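{- Let $M_G$ be a mixed graph of order $n$ and write $P_{M_G}(x)=\det(xI-N(M_G))=x^n+c_1x^{n-1}+\cdots+c_{n-1}x+c_n$. Then for each $k$, $$c_k=\sum_{M_{G'}}(-1)^{ -k+r(G')+l_{sn}(M_{G'})+l_n(M_{G'})}\cdot 2^{\,l_p(M_{G'})+l_n(M_{G'})},$$ where the sum is over all elementary mixed subgraphs $M_{G'}$ of $M_G$ with $k$ vertices, $G'$ is the underlying graph of $M_{G'}$, and $l_p(M_{G'}),l_n(M_{G'}),l_{sn}(M_{G'})$ are the numbers of positive, negative and semi-negative mixed cycles in $M_{G'}$, respectively.
   Context: A mixed graph $M_G$ is obtained from a finite simple graph $G$ by orienting the edges of some subset of $E(G)$. With $\omega=\frac{1+\mathbf{i}\sqrt3}{2}$, $N(M_G)=(n_{st})$ has $(u,v)$-entry $\omega$ if $\overrightarrow{uv}$ is an arc, $\bar\omega$ if $\overrightarrow{vu}$ is an arc, $1$ for an undirected edge, $0$ otherwise. A mixed subgraph of $M_G$ is a subgraph of $G$ with the edge directions inherited from $M_G$. An elementary mixed graph is one each of whose components is a single (possibly oriented) edge or a mixed cycle (a mixed graph whose underlying graph is a cycle). A mixed cycle $v_1\cdots v_lv_1$ has weight $n_{12}n_{23}\cdots n_{l1}$; it is positive if the weight is $1$, negative if $-1$, semi-negative if the weight is $-\omega$ or $-\bar\omega$ (semi-positive if $\omega$ or $\bar\omega$). For a simple graph $H$, $r(H)=|V(H)|-t(H)$ where $t(H)$ is the number of components. -}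

module Defs where

open import Data.Nat as ℕ using (ℕ; zero; suc; _∸_)
open import Data.Integer as ℤ using (ℤ; +_; -_)
open import Data.Fin as Fin using (Fin; toℕ; punchIn)
open import Data.Fin.Properties using () renaming (_≟_ to _≟F_)
open import Data.Bool using (Bool; true; false; _∧_; _∨_; not; if_then_else_)
open import Data.List as List using (List; []; _∷_; _++_; map; foldr; length; concatMap; allFin)
open import Data.Bool.ListAction using () renaming (any to anyL; all to allL)
open import Data.Maybe using (Maybe; just; nothing)
open import Data.Product using (_×_; _,_)
open import Relation.Nullary.Decidable using (⌊_⌋)
open import Relation.Binary.PropositionalEquality using (_≡_)

-- Eisenstein integers ℤ[ω], ω = (1 + i√3)/2, so ω² = ω - 1.
-- mkω a b  represents  a + b ω.

record ℤω : Set where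
  constructor mkω
  field
    re : ℤ
    im : ℤ

open ℤω public

0ω 1ω ω ω̄ : ℤω
0ω = mkω (+ 0) (+ 0)
1ω = mkω (+ 1) (+ 0)
ω  = mkω (+ 0) (+ 1)
ω̄  = mkω (+ 1) (- (+ 1))

_+ω_ : ℤω → ℤω → ℤω
mkω a b +ω mkω c d = mkω (a ℤ.+ c) (b ℤ.+ d)

-ω_ : ℤω → ℤω
-ω mkω a b = mkω (- a) (- b)

-- (a + bω)(c + dω) = (ac - bd) + (ad + bc + bd) ω
_*ω_ : ℤω → ℤω → ℤω
mkω a b *ω mkω c d = mkω (a ℤ.* c ℤ.- b ℤ.* d) (a ℤ.* d ℤ.+ b ℤ.* c ℤ.+ b ℤ.* d)

fromℤ : ℤ → ℤω
fromℤ z = mkω z (+ 0)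

_==ω_ : ℤω → ℤω → Bool
mkω a b ==ω mkω c d = ⌊ a ℤ.≟ c ⌋ ∧ ⌊ b ℤ.≟ d ⌋

-- Polynomials over ℤ[ω] as coefficient lists, lowest degree first.

Poly : Set
Poly = List ℤω

_+P_ : Poly → Poly → Poly
[] +P q = q
(a ∷ p) +P [] = a ∷ p
(a ∷ p) +P (b ∷ q) = (a +ω b) ∷ (p +P q)

scaleP : ℤω → Poly → Poly
scaleP c = map (c *ω_)

_*P_ : Poly → Poly → Poly
[] *P q = []
(a ∷ p) *P q = scaleP a q +P (0ω ∷ (p *P q))

-P_ : Poly → Poly
-P p = map -ω_ p

constP : ℤω → Poly
constP c = c ∷ []

X : Poly
X = 0ω ∷ 1ω ∷ []

coeff : Poly → ℕ → ℤω
coeff [] i = 0ω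
coeff (a ∷ p) zero = a
coeff (a ∷ p) (suc i) = coeff p i

altSign : ℕ → Poly → Poly
altSign zero p = p
altSign (suc zero) p = -P p
altSign (suc (suc k)) p = altSign k p

det : (n : ℕ) → (Fin n → Fin n → Poly) → Poly
det zero M = constP 1ω
det (suc n) M =
  foldr _+P_ []
    (map (λ j → altSign (toℕ j)
                  (M Fin.zero j *P det n (λ i k → M (Fin.suc i) (punchIn j k))))
         (allFin (suc n)))

-- Mixed graphs on the vertex set Fin n.
-- kind i j = arc   : the arc  i → j  is present
-- kind i j = rarc  : the arc  j → i  is present
-- kind i j = undir : undirected edge ij
-- kind i j = none  : i and j are not adjacent

data Kind : Set where
  none undir arc rarc : Kind

flipK : Kind → Kind
flipK none  = none
flipK undir = undir
flipK arc   = rarc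
flipK rarc  = arc

record MixedGraph (n : ℕ) : Set where
  field
    kind     : Fin n → Fin n → Kind
    loopless : ∀ i → kind i i ≡ none
    flip-sym : ∀ i j → kind j i ≡ flipK (kind i j)

open MixedGraph public

entry : Kind → ℤω
entry none  = 0ω
entry undir = 1ω
entry arc   = ω
entry rarc  = ω̄

N : ∀ {n} → MixedGraph n → Fin n → Fin n → ℤω
N G i j = entry (kind G i j)

charPoly : ∀ {n} → MixedGraph n → Poly
charPoly {n} G =
  det n (λ i j → (if ⌊ i ≟F j ⌋ then X else []) +P (-P constP (N G i j)))

c : ∀ {n} → MixedGraph n → ℕ → ℤω
c {n} G k = coeff (charPoly G) (n ∸ k)

-- Mixed subgraphs.  The edges of G are listed once each as (i , j) with
-- i < j.  A mixed subgraph without isolated vertices (in particular every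
-- elementary mixed subgraph) is determined by its edge set, a sublist of
-- this list; its vertex set is the set of endpoints of its edges, and the
-- directions are inherited from M_G via N.

isEdge : Kind → Bool
isEdge none = false
isEdge _    = true

edges : ∀ {n} → MixedGraph n → List (Fin n × Fin n)
edges {n} G =
  concatMap (λ i → concatMap (λ j →
      if ⌊ i Fin.<? j ⌋ ∧ isEdge (kind G i j) then (i , j) ∷ [] else [])
    (allFin n)) (allFin n)

sublists : ∀ {A : Set} → List A → List (List A)
sublists [] = [] ∷ []
sublists (x ∷ xs) = sublists xs ++ map (x ∷_) (sublists xs)

Edges : ℕ → Set
Edges n = List (Fin n × Fin n)

count : ∀ {n} → (Fin n → Bool) → ℕ
count {n} p = length (List.filterᵇ p (allFin n))

anyF : ∀ {n} → (Fin n → Bool) → Bool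
anyF {n} p = anyL p (allFin n)

allF : ∀ {n} → (Fin n → Bool) → Bool
allF {n} p = allL p (allFin n)

nbrs : ∀ {n} → Edges n → Fin n → List (Fin n)
nbrs S v = concatMap f S
  where
  f : _ → List _
  f (a , b) = if ⌊ a ≟F v ⌋ then b ∷ []
              else if ⌊ b ≟F v ⌋ then a ∷ [] else []

deg : ∀ {n} → Edges n → Fin n → ℕ
deg S v = length (nbrs S v)

adjS : ∀ {n} → Edges n → Fin n → Fin n → Bool
adjS S u w = anyL (λ x → ⌊ x ≟F w ⌋) (nbrs S u)

inV : ∀ {n} → Edges n → Fin n → Bool
inV S v = not (ℕ._≡ᵇ_ (deg S v) 0)

nV : ∀ {n} → Edges n → ℕ
nV S = count (inV S)

-- connected component of v (vertices reachable from v; n rounds suffice)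
iter : ∀ {A : Set} → ℕ → (A → A) → A → A
iter zero f a = a
iter (suc m) f a = f (iter m f a)

comp : ∀ {n} → Edges n → Fin n → Fin n → Bool
comp {n} S v = iter n step (λ u → ⌊ u ≟F v ⌋)
  where
  step : (Fin n → Bool) → (Fin n → Bool)
  step R u = R u ∨ anyF (λ w → R w ∧ adjS S w u)

compSize : ∀ {n} → Edges n → Fin n → ℕ
compSize S v = count (comp S v)

isRep : ∀ {n} → Edges n → Fin n → Bool
isRep S v = inV S v ∧ allF (λ u → not (comp S v u) ∨ ⌊ v Fin.≤? u ⌋)

-- the component of v is a cycle: connected and 2-regular
compIsCycle : ∀ {n} → Edges n → Fin n → Bool
compIsCycle S v = allF (λ u → not (comp S v u) ∨ ℕ._≡ᵇ_ (deg S u) 2)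

-- the component of v is a single edge: connected on exactly two vertices
compIsEdge : ∀ {n} → Edges n → Fin n → Bool
compIsEdge S v = ℕ._≡ᵇ_ (compSize S v) 2

isElementary : ∀ {n} → Edges n → Bool
isElementary S = allF (λ v → not (inV S v) ∨ (compIsEdge S v ∨ compIsCycle S v))

tC : ∀ {n} → Edges n → ℕ
tC S = count (isRep S)

rk : ∀ {n} → Edges n → ℕ
rk S = nV S ∸ tC S

-- weight n_{12} n_{23} ... n_{l1} of the cycle component through v,
-- traversed v = v_1, v_2, ..., v_l, v_1 (l = size of the component)
headM : ∀ {A : Set} → List A → Maybe A
headM [] = nothing
headM (x ∷ _) = just x

cycleWeight : ∀ {n} → MixedGraph n → Edges n → Fin n → ℤω
cycleWeight {n} G S v with headM (nbrs S v)
... | nothing = 0ω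
... | just v₂ = N G v v₂ *ω go (compSize S v ∸ 2) v v₂
  where
  go : ℕ → Fin n → Fin n → ℤω
  go zero prev cur = N G cur v
  go (suc m) prev cur with headM (List.filterᵇ (λ x → not ⌊ x ≟F prev ⌋) (nbrs S cur))
  ... | nothing = 0ω
  ... | just nxt = N G cur nxt *ω go m cur nxt

isCycleRep : ∀ {n} → Edges n → Fin n → Bool
isCycleRep S v = isRep S v ∧ compIsCycle S v

l-p l-n l-sn : ∀ {n} → MixedGraph n → Edges n → ℕ
l-p  G S = count (λ v → isCycleRep S v ∧ (cycleWeight G S v ==ω 1ω))
l-n  G S = count (λ v → isCycleRep S v ∧ (cycleWeight G S v ==ω (-ω 1ω)))
l-sn G S = count (λ v → isCycleRep S v ∧
                   ((cycleWeight G S v ==ω (-ω ω)) ∨ (cycleWeight G S v ==ω (-ω ω̄))))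

-- (-1)^m as an integer (note (-1)^(-k) = (-1)^k)
minusOnePow : ℕ → ℤ
minusOnePow zero = + 1
minusOnePow (suc m) = - minusOnePow m

sumℤ : List ℤ → ℤ
sumℤ = foldr ℤ._+_ (+ 0)

rhs : ∀ {n} → MixedGraph n → ℕ → ℤ
rhs G k =
  sumℤ (map term (List.filterᵇ (λ S → isElementary S ∧ ℕ._≡ᵇ_ (nV S) k)
                               (sublists (edges G))))
  where
  term : _ → ℤ
  term S = minusOnePow (k ℕ.+ rk S ℕ.+ l-sn G S ℕ.+ l-n G S)
           ℤ.* (+ (2 ℕ.^ (l-p G S ℕ.+ l-n G S)))

{-# OPTIONS --safe #-}
module Submission where

-- Expanding the minor of xI − N with rows u ∷ V and columns v ∷ V along its first row gives a
-- recursion with uniform signs, which writes det (xI − N) as a sum over systems of disjoint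
-- closed walks: from the least unvisited vertex, walk through new vertices until the walk closes.
-- Each system uses the edges of exactly one S ⊆ E(G), so the determinant is the sum over S of the
-- systems with edge set S.  For fixed S the walk is forced after its first step: an isolated
-- vertex contributes x, a component that is neither an edge nor a cycle admits no walk, an edge
-- is traversed back and forth with weight −1, and a cycle is traversed in its two directions,
-- with total weight −(w + w̄) for w the weight of the mixed cycle.

open import Defs
open import Level using (0ℓ; _⊔_)
open import Algebra.Bundles using (CommutativeRing)
open import Data.Nat as ℕ using (ℕ; zero; suc; _≤_; _<_; z≤n; s≤s)
import Data.Nat.Properties as ℕₚ
open import Data.Integer as ℤ using (ℤ; +_; -[1+_])
import Data.Integer.Properties as ℤₚ
open import Data.Integer.Tactic.RingSolver using (solve-∀)
open import Data.Fin as Fin using (Fin; toℕ; punchIn)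
import Data.Fin.Properties as Finₚ
open import Data.Bool using (Bool; true; false; _∧_; _∨_; not; if_then_else_; T)
import Data.Bool.Properties as Boolₚ
open import Data.Bool.ListAction using () renaming (any to anyL; all to allL)
open import Data.Maybe using (Maybe; just)
open import Data.List as List using (List; []; _∷_; _++_; map; foldr; length; filter; concatMap; tabulate; allFin; cartesianProduct)
import Data.List.Properties as Listₚ
open import Data.List.Membership.Propositional using (_∈_; _∉_)
open import Data.List.Membership.Propositional.Properties
open import Data.List.Relation.Unary.Any using (Any; here; there)
open import Data.List.Relation.Unary.All as All using (All; []; _∷_)
open import Data.List.Relation.Unary.AllPairs as AllPairs using (AllPairs; []; _∷_)
import Data.List.Relation.Unary.AllPairs.Properties as AllPairsₚ
open import Data.List.Relation.Unary.Unique.Propositional using (Unique)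
import Data.List.Relation.Unary.Unique.Propositional.Properties as Uniqueₚ
open import Data.Product using (_×_; _,_; ∃; proj₁; proj₂)
open import Data.Sum as Sum using (_⊎_; inj₁; inj₂)
open import Data.Unit using (tt)
open import Data.Empty using (⊥; ⊥-elim)
open import Relation.Nullary using (Dec; ¬_; yes; no; contradiction)
open import Relation.Nullary.Decidable using (⌊_⌋; ¬?)
open import Relation.Binary.Definitions using (tri<; tri≈; tri>)
open import Relation.Binary.PropositionalEquality using (_≡_; _≢_; refl; sym; trans; cong; cong₂; subst; ≢-sym; isEquivalence; module ≡-Reasoning)
open import Function using (_∘_; id)

-- Eisenstein integers and polynomials over them

-- The obstacle is that the edge set of a system of walks is known only once its last walk has
-- closed. The expansion therefore carries a record `U` of the traversed pairs and a terminal value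
-- `L`, which inspects `U` at the very end. The expansion is linear in `L`, and for each `U` the
-- indicators "`U` matches S" add up to 1 over all S. Replacing `L = 1` by this sum splits the
-- determinant by edge sets without enumerating walks or permutations. Once S is fixed, a branch can
-- be discarded as soon as it has used an edge outside S or abandoned an edge of S; at most two
-- first steps then survive at each root. The unvisited vertices stay sorted, so every walk is
-- rooted at the least vertex of its component. This is the vertex that `isRep` selects, hence the
-- one at which components and cycles are counted, and the whole contribution of an elementary
-- component can be assigned to it.

+ω-assoc : ∀ x y z → (x +ω y) +ω z ≡ x +ω (y +ω z)
+ω-assoc x y z = cong₂ mkω (ℤₚ.+-assoc (re x) (re y) (re z)) (ℤₚ.+-assoc (im x) (im y) (im z))

+ω-comm : ∀ x y → x +ω y ≡ y +ω x
+ω-comm x y = cong₂ mkω (ℤₚ.+-comm (re x) (re y)) (ℤₚ.+-comm (im x) (im y))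

+ω-identityˡ : ∀ x → 0ω +ω x ≡ x
+ω-identityˡ x = cong₂ mkω (ℤₚ.+-identityˡ (re x)) (ℤₚ.+-identityˡ (im x))

+ω-identityʳ : ∀ x → x +ω 0ω ≡ x
+ω-identityʳ x = cong₂ mkω (ℤₚ.+-identityʳ (re x)) (ℤₚ.+-identityʳ (im x))

+ω-inverseʳ : ∀ x → x +ω (-ω x) ≡ 0ω
+ω-inverseʳ x = cong₂ mkω (ℤₚ.+-inverseʳ (re x)) (ℤₚ.+-inverseʳ (im x))

+ω-inverseˡ : ∀ x → (-ω x) +ω x ≡ 0ω
+ω-inverseˡ x = cong₂ mkω (ℤₚ.+-inverseˡ (re x)) (ℤₚ.+-inverseˡ (im x))

*ω-comm : ∀ x y → x *ω y ≡ y *ω x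
*ω-comm (mkω a b) (mkω c d) = cong₂ mkω (eqr a b c d) (eqi a b c d)
  where
  eqr : ∀ a b c d → a ℤ.* c ℤ.- b ℤ.* d ≡ c ℤ.* a ℤ.- d ℤ.* b
  eqr = solve-∀
  eqi : ∀ a b c d → a ℤ.* d ℤ.+ b ℤ.* c ℤ.+ b ℤ.* d ≡ c ℤ.* b ℤ.+ d ℤ.* a ℤ.+ d ℤ.* b
  eqi = solve-∀

*ω-assoc : ∀ x y z → (x *ω y) *ω z ≡ x *ω (y *ω z)
*ω-assoc (mkω a b) (mkω c d) (mkω e f) = cong₂ mkω (eqr a b c d e f) (eqi a b c d e f)
  where
  eqr : ∀ a b c d e f →
    (a ℤ.* c ℤ.- b ℤ.* d) ℤ.* e ℤ.- (a ℤ.* d ℤ.+ b ℤ.* c ℤ.+ b ℤ.* d) ℤ.* f ≡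
    a ℤ.* (c ℤ.* e ℤ.- d ℤ.* f) ℤ.- b ℤ.* (c ℤ.* f ℤ.+ d ℤ.* e ℤ.+ d ℤ.* f)
  eqr = solve-∀
  eqi : ∀ a b c d e f →
    (a ℤ.* c ℤ.- b ℤ.* d) ℤ.* f ℤ.+ (a ℤ.* d ℤ.+ b ℤ.* c ℤ.+ b ℤ.* d) ℤ.* e
      ℤ.+ (a ℤ.* d ℤ.+ b ℤ.* c ℤ.+ b ℤ.* d) ℤ.* f ≡
    a ℤ.* (c ℤ.* f ℤ.+ d ℤ.* e ℤ.+ d ℤ.* f) ℤ.+ b ℤ.* (c ℤ.* e ℤ.- d ℤ.* f)
      ℤ.+ b ℤ.* (c ℤ.* f ℤ.+ d ℤ.* e ℤ.+ d ℤ.* f)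
  eqi = solve-∀

*ω-distribˡ : ∀ x y z → x *ω (y +ω z) ≡ (x *ω y) +ω (x *ω z)
*ω-distribˡ (mkω a b) (mkω c d) (mkω e f) = cong₂ mkω (eqr a b c d e f) (eqi a b c d e f)
  where
  eqr : ∀ a b c d e f →
    a ℤ.* (c ℤ.+ e) ℤ.- b ℤ.* (d ℤ.+ f) ≡
    (a ℤ.* c ℤ.- b ℤ.* d) ℤ.+ (a ℤ.* e ℤ.- b ℤ.* f)
  eqr = solve-∀
  eqi : ∀ a b c d e f →
    a ℤ.* (d ℤ.+ f) ℤ.+ b ℤ.* (c ℤ.+ e) ℤ.+ b ℤ.* (d ℤ.+ f) ≡
    (a ℤ.* d ℤ.+ b ℤ.* c ℤ.+ b ℤ.* d) ℤ.+ (a ℤ.* f ℤ.+ b ℤ.* e ℤ.+ b ℤ.* f)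
  eqi = solve-∀

*ω-identityˡ : ∀ x → 1ω *ω x ≡ x
*ω-identityˡ (mkω a b) = cong₂ mkω (eqr a b) (eqi a b)
  where
  eqr : ∀ a b → + 1 ℤ.* a ℤ.- + 0 ℤ.* b ≡ a
  eqr = solve-∀
  eqi : ∀ a b → + 1 ℤ.* b ℤ.+ + 0 ℤ.* a ℤ.+ + 0 ℤ.* b ≡ b
  eqi = solve-∀

*ω-identityʳ : ∀ x → x *ω 1ω ≡ x
*ω-identityʳ x = trans (*ω-comm x 1ω) (*ω-identityˡ x)

*ω-distribʳ : ∀ x y z → (y +ω z) *ω x ≡ (y *ω x) +ω (z *ω x)
*ω-distribʳ x y z = trans (*ω-comm (y +ω z) x)
  (trans (*ω-distribˡ x y z) (cong₂ _+ω_ (*ω-comm x y) (*ω-comm x z)))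

ℤω-commutativeRing : CommutativeRing 0ℓ 0ℓ
ℤω-commutativeRing = record
  { Carrier = ℤω ; _≈_ = _≡_ ; _+_ = _+ω_ ; _*_ = _*ω_ ; -_ = -ω_ ; 0# = 0ω ; 1# = 1ω
  ; isCommutativeRing = record
    { isRing = record
      { +-isAbelianGroup = record
        { isGroup = record
          { isMonoid = record
            { isSemigroup = record
              { isMagma = record { isEquivalence = isEquivalence ; ∙-cong = cong₂ _+ω_ }
              ; assoc = +ω-assoc }
            ; identity = +ω-identityˡ , +ω-identityʳ }
          ; inverse = +ω-inverseˡ , +ω-inverseʳ
          ; ⁻¹-cong = cong -ω_ }
        ; comm = +ω-comm }
      ; *-cong = cong₂ _*ω_
      ; *-assoc = *ω-assoc
      ; *-identity = *ω-identityˡ , *ω-identityʳ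
      ; distrib = *ω-distribˡ , *ω-distribʳ }
    ; *-comm = *ω-comm } }

open import Algebra.Properties.Ring (CommutativeRing.ring ℤω-commutativeRing) public
  using () renaming (-0#≈0# to -ω0≡0)

module ω = CommutativeRing ℤω-commutativeRing

-- The ring of polynomials up to equality of coefficients.

infix 4 _≈P_

-- Coefficient lists are not normalised: `constP 0ω` and `[]` are different lists for the same
-- polynomial, so ring laws such as the one for additive inverses hold only in this sense.
_≈P_ : Poly → Poly → Set
p ≈P q = ∀ i → coeff p i ≡ coeff q i

coeff-+P : ∀ p q i → coeff (p +P q) i ≡ coeff p i +ω coeff q i
coeff-+P []      q       i       = sym (+ω-identityˡ _)
coeff-+P (a ∷ p) []      i       = sym (+ω-identityʳ _)
coeff-+P (a ∷ p) (b ∷ q) zero    = refl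
coeff-+P (a ∷ p) (b ∷ q) (suc i) = coeff-+P p q i

coeff-scaleP : ∀ c p i → coeff (scaleP c p) i ≡ c *ω coeff p i
coeff-scaleP c []      i       = sym (ω.zeroʳ c)
coeff-scaleP c (a ∷ p) zero    = refl
coeff-scaleP c (a ∷ p) (suc i) = coeff-scaleP c p i

coeff--P : ∀ p i → coeff (-P p) i ≡ -ω coeff p i
coeff--P []      i       = sym -ω0≡0
coeff--P (a ∷ p) zero    = refl
coeff--P (a ∷ p) (suc i) = coeff--P p i

shift : Poly → Poly
shift p = 0ω ∷ p

shift-cong : ∀ p q → p ≈P q → shift p ≈P shift q
shift-cong p q e zero    = refl
shift-cong p q e (suc i) = e i

+P-cong : ∀ p p′ q q′ → p ≈P p′ → q ≈P q′ → p +P q ≈P p′ +P q′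
+P-cong p p′ q q′ e f i =
  trans (coeff-+P p q i) (trans (cong₂ _+ω_ (e i) (f i)) (sym (coeff-+P p′ q′ i)))

scaleP-cong : ∀ c p q → p ≈P q → scaleP c p ≈P scaleP c q
scaleP-cong c p q e i =
  trans (coeff-scaleP c p i) (trans (cong (c *ω_) (e i)) (sym (coeff-scaleP c q i)))

-P-cong : ∀ {p q} → p ≈P q → -P p ≈P -P q
-P-cong {p} {q} e i = trans (coeff--P p i) (trans (cong -ω_ (e i)) (sym (coeff--P q i)))

+P-assoc : ∀ p q r → (p +P q) +P r ≈P p +P (q +P r)
+P-assoc p q r i = begin
  coeff ((p +P q) +P r) i                 ≡⟨ coeff-+P (p +P q) r i ⟩
  coeff (p +P q) i +ω coeff r i           ≡⟨ cong (_+ω coeff r i) (coeff-+P p q i) ⟩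
  (coeff p i +ω coeff q i) +ω coeff r i   ≡⟨ +ω-assoc (coeff p i) (coeff q i) (coeff r i) ⟩
  coeff p i +ω (coeff q i +ω coeff r i)   ≡⟨ cong (coeff p i +ω_) (coeff-+P q r i) ⟨
  coeff p i +ω coeff (q +P r) i           ≡⟨ coeff-+P p (q +P r) i ⟨
  coeff (p +P (q +P r)) i                 ∎
  where open ≡-Reasoning

+P-comm : ∀ p q → p +P q ≈P q +P p
+P-comm p q i = trans (coeff-+P p q i)
  (trans (+ω-comm (coeff p i) (coeff q i)) (sym (coeff-+P q p i)))

+P-identityʳ : ∀ p → p +P [] ≈P p
+P-identityʳ p i = trans (coeff-+P p [] i) (+ω-identityʳ _)

+P-inverseʳ : ∀ p → p +P (-P p) ≈P []
+P-inverseʳ p i = trans (coeff-+P p (-P p) i)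
  (trans (cong (coeff p i +ω_) (coeff--P p i)) (+ω-inverseʳ (coeff p i)))

+P-inverseˡ : ∀ p → (-P p) +P p ≈P []
+P-inverseˡ p i = trans (+P-comm (-P p) p i) (+P-inverseʳ p i)

coeff-∷* : ∀ a p q i → coeff ((a ∷ p) *P q) i ≡ (a *ω coeff q i) +ω coeff (shift (p *P q)) i
coeff-∷* a p q i = trans (coeff-+P (scaleP a q) (shift (p *P q)) i)
  (cong (_+ω coeff (shift (p *P q)) i) (coeff-scaleP a q i))

open import Algebra.Properties.CommutativeSemigroup ω.+-commutativeSemigroup
  using () renaming (interchange to +ω-interchange; x∙yz≈y∙xz to +ω-leftComm)

shift-+P : ∀ p q → shift (p +P q) ≈P shift p +P shift q
shift-+P p q zero    = sym (+ω-identityˡ 0ω)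
shift-+P p q (suc i) = refl

*P-distribʳ : ∀ r p q → (p +P q) *P r ≈P (p *P r) +P (q *P r)
*P-distribʳ r []      q       i = refl
*P-distribʳ r (a ∷ p) []      i = sym (+P-identityʳ ((a ∷ p) *P r) i)
*P-distribʳ r (a ∷ p) (b ∷ q) i = begin
  coeff (((a +ω b) ∷ (p +P q)) *P r) i
    ≡⟨ coeff-∷* (a +ω b) (p +P q) r i ⟩
  ((a +ω b) *ω coeff r i) +ω coeff (shift ((p +P q) *P r)) i
    ≡⟨ cong₂ _+ω_ (*ω-distribʳ (coeff r i) a b)
         (trans (shift-cong ((p +P q) *P r) ((p *P r) +P (q *P r)) (*P-distribʳ r p q) i)
           (trans (shift-+P (p *P r) (q *P r) i) (coeff-+P (shift (p *P r)) (shift (q *P r)) i))) ⟩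
  ((a *ω coeff r i) +ω (b *ω coeff r i))
    +ω (coeff (shift (p *P r)) i +ω coeff (shift (q *P r)) i)
    ≡⟨ +ω-interchange (a *ω coeff r i) (b *ω coeff r i) _ _ ⟩
  ((a *ω coeff r i) +ω coeff (shift (p *P r)) i)
    +ω ((b *ω coeff r i) +ω coeff (shift (q *P r)) i)
    ≡⟨ cong₂ _+ω_ (coeff-∷* a p r i) (coeff-∷* b q r i) ⟨
  coeff ((a ∷ p) *P r) i +ω coeff ((b ∷ q) *P r) i
    ≡⟨ coeff-+P ((a ∷ p) *P r) ((b ∷ q) *P r) i ⟨
  coeff (((a ∷ p) *P r) +P ((b ∷ q) *P r)) i ∎
  where open ≡-Reasoning

scaleP-*P : ∀ c p q → scaleP c p *P q ≈P scaleP c (p *P q)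
scaleP-*P c []      q i = refl
scaleP-*P c (a ∷ p) q i = begin
  coeff (((c *ω a) ∷ scaleP c p) *P q) i
    ≡⟨ coeff-∷* (c *ω a) (scaleP c p) q i ⟩
  ((c *ω a) *ω coeff q i) +ω coeff (shift (scaleP c p *P q)) i
    ≡⟨ cong₂ _+ω_ (*ω-assoc c a (coeff q i)) (trans (shift-cong (scaleP c p *P q) (scaleP c (p *P q)) (scaleP-*P c p q) i) (lem i)) ⟩
  (c *ω (a *ω coeff q i)) +ω (c *ω coeff (shift (p *P q)) i)
    ≡⟨ *ω-distribˡ c (a *ω coeff q i) _ ⟨
  c *ω ((a *ω coeff q i) +ω coeff (shift (p *P q)) i)
    ≡⟨ cong (c *ω_) (coeff-∷* a p q i) ⟨
  c *ω coeff ((a ∷ p) *P q) i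
    ≡⟨ coeff-scaleP c ((a ∷ p) *P q) i ⟨
  coeff (scaleP c ((a ∷ p) *P q)) i ∎
  where
  open ≡-Reasoning
  lem : ∀ i → coeff (shift (scaleP c (p *P q))) i ≡ c *ω coeff (shift (p *P q)) i
  lem zero    = sym (ω.zeroʳ c)
  lem (suc i) = coeff-scaleP c (p *P q) i

shift-*P : ∀ p q → shift p *P q ≈P shift (p *P q)
shift-*P p q i = trans (coeff-∷* 0ω p q i)
  (trans (cong (_+ω coeff (shift (p *P q)) i) (ω.zeroˡ (coeff q i))) (+ω-identityˡ _))

*P-congʳ : ∀ p q q′ → q ≈P q′ → p *P q ≈P p *P q′
*P-congʳ []      q q′ e i = refl
*P-congʳ (a ∷ p) q q′ e = +P-cong (scaleP a q) (scaleP a q′) (shift (p *P q)) (shift (p *P q′))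
  (scaleP-cong a q q′ e) (shift-cong (p *P q) (p *P q′) (*P-congʳ p q q′ e))

*P-assoc : ∀ p q r → (p *P q) *P r ≈P p *P (q *P r)
*P-assoc []      q r i = refl
*P-assoc (a ∷ p) q r i = trans (*P-distribʳ r (scaleP a q) (shift (p *P q)) i)
  (+P-cong (scaleP a q *P r) (scaleP a (q *P r)) (shift (p *P q) *P r) (shift (p *P (q *P r)))
    (scaleP-*P a q r)
    (λ j → trans (shift-*P (p *P q) r j)
      (shift-cong ((p *P q) *P r) (p *P (q *P r)) (*P-assoc p q r) j)) i)

*P-zeroʳ : ∀ p → p *P [] ≈P []
*P-zeroʳ []      i       = refl
*P-zeroʳ (a ∷ p) zero    = refl
*P-zeroʳ (a ∷ p) (suc i) = *P-zeroʳ p i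

-- `_*P_` recurses on its left factor. This is the matching recursion on the right factor, which
-- makes commutativity an induction.
*P-∷ : ∀ p b q → p *P (b ∷ q) ≈P scaleP b p +P shift (p *P q)
*P-∷ []      b q zero    = refl
*P-∷ []      b q (suc i) = refl
*P-∷ (a ∷ p) b q zero    = cong (_+ω 0ω) (*ω-comm a b)
*P-∷ (a ∷ p) b q (suc i) = begin
  coeff (scaleP a q +P (p *P (b ∷ q))) i
    ≡⟨ coeff-+P (scaleP a q) (p *P (b ∷ q)) i ⟩
  coeff (scaleP a q) i +ω coeff (p *P (b ∷ q)) i
    ≡⟨ cong (coeff (scaleP a q) i +ω_)
         (trans (*P-∷ p b q i) (coeff-+P (scaleP b p) (shift (p *P q)) i)) ⟩
  coeff (scaleP a q) i +ω (coeff (scaleP b p) i +ω coeff (shift (p *P q)) i)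
    ≡⟨ +ω-leftComm (coeff (scaleP a q) i) (coeff (scaleP b p) i) _ ⟩
  coeff (scaleP b p) i +ω (coeff (scaleP a q) i +ω coeff (shift (p *P q)) i)
    ≡⟨ cong (coeff (scaleP b p) i +ω_) (coeff-+P (scaleP a q) (shift (p *P q)) i) ⟨
  coeff (scaleP b p) i +ω coeff ((a ∷ p) *P q) i
    ≡⟨ coeff-+P (scaleP b p) ((a ∷ p) *P q) i ⟨
  coeff (scaleP b p +P ((a ∷ p) *P q)) i ∎
  where open ≡-Reasoning

*P-comm : ∀ p q → p *P q ≈P q *P p
*P-comm []      q i = sym (*P-zeroʳ q i)
*P-comm (a ∷ p) q i =
  trans (+P-cong (scaleP a q) (scaleP a q) (shift (p *P q)) (shift (q *P p)) (λ _ → refl)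
          (shift-cong (p *P q) (q *P p) (*P-comm p q)) i)
        (sym (*P-∷ q a p i))

-- Equal polynomials may be lists of different lengths, which makes an induction on the left factor
-- awkward; congruence on the left is carried over from the right by commutativity.
*P-cong : ∀ p p′ q q′ → p ≈P p′ → q ≈P q′ → p *P q ≈P p′ *P q′
*P-cong p p′ q q′ e f i =
  trans (*P-congʳ p q q′ f i) (trans (*P-comm p q′ i) (trans (*P-congʳ q′ p p′ e i) (*P-comm q′ p′ i)))

constP-*P : ∀ c p → constP c *P p ≈P scaleP c p
constP-*P c p i = trans (coeff-+P (scaleP c p) (shift []) i)
  (trans (cong (coeff (scaleP c p) i +ω_) (z i)) (+ω-identityʳ _))
  where
  z : ∀ i → coeff (shift []) i ≡ 0ω
  z zero    = refl
  z (suc i) = refl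

*P-identityˡ : ∀ p → constP 1ω *P p ≈P p
*P-identityˡ p i = trans (constP-*P 1ω p i) (trans (coeff-scaleP 1ω p i) (*ω-identityˡ _))

*P-distribˡ : ∀ r p q → r *P (p +P q) ≈P (r *P p) +P (r *P q)
*P-distribˡ r p q i = trans (*P-comm r (p +P q) i)
  (trans (*P-distribʳ r p q i) (+P-cong (p *P r) (r *P p) (q *P r) (r *P q) (*P-comm p r) (*P-comm q r) i))

Poly-commutativeRing : CommutativeRing 0ℓ 0ℓ
Poly-commutativeRing = record
  { Carrier = Poly ; _≈_ = _≈P_ ; _+_ = _+P_ ; _*_ = _*P_ ; -_ = -P_ ; 0# = [] ; 1# = constP 1ω
  ; isCommutativeRing = record
    { isRing = record
      { +-isAbelianGroup = record
        { isGroup = record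
          { isMonoid = record
            { isSemigroup = record
              { isMagma = record
                { isEquivalence = record
                  { refl = λ _ → refl ; sym = λ e i → sym (e i) ; trans = λ e f i → trans (e i) (f i) }
                ; ∙-cong = λ {p} {p′} {q} {q′} → +P-cong p p′ q q′ }
              ; assoc = +P-assoc }
            ; identity = (λ _ _ → refl) , +P-identityʳ }
          ; inverse = +P-inverseˡ , +P-inverseʳ
          ; ⁻¹-cong = λ {p} {q} → -P-cong {p} {q} }
        ; comm = +P-comm }
      ; *-cong = λ {p} {p′} {q} {q′} → *P-cong p p′ q q′
      ; *-assoc = *P-assoc
      ; *-identity = *P-identityˡ , λ p i → trans (*P-comm p (constP 1ω) i) (*P-identityˡ p i)
      ; distrib = *P-distribˡ , *P-distribʳ }
    ; *-comm = *P-comm } }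

constP-* : ∀ a b → constP (a *ω b) ≈P constP a *P constP b
constP-* a b zero    = sym (+ω-identityʳ (a *ω b))
constP-* a b (suc i) = refl

constP-0 : constP 0ω ≈P []
constP-0 zero    = refl
constP-0 (suc i) = refl

-- Determinants as sums over closed walks

_==_ : ∀ {n} → Fin n → Fin n → Bool
a == b = ⌊ a Finₚ.≟ b ⌋

remove : ∀ {n} → Fin n → List (Fin n) → List (Fin n)
remove w = filter (λ y → ¬? (y Finₚ.≟ w))

remove-≢ : ∀ {n} {a w : Fin n} V → a ≢ w → remove w (a ∷ V) ≡ a ∷ remove w V
remove-≢ {w = w} V a≢w = Listₚ.filter-accept (λ y → ¬? (y Finₚ.≟ w)) a≢w

remove-∉ : ∀ {n} {w : Fin n} V → All (w ≢_) V → remove w V ≡ V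
remove-∉ {w = w} V w∉ = Listₚ.filter-all (λ y → ¬? (y Finₚ.≟ w)) (All.map (_∘ sym) w∉)

remove-head : ∀ {n} {w : Fin n} V → All (w ≢_) V → remove w (w ∷ V) ≡ V
remove-head {w = w} V w∉ =
  trans (Listₚ.filter-reject (λ y → ¬? (y Finₚ.≟ w)) (λ k → k refl)) (remove-∉ V w∉)

length-remove-∈ : ∀ {n} {w : Fin n} {V} → w ∈ V → length (remove w V) < length V
length-remove-∈ {w = w} w∈ = Listₚ.filter-notAll (λ y → ¬? (y Finₚ.≟ w)) _ (go w∈)
  where
  go : ∀ {V} → w ∈ V → Any (λ y → ¬ (y ≢ w)) V
  go (here e)  = here (λ k → k (sym e))
  go (there p) = there (go p)

-- U a b holds once the edge ab has been traversed, in either direction.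
Used : ℕ → Set
Used n = Fin n → Fin n → Bool

add : ∀ {n} → Fin n → Fin n → Used n → Used n
add w x U a b = U a b ∨ (((a == w) ∧ (b == x)) ∨ ((a == x) ∧ (b == w)))

module RingSums {c ℓ} (R : CommutativeRing c ℓ) where
  open CommutativeRing R hiding (zero) renaming (refl to ≈-refl; sym to ≈-sym; trans to ≈-trans)
  open import Algebra.Properties.CommutativeSemigroup +-commutativeSemigroup using (interchange)

  ∑ : ∀ {a} {A : Set a} → List A → (A → Carrier) → Carrier
  ∑ []      f = 0#
  ∑ (x ∷ V) f = f x + ∑ V f

  ∏ : ∀ {a} {A : Set a} → List A → (A → Carrier) → Carrier
  ∏ []      f = 1#
  ∏ (x ∷ V) f = f x * ∏ V f

  module _ {a} {A : Set a} where

    ∑-cong∈ : ∀ V {f g : A → Carrier} → (∀ {x} → x ∈ V → f x ≈ g x) → ∑ V f ≈ ∑ V g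
    ∑-cong∈ []      e = ≈-refl
    ∑-cong∈ (x ∷ V) e = +-cong (e (here refl)) (∑-cong∈ V (e ∘ there))

    ∑-cong : ∀ V {f g : A → Carrier} → (∀ x → f x ≈ g x) → ∑ V f ≈ ∑ V g
    ∑-cong V e = ∑-cong∈ V (λ {x} _ → e x)

    ∑-zero∈ : ∀ V {f : A → Carrier} → (∀ {x} → x ∈ V → f x ≈ 0#) → ∑ V f ≈ 0#
    ∑-zero∈ []      e = ≈-refl
    ∑-zero∈ (x ∷ V) e = ≈-trans (+-cong (e (here refl)) (∑-zero∈ V (e ∘ there))) (+-identityˡ 0#)

    ∑-+ : ∀ V (f g : A → Carrier) → ∑ V (λ x → f x + g x) ≈ ∑ V f + ∑ V g
    ∑-+ []      f g = ≈-sym (+-identityˡ 0#)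
    ∑-+ (x ∷ V) f g = ≈-trans (+-congˡ (∑-+ V f g)) (interchange (f x) (g x) _ _)

    ∑-++ : ∀ V W (f : A → Carrier) → ∑ (V ++ W) f ≈ ∑ V f + ∑ W f
    ∑-++ []      W f = ≈-sym (+-identityˡ _)
    ∑-++ (x ∷ V) W f = ≈-trans (+-congˡ (∑-++ V W f)) (≈-sym (+-assoc _ _ _))

  ∑-map : ∀ {a b} {A : Set a} {B : Set b} (g : A → B) V (f : B → Carrier) →
          ∑ (map g V) f ≈ ∑ V (f ∘ g)
  ∑-map g []      f = ≈-refl
  ∑-map g (x ∷ V) f = +-congˡ (∑-map g V f)

module Determinant {c ℓ} (R : CommutativeRing c ℓ) where
  open CommutativeRing R hiding (zero) renaming (refl to ≈-refl; sym to ≈-sym; trans to ≈-trans)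
  open import Algebra.Properties.Ring ring
    using (-‿+-comm; -0#≈0#; -‿involutive; -‿distribʳ-*)
  open import Algebra.Properties.CommutativeSemigroup *-commutativeSemigroup
    using () renaming (x∙yz≈y∙xz to *-leftComm)
  open import Algebra.Properties.CommutativeSemigroup +-commutativeSemigroup
    using () renaming (x∙yz≈y∙xz to +-leftComm)
  open import Relation.Binary.Reasoning.Setoid setoid
  open RingSums R

  -- Alternating and plain sums over the ways of picking one entry from a list.
  altP sumP : ∀ {a} {A : Set a} → (A → List A → Carrier) → List A → Carrier
  altP h []       = 0#
  altP h (c ∷ cs) = h c cs - altP (λ d ds → h d (c ∷ ds)) cs
  sumP h []       = 0#
  sumP h (c ∷ cs) = h c cs + sumP (λ d ds → h d (c ∷ ds)) cs

  module _ {a} {A : Set a} where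

    altP-cong : ∀ {h h′ : A → List A → Carrier} → (∀ c cs → h c cs ≈ h′ c cs) →
                ∀ cs → altP h cs ≈ altP h′ cs
    altP-cong e []       = ≈-refl
    altP-cong e (c ∷ cs) = +-cong (e c cs) (-‿cong (altP-cong (λ d ds → e d (c ∷ ds)) cs))

    sumP-cong : ∀ {h h′ : A → List A → Carrier} → (∀ c cs → h c cs ≈ h′ c cs) →
                ∀ cs → sumP h cs ≈ sumP h′ cs
    sumP-cong e []       = ≈-refl
    sumP-cong e (c ∷ cs) = +-cong (e c cs) (sumP-cong (λ d ds → e d (c ∷ ds)) cs)

    altP-+ : ∀ (h k : A → List A → Carrier) cs →
             altP (λ c cs → h c cs + k c cs) cs ≈ altP h cs + altP k cs
    altP-+ h k []       = ≈-sym (+-identityˡ 0#)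
    altP-+ h k (c ∷ cs) = begin
      (h c cs + k c cs) - altP (λ d ds → h d (c ∷ ds) + k d (c ∷ ds)) cs
        ≈⟨ +-congˡ (-‿cong (altP-+ (λ d ds → h d (c ∷ ds)) (λ d ds → k d (c ∷ ds)) cs)) ⟩
      (h c cs + k c cs) - (H + K)       ≈⟨ +-congˡ (-‿+-comm H K) ⟨
      (h c cs + k c cs) + (- H + - K)   ≈⟨ +-assoc _ _ _ ⟩
      h c cs + (k c cs + (- H + - K))   ≈⟨ +-congˡ (+-leftComm _ _ _) ⟩
      h c cs + (- H + (k c cs - K))     ≈⟨ +-assoc _ _ _ ⟨
      (h c cs - H) + (k c cs - K)       ∎
      where
      H K : Carrier
      H = altP (λ d ds → h d (c ∷ ds)) cs
      K = altP (λ d ds → k d (c ∷ ds)) cs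

    altP-neg : ∀ (h : A → List A → Carrier) cs → altP (λ c cs → - h c cs) cs ≈ - altP h cs
    altP-neg h []       = ≈-sym -0#≈0#
    altP-neg h (c ∷ cs) =
      ≈-trans (+-congˡ (-‿cong (altP-neg (λ d ds → h d (c ∷ ds)) cs))) (-‿+-comm _ _)

    sumP-neg : ∀ (h : A → List A → Carrier) cs → sumP (λ c cs → - h c cs) cs ≈ - sumP h cs
    sumP-neg h []       = ≈-sym -0#≈0#
    sumP-neg h (c ∷ cs) = ≈-trans (+-congˡ (sumP-neg (λ d ds → h d (c ∷ ds)) cs)) (-‿+-comm _ _)

    altP-* : ∀ x (h : A → List A → Carrier) cs → x * altP h cs ≈ altP (λ c cs → x * h c cs) cs
    altP-* x h []       = zeroʳ x
    altP-* x h (c ∷ cs) = begin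
      x * (h c cs - H)             ≈⟨ distribˡ x _ _ ⟩
      x * h c cs + x * - H         ≈⟨ +-congˡ (-‿distribʳ-* x H) ⟨
      x * h c cs - x * H           ≈⟨ +-congˡ (-‿cong (altP-* x (λ d ds → h d (c ∷ ds)) cs)) ⟩
      altP (λ c cs → x * h c cs) (c ∷ cs) ∎
      where
      H : Carrier
      H = altP (λ d ds → h d (c ∷ ds)) cs

    -- The two orders of picking a pair leave the same list, but only picking the left entry first
    -- lowers the position of the other one, hence the opposite signs. In the induction `x` and `y`
    -- collect the pairs that contain the head, picked first or second, and they trade places.
    altP-swap : ∀ (f : A → A → List A → Carrier) cs →
      altP (λ c → altP (f c)) cs ≈ - altP (λ c → altP (λ d → f d c)) cs
    altP-swap f []       = ≈-sym -0#≈0#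
    altP-swap f (e ∷ es) = begin
      x - altP (λ c cs → f c e cs - altP (λ d ds → f c d (e ∷ ds)) cs) es
        ≈⟨ +-congˡ (-‿cong (split f)) ⟩
      x - (y - X′)            ≈⟨ +-congˡ (-‿cong (+-congˡ (-‿cong (altP-swap f′ es)))) ⟩
      x - (y - - Y′)          ≈⟨ +-congˡ (-‿cong (+-congˡ (-‿involutive Y′))) ⟩
      x - (y + Y′)            ≈⟨ +-congˡ (-‿+-comm y Y′) ⟨
      x + (- y + - Y′)        ≈⟨ +-leftComm x (- y) (- Y′) ⟩
      - y + (x - Y′)          ≈⟨ +-congˡ (-‿involutive (x - Y′)) ⟨
      - y + - (- (x - Y′))    ≈⟨ -‿+-comm y (- (x - Y′)) ⟩
      - (y - (x - Y′))        ≈⟨ -‿cong (+-congˡ (-‿cong (split (λ c d → f d c)))) ⟨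
      - (y - altP (λ c cs → f e c cs - altP (λ d ds → f d c (e ∷ ds)) cs) es) ∎
      where
      f′ : A → A → List A → Carrier
      f′ c d ds = f c d (e ∷ ds)
      x y X′ Y′ : Carrier
      x  = altP (f e) es
      y  = altP (λ c → f c e) es
      X′ = altP (λ c → altP (f′ c)) es
      Y′ = altP (λ c → altP (λ d → f′ d c)) es
      split : ∀ (g : A → A → List A → Carrier) →
        altP (λ c cs → g c e cs - altP (λ d ds → g c d (e ∷ ds)) cs) es ≈
        altP (λ c → g c e) es - altP (λ c → altP (λ d ds → g c d (e ∷ ds))) es
      split g = ≈-trans (altP-+ (λ c → g c e) _ es)
                      (+-congˡ (altP-neg (λ c → altP (λ d ds → g c d (e ∷ ds))) es))

    module _ (M : A → A → Carrier) where

      -- Rows and columns are lists of indices into the one matrix `M`: minors are again of this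
      -- form, and exchanging rows is an operation on lists.
      detL : List A → List A → Carrier
      detL []       cs = 1#
      detL (r ∷ rs) cs = altP (λ c cs′ → M r c * detL rs cs′) cs

      Alternating : (List A → Carrier) → Set _
      Alternating F = ∀ xs a b ys → F (xs ++ a ∷ b ∷ ys) ≈ - F (xs ++ b ∷ a ∷ ys)

      -- If the exchanged rows are on top, both are expanded and `altP-swap` applies; below that the
      -- sign passes through the expansion. Adjacent exchanges are enough to move a row to the front
      -- one place at a time.
      detL-alternating : ∀ cs → Alternating (λ rs → detL rs cs)
      detL-alternating cs [] a b ys = begin
        altP (λ c cs′ → M a c * altP (λ d ds → M b d * detL ys ds) cs′) cs
          ≈⟨ altP-cong (λ c cs′ → altP-* (M a c) _ cs′) cs ⟩
        altP (λ c → altP (λ d ds → M a c * (M b d * detL ys ds))) cs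
          ≈⟨ altP-swap _ cs ⟩
        - altP (λ c → altP (λ d ds → M a d * (M b c * detL ys ds))) cs
          ≈⟨ -‿cong (altP-cong (λ c → altP-cong (λ d ds → *-leftComm (M a d) (M b c) (detL ys ds))) cs) ⟩
        - altP (λ c → altP (λ d ds → M b c * (M a d * detL ys ds))) cs
          ≈⟨ -‿cong (altP-cong (λ c cs′ → altP-* (M b c) _ cs′) cs) ⟨
        - altP (λ c cs′ → M b c * altP (λ d ds → M a d * detL ys ds) cs′) cs ∎
      detL-alternating cs (x ∷ xs) a b ys = ≈-trans
        (altP-cong (λ c cs′ → ≈-trans (*-congˡ (detL-alternating cs′ xs a b ys))
                                    (≈-sym (-‿distribʳ-* (M x c) _))) cs)
        (altP-neg (λ c cs′ → M x c * detL (xs ++ b ∷ a ∷ ys) cs′) cs)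

      -- Bringing the picked entry to the front of the row list absorbs the sign of the pick.
      altP-front : (F : A → List A → List A → Carrier) → (∀ w V′ → Alternating (F w V′)) →
        ∀ V → altP (λ w V′ → F w V′ V) V ≈ sumP (λ w V′ → F w V′ (w ∷ V′)) V
      altP-front F alt []      = ≈-refl
      altP-front F alt (a ∷ W) = +-congˡ (begin
        - altP (λ w W′ → F w (a ∷ W′) (a ∷ W)) W
          ≈⟨ -‿cong (altP-front (λ w W′ rs → F w (a ∷ W′) (a ∷ rs))
                       (λ w W′ xs → alt w (a ∷ W′) (a ∷ xs)) W) ⟩
        - sumP (λ w W′ → F w (a ∷ W′) (a ∷ w ∷ W′)) W
          ≈⟨ sumP-neg _ W ⟨
        sumP (λ w W′ → - F w (a ∷ W′) (a ∷ w ∷ W′)) W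
          ≈⟨ sumP-cong (λ w W′ → alt w (a ∷ W′) [] w a W′) W ⟨
        sumP (λ w W′ → F w (a ∷ W′) (w ∷ a ∷ W′)) W ∎)

      -- Choosing a column w of `V` leaves the rows `V` against the columns v ∷ V′. With row w moved
      -- to the front, the minor is again a principal one bordered by row w and column v, and the
      -- sign of the position is absorbed; the one remaining minus comes from passing column v.
      detL-bordered : ∀ u v V → detL (u ∷ V) (v ∷ V) ≈
        M u v * detL V V - sumP (λ w V′ → M u w * detL (w ∷ V′) (v ∷ V′)) V
      detL-bordered u v V = +-congˡ (-‿cong
        (altP-front (λ w V′ rs → M u w * detL rs (v ∷ V′))
          (λ w V′ xs a b ys → ≈-trans (*-congˡ (detL-alternating (v ∷ V′) xs a b ys))
                                    (≈-sym (-‿distribʳ-* (M u w) _))) V))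

  sumP-Unique : ∀ {n} (h : Fin n → List (Fin n) → Carrier) V → Unique V →
                sumP h V ≈ ∑ V (λ w → h w (remove w V))
  sumP-Unique h []      _          = ≈-refl
  sumP-Unique h (a ∷ W) (a∉W ∷ uW) = +-cong
    (reflexive (cong (h a) (sym (remove-head W a∉W))))
    (≈-trans (sumP-Unique (λ d ds → h d (a ∷ ds)) W uW)
      (∑-cong∈ W (λ {w} w∈ → reflexive (cong (h w) (sym (remove-≢ W (All.lookup a∉W w∈)))))))

  module Walks {n} (M : Fin n → Fin n → Carrier) where

    -- Expansion of the determinant into closed walks: Pf expands the principal minor on V,
    -- Df the minor with extra row w and extra column v, recording in U the pairs traversed.
    -- The first argument is fuel.
    Pf : ℕ → (Used n → Carrier) → List (Fin n) → Used n → Carrier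
    Df : ℕ → (Used n → Carrier) → List (Fin n) → Used n → Fin n → Fin n → Carrier
    Pf f L []      U = L U
    Pf f L (u ∷ V) U = Df f L V U u u
    Df zero    L V U w v = 0#
    Df (suc f) L V U w v = M w v * Pf f L V (add w v U)
      - ∑ V (λ x → M w x * Df f L (remove x V) (add w x U) x v)

    module _ {L₁ L₂ : Used n → Carrier} (e : ∀ U → L₁ U ≈ L₂ U) where
      Pf-cong : ∀ f V U → Pf f L₁ V U ≈ Pf f L₂ V U
      Df-cong : ∀ f V U w v → Df f L₁ V U w v ≈ Df f L₂ V U w v
      Pf-cong f []      U = e U
      Pf-cong f (u ∷ V) U = Df-cong f V U u u
      Df-cong zero    V U w v = ≈-refl
      Df-cong (suc f) V U w v = +-cong (*-congˡ (Pf-cong f V _))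
        (-‿cong (∑-cong V (λ x → *-congˡ (Df-cong f (remove x V) _ x v))))

    module _ (L₁ L₂ : Used n → Carrier) where
      Pf-+ : ∀ f V U → Pf f (λ U → L₁ U + L₂ U) V U ≈ Pf f L₁ V U + Pf f L₂ V U
      Df-+ : ∀ f V U w v → Df f (λ U → L₁ U + L₂ U) V U w v ≈ Df f L₁ V U w v + Df f L₂ V U w v
      Pf-+ f []      U = ≈-refl
      Pf-+ f (u ∷ V) U = Df-+ f V U u u
      Df-+ zero    V U w v = ≈-sym (+-identityˡ 0#)
      Df-+ (suc f) V U w v = begin
        M w v * Pf f (λ U → L₁ U + L₂ U) V (add w v U)
          - ∑ V (λ x → M w x * Df f (λ U → L₁ U + L₂ U) (remove x V) (add w x U) x v)
          ≈⟨ +-cong (≈-trans (*-congˡ (Pf-+ f V _)) (distribˡ _ _ _))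
               (-‿cong (≈-trans (∑-cong V (λ x → ≈-trans (*-congˡ (Df-+ f (remove x V) _ x v)) (distribˡ _ _ _)))
                              (∑-+ V _ _))) ⟩
        (p₁ + p₂) - (s₁ + s₂)         ≈⟨ +-congˡ (-‿+-comm s₁ s₂) ⟨
        (p₁ + p₂) + (- s₁ + - s₂)     ≈⟨ +-assoc _ _ _ ⟩
        p₁ + (p₂ + (- s₁ + - s₂))     ≈⟨ +-congˡ (+-leftComm _ _ _) ⟩
        p₁ + (- s₁ + (p₂ - s₂))       ≈⟨ +-assoc _ _ _ ⟨
        (p₁ - s₁) + (p₂ - s₂)         ∎
        where
        p₁ p₂ s₁ s₂ : Carrier
        p₁ = M w v * Pf f L₁ V (add w v U)
        p₂ = M w v * Pf f L₂ V (add w v U)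
        s₁ = ∑ V (λ x → M w x * Df f L₁ (remove x V) (add w x U) x v)
        s₂ = ∑ V (λ x → M w x * Df f L₂ (remove x V) (add w x U) x v)

    Pf-0 : ∀ f V U → Pf f (λ _ → 0#) V U ≈ 0#
    Df-0 : ∀ f V U w v → Df f (λ _ → 0#) V U w v ≈ 0#
    Pf-0 f []      U = ≈-refl
    Pf-0 f (u ∷ V) U = Df-0 f V U u u
    Df-0 zero    V U w v = ≈-refl
    Df-0 (suc f) V U w v = ≈-trans
      (+-cong (≈-trans (*-congˡ (Pf-0 f V _)) (zeroʳ _))
        (-‿cong (∑-zero∈ V (λ {x} _ → ≈-trans (*-congˡ (Df-0 f (remove x V) _ x v)) (zeroʳ _)))))
      (-‿inverseʳ 0#)

    -- Linearity in the terminal value: a decomposition of the constant 1 into functions of the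
    -- record `U` becomes a decomposition of the determinant.
    Pf-∑ : ∀ {a} {A : Set a} (Ss : List A) (L : A → Used n → Carrier) f V U →
           Pf f (λ U → ∑ Ss (λ S → L S U)) V U ≈ ∑ Ss (λ S → Pf f (L S) V U)
    Pf-∑ []       L f V U = Pf-0 f V U
    Pf-∑ (S ∷ Ss) L f V U = ≈-trans (Pf-+ (L S) _ f V U) (+-congˡ (Pf-∑ Ss L f V U))

    -- `Pf` needs one unit of fuel per vertex of `V` and `Df` one more for the extra row; closing a
    -- walk and moving on both use up exactly one row. The record is arbitrary because the constant
    -- terminal value never looks at it.
    detL-Pf : ∀ f V U → Unique V → length V ≤ f → detL M V V ≈ Pf f (λ _ → 1#) V U
    detL-Df : ∀ f V U u v → Unique V → length V < f →
              detL M (u ∷ V) (v ∷ V) ≈ Df f (λ _ → 1#) V U u v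
    detL-Pf f []      U _        _  = ≈-refl
    detL-Pf f (u ∷ V) U (_ ∷ uV) lt = detL-Df f V U u u uV lt
    detL-Df (suc f) V U u v uV (s≤s le) = ≈-trans (detL-bordered M u v V)
      (+-cong (*-congˡ (detL-Pf f V _ uV le))
        (-‿cong (≈-trans (sumP-Unique _ V uV)
          (∑-cong∈ V (λ {x} x∈ → *-congˡ
            (detL-Df f (remove x V) _ x v (Uniqueₚ.filter⁺ (λ y → ¬? (y Finₚ.≟ x)) uV)
              (ℕₚ.<-≤-trans (length-remove-∈ x∈) le)))))))

-- The cofactor recursion `det` as a determinant on lists.

module DetPoly where
  open CommutativeRing Poly-commutativeRing using ()
    renaming (refl to P-refl; sym to P-sym; trans to P-trans; -‿cong to P-neg; +-cong to P-+; *-congˡ to P-*)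
  open import Algebra.Properties.Ring (CommutativeRing.ring Poly-commutativeRing)
    using (-‿involutive; -‿+-comm)
  open Determinant Poly-commutativeRing

  altSign-suc : ∀ k p → altSign (suc k) p ≈P -P altSign k p
  altSign-suc zero          p = P-refl { -P p }
  altSign-suc (suc zero)    p = P-sym { -P (-P p) } {p} (-‿involutive p)
  altSign-suc (suc (suc k)) p = altSign-suc k p

  ∑± : ∀ {m} → (Fin m → Poly) → Poly
  ∑± {m} g = foldr _+P_ [] (tabulate {n = m} (λ j → altSign (toℕ j) (g j)))

  foldr-neg : ∀ {m} (g h : Fin m → Poly) → (∀ j → g j ≈P -P h j) →
              foldr _+P_ [] (tabulate g) ≈P -P foldr _+P_ [] (tabulate h)
  foldr-neg {zero}  g h e i = refl
  foldr-neg {suc m} g h e = P-trans {g Fin.zero +P foldr _+P_ [] (tabulate (g ∘ Fin.suc))}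
    {(-P h Fin.zero) +P (-P H)} { -P (h Fin.zero +P H)}
    (P-+ {g Fin.zero} { -P h Fin.zero} {foldr _+P_ [] (tabulate (g ∘ Fin.suc))} { -P H}
      (e Fin.zero) (foldr-neg (g ∘ Fin.suc) (h ∘ Fin.suc) (e ∘ Fin.suc)))
    (-‿+-comm (h Fin.zero) H)
    where
    H : Poly
    H = foldr _+P_ [] (tabulate (h ∘ Fin.suc))

  -- Taking one negation out of the tail lowers all its `altSign` exponents by one, which turns
  -- explicit signs into the nested subtractions of `altP`.
  altP-tabulate : ∀ {A : Set} n (c : Fin (suc n) → A) (h : A → List A → Poly) (g : Fin (suc n) → Poly) →
    (∀ j → g j ≈P h (c j) (tabulate (c ∘ punchIn j))) →
    ∑± g ≈P altP h (tabulate c)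
  altP-tabulate n c h g e = P-+ {g Fin.zero} {h (c Fin.zero) (tabulate (c ∘ Fin.suc))}
      {foldr _+P_ [] (tabulate (λ j → altSign (suc (toℕ j)) (g (Fin.suc j))))}
      { -P altP (λ d ds → h d (c Fin.zero ∷ ds)) (tabulate (c ∘ Fin.suc))}
      (e Fin.zero) (P-trans {foldr _+P_ [] (tabulate (λ j → altSign (suc (toℕ j)) (g (Fin.suc j))))}
        { -P ∑± (g ∘ Fin.suc)} { -P altP (λ d ds → h d (c Fin.zero ∷ ds)) (tabulate (c ∘ Fin.suc))}
        (foldr-neg _ _ (λ j → altSign-suc (toℕ j) (g (Fin.suc j))))
        (P-neg {∑± (g ∘ Fin.suc)} {altP (λ d ds → h d (c Fin.zero ∷ ds)) (tabulate (c ∘ Fin.suc))}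
          (rest n c h g e)))
    where
    rest : ∀ {A : Set} n (c : Fin (suc n) → A) (h : A → List A → Poly) (g : Fin (suc n) → Poly) →
      (∀ j → g j ≈P h (c j) (tabulate (c ∘ punchIn j))) →
      ∑± (g ∘ Fin.suc) ≈P altP (λ d ds → h d (c Fin.zero ∷ ds)) (tabulate (c ∘ Fin.suc))
    rest zero    c h g e i = refl
    rest (suc n) c h g e =
      altP-tabulate n (c ∘ Fin.suc) (λ d ds → h d (c Fin.zero ∷ ds)) (g ∘ Fin.suc) (e ∘ Fin.suc)

  -- The index maps are arbitrary because passing to a minor replaces `r` by `r ∘ Fin.suc` and `c`
  -- by `c ∘ punchIn j`.
  det≈detL : ∀ {A : Set} (M : A → A → Poly) n (r c : Fin n → A) →
    det n (λ i j → M (r i) (c j)) ≈P detL M (tabulate r) (tabulate c)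
  det≈detL M zero    r c i = refl
  det≈detL M (suc n) r c i = trans
    (cong (λ l → coeff (foldr _+P_ [] l) i) (Listₚ.map-tabulate id (λ j → altSign (toℕ j) (g j))))
    (altP-tabulate n c (λ d ds → M (r Fin.zero) d *P detL M (tabulate (r ∘ Fin.suc)) ds) g
      (λ j → P-* {M (r Fin.zero) (c j)} {minor j}
               {detL M (tabulate (r ∘ Fin.suc)) (tabulate (c ∘ punchIn j))}
               (det≈detL M n (r ∘ Fin.suc) (c ∘ punchIn j))) i)
    where
    minor g : Fin (suc n) → Poly
    minor j = det n (λ i k → M (r (Fin.suc i)) (c (punchIn j k)))
    g j = M (r Fin.zero) (c j) *P minor j

-- Edge sets and neighbourhoods

T⇒≡ : ∀ {b} → T b → b ≡ true
T⇒≡ {true} _ = refl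

≡⇒T : ∀ {b} → b ≡ true → T b
≡⇒T refl = tt

true≢false : ∀ {ℓ} {A : Set ℓ} {b : Bool} → b ≡ true → b ≡ false → A
true≢false refl ()

module _ {n : ℕ} where
  ==-refl : (a : Fin n) → (a == a) ≡ true
  ==-refl a with a Finₚ.≟ a
  ... | yes _ = refl
  ... | no ¬p = contradiction refl ¬p

  ==⇒≡ : {a b : Fin n} → (a == b) ≡ true → a ≡ b
  ==⇒≡ {a} {b} e with a Finₚ.≟ b
  ... | yes p = p

  ≢⇒== : {a b : Fin n} → a ≢ b → (a == b) ≡ false
  ≢⇒== {a} {b} a≢b with a Finₚ.≟ b
  ... | yes p = contradiction p a≢b
  ... | no _  = refl

∧-true : ∀ {a b} → a ∧ b ≡ true → a ≡ true × b ≡ true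
∧-true {true} {true} _ = refl , refl

∨-true : ∀ {a b} → a ∨ b ≡ true → a ≡ true ⊎ b ≡ true
∨-true {true}  _ = inj₁ refl
∨-true {false} e = inj₂ e

∨-trueʳ : ∀ a {b} → b ≡ true → a ∨ b ≡ true
∨-trueʳ true  _ = refl
∨-trueʳ false e = e

module _ {A : Set} (p : A → Bool) where
  anyL⁻ : ∀ xs → anyL p xs ≡ true → ∃ λ x → x ∈ xs × p x ≡ true
  anyL⁻ (x ∷ xs) e with ∨-true {p x} e
  ... | inj₁ px = x , here refl , px
  ... | inj₂ e′ with anyL⁻ xs e′
  ...   | y , y∈ , py = y , there y∈ , py

  anyL⁺ : ∀ {xs x} → x ∈ xs → p x ≡ true → anyL p xs ≡ true
  anyL⁺ {y ∷ xs} (here refl) e = cong (_∨ anyL p xs) e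
  anyL⁺ {y ∷ xs} (there x∈)  e = ∨-trueʳ (p y) (anyL⁺ x∈ e)

  allL⁻ : ∀ {xs} → allL p xs ≡ true → ∀ {x} → x ∈ xs → p x ≡ true
  allL⁻ {y ∷ xs} e (here refl) = proj₁ (∧-true {p y} e)
  allL⁻ {y ∷ xs} e (there x∈)  = allL⁻ (proj₂ (∧-true {p y} e)) x∈

  allL⁺ : ∀ xs → (∀ {x} → x ∈ xs → p x ≡ true) → allL p xs ≡ true
  allL⁺ []       e = refl
  allL⁺ (x ∷ xs) e = cong₂ _∧_ (e (here refl)) (allL⁺ xs (e ∘ there))

  allL-false : ∀ {xs x} → x ∈ xs → p x ≡ false → allL p xs ≡ false
  allL-false {y ∷ xs} (here refl) e = cong (_∧ allL p xs) e
  allL-false {y ∷ xs} (there x∈)  e =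
    trans (cong (p y ∧_) (allL-false x∈ e)) (Boolₚ.∧-zeroʳ (p y))

module _ {A : Set} where
  ∈-sublists : ∀ {E S : List A} {e} → S ∈ sublists E → e ∈ S → e ∈ E
  ∈-sublists {[]} (here refl) ()
  ∈-sublists {x ∷ E} S∈ e∈ with ∈-++⁻ (sublists E) S∈
  ... | inj₁ S∈′ = there (∈-sublists S∈′ e∈)
  ... | inj₂ m with ∈-map⁻ (x ∷_) m
  ...   | S′ , S′∈ , refl with e∈
  ...     | here refl = here refl
  ...     | there e∈′ = there (∈-sublists S′∈ e∈′)

  sublists-Unique : ∀ {E S : List A} → Unique E → S ∈ sublists E → Unique S
  sublists-Unique {[]} _ (here refl) = []
  sublists-Unique {x ∷ E} (x∉ ∷ uE) S∈ with ∈-++⁻ (sublists E) S∈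
  ... | inj₁ S∈′ = sublists-Unique uE S∈′
  ... | inj₂ m with ∈-map⁻ (x ∷_) m
  ...   | S′ , S′∈ , refl =
          All.tabulate (λ e∈ → All.lookup x∉ (∈-sublists S′∈ e∈)) ∷ sublists-Unique uE S′∈

module _ {n : ℕ} (G : MixedGraph n) where

  private
    listed : Fin n × Fin n → Bool
    listed (i , j) = ⌊ i Fin.<? j ⌋ ∧ isEdge (kind G i j)

    row : ∀ i ys → concatMap (λ j → if listed (i , j) then (i , j) ∷ [] else []) ys
                   ≡ List.filterᵇ listed (map (i ,_) ys)
    row i []       = refl
    row i (y ∷ ys) with listed (i , y)
    ... | true  = cong ((i , y) ∷_) (row i ys)
    ... | false = row i ys

    rows : ∀ xs ys → concatMap (λ i → concatMap (λ j → if listed (i , j) then (i , j) ∷ [] else []) ys) xs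
                     ≡ List.filterᵇ listed (cartesianProduct xs ys)
    rows []       ys = refl
    rows (x ∷ xs) ys = trans (cong₂ _++_ (row x ys) (rows xs ys))
      (sym (Listₚ.filter-++ _ (map (x ,_) ys) (cartesianProduct xs ys)))

    -- In this form uniqueness and membership of edges reduce to facts about filters and cartesian
    -- products.
    edges-filter : edges G ≡ List.filterᵇ listed (cartesianProduct (allFin n) (allFin n))
    edges-filter = rows (allFin n) (allFin n)

  edges-Unique : Unique (edges G)
  edges-Unique = subst Unique (sym edges-filter)
    (Uniqueₚ.filter⁺ _ (Uniqueₚ.cartesianProduct⁺ (Uniqueₚ.allFin⁺ n) (Uniqueₚ.allFin⁺ n)))

  ∈-edges⁺ : ∀ {i j} → i Fin.< j → isEdge (kind G i j) ≡ true → (i , j) ∈ edges G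
  ∈-edges⁺ {i} {j} i<j e = subst ((i , j) ∈_) (sym edges-filter)
    (∈-filter⁺ _ (∈-cartesianProduct⁺ (∈-allFin i) (∈-allFin j)) (≡⇒T (cong₂ _∧_ lt e)))
    where
    lt : ⌊ i Fin.<? j ⌋ ≡ true
    lt with i Fin.<? j
    ... | yes _ = refl
    ... | no ¬p = contradiction i<j ¬p

  ∈-edges⁻ : ∀ {i j} → (i , j) ∈ edges G → i Fin.< j × isEdge (kind G i j) ≡ true
  ∈-edges⁻ {i} {j} m with ∧-true {⌊ i Fin.<? j ⌋} (T⇒≡ (proj₂
        (∈-filter⁻ _ {xs = cartesianProduct (allFin n) (allFin n)} (subst ((i , j) ∈_) edges-filter m))))
  ... | lt , e with i Fin.<? j
  ...   | yes p = p , e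

module _ {n : ℕ} where

  Ordered : Edges n → Set
  Ordered S = ∀ {i j} → (i , j) ∈ S → i Fin.< j

  ∈-nbrs⁻ : ∀ S {v y : Fin n} → y ∈ nbrs S v → (v , y) ∈ S ⊎ (y , v) ∈ S
  ∈-nbrs⁻ ((a , b) ∷ S) {v} {y} m with a Finₚ.≟ v
  ∈-nbrs⁻ ((a , b) ∷ S) (here refl) | yes refl = inj₁ (here refl)
  ∈-nbrs⁻ ((a , b) ∷ S) (there m)   | yes refl = Sum.map there there (∈-nbrs⁻ S m)
  ∈-nbrs⁻ ((a , b) ∷ S) {v} {y} m | no _ with b Finₚ.≟ v
  ∈-nbrs⁻ ((a , b) ∷ S) (here refl) | no _ | yes refl = inj₂ (here refl)
  ∈-nbrs⁻ ((a , b) ∷ S) (there m)   | no _ | yes refl = Sum.map there there (∈-nbrs⁻ S m)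
  ∈-nbrs⁻ ((a , b) ∷ S) m           | no _ | no _     = Sum.map there there (∈-nbrs⁻ S m)

  ∈-nbrs⁺ˡ : ∀ {S} {v y : Fin n} → (v , y) ∈ S → y ∈ nbrs S v
  ∈-nbrs⁺ˡ {(a , b) ∷ S} {v} (here refl) with v Finₚ.≟ v
  ... | yes _ = here refl
  ... | no ¬p = contradiction refl ¬p
  ∈-nbrs⁺ˡ {(a , b) ∷ S} (there m) = ∈-++⁺ʳ _ (∈-nbrs⁺ˡ m)

  ∈-nbrs⁺ʳ : ∀ {S} {v y : Fin n} → Ordered S → (y , v) ∈ S → y ∈ nbrs S v
  ∈-nbrs⁺ʳ {(a , b) ∷ S} {v} o (here refl) with a Finₚ.≟ v
  ... | yes refl = contradiction (o (here refl)) (ℕₚ.<-irrefl refl)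
  ... | no _ with v Finₚ.≟ v
  ...   | yes _ = here refl
  ...   | no ¬p = contradiction refl ¬p
  ∈-nbrs⁺ʳ {(a , b) ∷ S} o (there m) = ∈-++⁺ʳ _ (∈-nbrs⁺ʳ (o ∘ there) m)

  -- A neighbour could repeat only through a repeated edge or through both orders of the same pair;
  -- `Ordered` excludes the second.
  nbrs-Unique : ∀ {S} → Ordered S → Unique S → ∀ v → Unique (nbrs S v)
  nbrs-Unique {[]} o u v = []
  nbrs-Unique {(a , b) ∷ S} o (e∉ ∷ uS) v with a Finₚ.≟ v
  ... | yes refl = All.tabulate (λ y∈ → λ { refl → fresh (∈-nbrs⁻ S y∈) }) ∷ nbrs-Unique (o ∘ there) uS v
    where
    fresh : (a , b) ∈ S ⊎ (b , a) ∈ S → ⊥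
    fresh (inj₁ m) = All.lookup e∉ m refl
    fresh (inj₂ m) = ℕₚ.<-asym (o (here refl)) (o (there m))
  ... | no _ with b Finₚ.≟ v
  ...   | yes refl = All.tabulate (λ y∈ → λ { refl → fresh (∈-nbrs⁻ S y∈) }) ∷ nbrs-Unique (o ∘ there) uS v
    where
    fresh : (b , a) ∈ S ⊎ (a , b) ∈ S → ⊥
    fresh (inj₁ m) = ℕₚ.<-asym (o (here refl)) (o (there m))
    fresh (inj₂ m) = All.lookup e∉ m refl
  ...   | no _ = nbrs-Unique (o ∘ there) uS v

  adjS⁻ : ∀ S {v y : Fin n} → adjS S v y ≡ true → y ∈ nbrs S v
  adjS⁻ S {v} e with anyL⁻ _ (nbrs S v) e
  ... | x , x∈ , px with ==⇒≡ px
  ...   | refl = x∈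

  adjS⁺ : ∀ S {v y : Fin n} → y ∈ nbrs S v → adjS S v y ≡ true
  adjS⁺ S {y = y} y∈ = anyL⁺ _ y∈ (==-refl y)

  adjS-sym : ∀ S {v y : Fin n} → Ordered S → adjS S v y ≡ true → adjS S y v ≡ true
  adjS-sym S {v} {y} o e with ∈-nbrs⁻ S (adjS⁻ S {v} e)
  ... | inj₁ m = adjS⁺ S {y} (∈-nbrs⁺ʳ o m)
  ... | inj₂ m = adjS⁺ S {y} (∈-nbrs⁺ˡ m)

-- Components

agree : Bool → Bool → Bool
agree true  b = b
agree false b = not b

agree-refl : ∀ b → agree b b ≡ true
agree-refl true  = refl
agree-refl false = refl

allL-cong∈ : ∀ {A : Set} {p q : A → Bool} xs → (∀ {x} → x ∈ xs → p x ≡ q x) → allL p xs ≡ allL q xs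
allL-cong∈ []       e = refl
allL-cong∈ (x ∷ xs) e = cong₂ _∧_ (e (here refl)) (allL-cong∈ xs (e ∘ there))

module _ {n : ℕ} where

  -- Only the pairs listed in `E` are compared. For the edges of a graph these have i < j, so the
  -- diagonal pairs recorded by walks that close at once are never seen.
  matches : Edges n → Edges n → Used n → Bool
  matches E S U = allL (λ (i , j) → agree (adjS S i j) (U i j)) E

  adjS-fresh : ∀ S {i j : Fin n} → Ordered S → i Fin.< j → (i , j) ∉ S → adjS S i j ≡ false
  adjS-fresh S {i} {j} o i<j ∉S with adjS S i j in eq
  ... | false = refl
  ... | true with ∈-nbrs⁻ S (adjS⁻ S {i} eq)
  ...   | inj₁ m = contradiction m ∉S
  ...   | inj₂ m = contradiction (o m) (ℕₚ.<-asym i<j)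

  adjS-∷ : ∀ S {a b i j : Fin n} → a Fin.< b → i Fin.< j → (a , b) ≢ (i , j) →
           adjS ((a , b) ∷ S) i j ≡ adjS S i j
  adjS-∷ S {a} {b} {i} {j} a<b i<j ne with a Finₚ.≟ i
  ... | yes refl with b Finₚ.≟ j
  ...   | yes refl = contradiction refl ne
  ...   | no _     = refl
  adjS-∷ S {a} {b} {i} {j} a<b i<j ne | no _ with b Finₚ.≟ i
  ... | no _ = refl
  ... | yes refl with a Finₚ.≟ j
  ...   | yes refl = contradiction i<j (ℕₚ.<-asym a<b)
  ...   | no _     = refl

  module _ {c ℓ} (R : CommutativeRing c ℓ) where
    open CommutativeRing R using (Carrier; 0#; 1#; _≈_; +-identityˡ; +-identityʳ; +-cong; reflexive)
      renaming (_+_ to _+R_; refl to ≈-refl; trans to ≈-trans; sym to ≈-sym)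
    open RingSums R

    leaf : Edges n → Edges n → Used n → Carrier
    leaf E S U = if matches E S U then 1# else 0#

    -- Exactly one sublist matches `U`, namely the edges of `E` that `U` contains. For the first
    -- edge, `U i j` decides whether the sublists with it or those without it survive.
    ∑-leaf : ∀ E → Ordered E → Unique E → ∀ U → ∑ (sublists E) (λ S → leaf E S U) ≈ 1#
    ∑-leaf []            o u        U = +-identityʳ 1#
    ∑-leaf ((i , j) ∷ E) o (e∉ ∷ u) U = ≈-trans (∑-++ (sublists E) _ _)
      (≈-trans (+-cong
          (∑-cong∈ (sublists E) (λ {S} S∈ → reflexive (cong indicator (without S S∈))))
          (≈-trans (∑-map ((i , j) ∷_) (sublists E) _)
            (∑-cong∈ (sublists E) (λ {S} S∈ → reflexive (cong indicator (with′ S S∈))))))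
        (split (U i j)))
      where
      indicator : Bool → Carrier
      indicator b = if b then 1# else 0#
      i<j : i Fin.< j
      i<j = o (here refl)
      without : ∀ S → S ∈ sublists E → matches ((i , j) ∷ E) S U ≡ not (U i j) ∧ matches E S U
      without S S∈ = cong (λ b → agree b (U i j) ∧ matches E S U)
        (adjS-fresh S (λ m → o (there (∈-sublists S∈ m))) i<j
          (λ m → All.lookup e∉ (∈-sublists S∈ m) refl))
      with′ : ∀ S → S ∈ sublists E → matches ((i , j) ∷ E) ((i , j) ∷ S) U ≡ U i j ∧ matches E S U
      with′ S S∈ = cong₂ _∧_
        (cong (λ b → agree b (U i j)) (adjS⁺ ((i , j) ∷ S) {i} (∈-nbrs⁺ˡ {S = (i , j) ∷ S} {i} (here refl))))
        (allL-cong∈ E (λ {(a , b)} m →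
          cong (λ z → agree z (U a b)) (adjS-∷ S i<j (o (there m)) (All.lookup e∉ m))))
      split : ∀ b → (∑ (sublists E) (λ S → indicator (not b ∧ matches E S U))) +R
                    (∑ (sublists E) (λ S → indicator (b ∧ matches E S U))) ≈ 1#
      split true  = ≈-trans (+-cong (∑-zero∈ (sublists E) (λ _ → ≈-refl)) (∑-leaf E (o ∘ there) u U))
                            (+-identityˡ 1#)
      split false = ≈-trans (+-cong (∑-leaf E (o ∘ there) u U) (∑-zero∈ (sublists E) (λ _ → ≈-refl)))
                            (+-identityʳ 1#)

  -- Counting vertices.

  Unique-⊆⇒length-≤ : ∀ {xs ys : List (Fin n)} → Unique xs → (∀ {x} → x ∈ xs → x ∈ ys) →
                      length xs ≤ length ys
  Unique-⊆⇒length-≤ {[]}     _          _   = z≤n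
  Unique-⊆⇒length-≤ {x ∷ xs} (x∉ ∷ uxs) sub = ℕₚ.≤-<-trans
    (Unique-⊆⇒length-≤ uxs (λ {y} y∈ → ∈-filter⁺ (λ z → ¬? (z Finₚ.≟ x)) (sub (there y∈))
      (λ e → All.lookup x∉ y∈ (sym e))))
    (length-remove-∈ (sub (here refl)))

  private
    ∈-filterᵇ⁺ : ∀ {p : Fin n → Bool} {x} → p x ≡ true → x ∈ List.filterᵇ p (allFin n)
    ∈-filterᵇ⁺ {x = x} px = ∈-filter⁺ _ (∈-allFin x) (≡⇒T px)

    ∈-filterᵇ⁻ : ∀ {p : Fin n → Bool} {x} → x ∈ List.filterᵇ p (allFin n) → p x ≡ true
    ∈-filterᵇ⁻ x∈ = T⇒≡ (proj₂ (∈-filter⁻ _ {xs = allFin n} x∈))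

    filterᵇ-Unique : ∀ p → Unique (List.filterᵇ p (allFin n))
    filterᵇ-Unique p = Uniqueₚ.filter⁺ _ (Uniqueₚ.allFin⁺ n)

  length≤count : ∀ {p : Fin n → Bool} {l} → Unique l → (∀ {x} → x ∈ l → p x ≡ true) → length l ≤ count p
  length≤count {p} ul h = Unique-⊆⇒length-≤ {ys = List.filterᵇ p (allFin n)} ul (∈-filterᵇ⁺ ∘ h)

  count≤length : ∀ {p : Fin n → Bool} {l} → (∀ {x} → p x ≡ true → x ∈ l) → count p ≤ length l
  count≤length {p} h = Unique-⊆⇒length-≤ (filterᵇ-Unique p) (h ∘ ∈-filterᵇ⁻)

  count≤n : ∀ p → count {n} p ≤ n
  count≤n p = subst (count p ≤_) (Listₚ.length-tabulate {n = n} id) (count≤length (λ {x} _ → ∈-allFin x))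

  count-mono : ∀ {p q : Fin n → Bool} → (∀ {x} → p x ≡ true → q x ≡ true) → count p ≤ count q
  count-mono {p} h = length≤count (filterᵇ-Unique p) (h ∘ ∈-filterᵇ⁻)

  count-mono-< : ∀ {p q : Fin n → Bool} {y} → (∀ {x} → p x ≡ true → q x ≡ true) →
                 p y ≡ false → q y ≡ true → count p < count q
  count-mono-< {p} {q} {y} h py qy = length≤count
    (All.tabulate (λ x∈ → λ { refl → true≢false (∈-filterᵇ⁻ x∈) py }) ∷ filterᵇ-Unique p)
    λ { (here refl) → qy ; (there x∈) → h (∈-filterᵇ⁻ x∈) }

allL-false⁻ : ∀ {A : Set} (p : A → Bool) xs → allL p xs ≡ false → ∃ λ x → p x ≡ false
allL-false⁻ p (x ∷ xs) e with p x in eq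
... | true  = allL-false⁻ p xs e
... | false = x , eq

module Component {n : ℕ} (S : Edges n) (ordered : Ordered S) where

  private
    grow : (Fin n → Bool) → Fin n → Bool
    grow R u = R u ∨ anyF (λ w → R w ∧ adjS S w u)

    reach : Fin n → ℕ → Fin n → Bool
    reach v k = iter k grow (λ u → u == v)

    grow-⊇ : ∀ R {u} → R u ≡ true → grow R u ≡ true
    grow-⊇ R {u} e = cong (_∨ anyF (λ w → R w ∧ adjS S w u)) e

    grow-adj : ∀ R {w u} → R w ≡ true → adjS S w u ≡ true → grow R u ≡ true
    grow-adj R {w} {u} Rw a = ∨-trueʳ (R u)
      (anyL⁺ (λ w → R w ∧ adjS S w u) (∈-allFin w) (cong₂ _∧_ Rw a))

    grow⁻ : ∀ R {u} → grow R u ≡ true → R u ≡ true ⊎ ∃ λ w → R w ≡ true × adjS S w u ≡ true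
    grow⁻ R {u} e with ∨-true {R u} e
    ... | inj₁ Ru = inj₁ Ru
    ... | inj₂ e′ with anyL⁻ (λ w → R w ∧ adjS S w u) (allFin n) e′
    ...   | w , _ , e″ = inj₂ (w , ∧-true e″)

    Stable : (Fin n → Bool) → Set
    Stable R = ∀ {u} → grow R u ≡ true → R u ≡ true

    grow-Stable : ∀ R → Stable R → Stable (grow R)
    grow-Stable R st e with grow⁻ (grow R) e
    ... | inj₁ e′           = e′
    ... | inj₂ (w , e′ , a) = grow-adj R (st e′) a

    -- The reached set grows strictly in every round until it is stable.
    stabilises : ∀ v k → Stable (reach v k) ⊎ k < count (reach v k)
    stabilises v zero = inj₂ (length≤count {p = reach v 0} {v ∷ []} ([] ∷ []) λ { (here refl) → ==-refl v })
    stabilises v (suc k) with stabilises v k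
    ... | inj₁ st = inj₁ (grow-Stable (reach v k) st)
    ... | inj₂ lt with allF (λ u → not (grow (reach v k) u) ∨ reach v k u) in eq
    ...   | true  = inj₁ (grow-Stable (reach v k) λ {u} e →
              subst (λ b → not b ∨ reach v k u ≡ true) e
                (allL⁻ (λ u → not (grow (reach v k) u) ∨ reach v k u) eq (∈-allFin u)))
    ...   | false with allL-false⁻ _ (allFin n) eq
    ...     | u , e = inj₂ (ℕₚ.≤-<-trans lt
              (count-mono-< {y = u} (grow-⊇ (reach v k)) (proj₁ (inv e)) (proj₂ (inv e))))
      where
      inv : ∀ {a b} → not a ∨ b ≡ false → b ≡ false × a ≡ true
      inv {true} {false} _ = refl , refl

    -- If `n` rounds had not reached stability, more than `n` vertices would have been reached.
    comp-Stable : ∀ v → Stable (comp S v)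
    comp-Stable v with stabilises v n
    ... | inj₁ st = st
    ... | inj₂ lt = contradiction (count≤n (reach v n)) (ℕₚ.<⇒≱ lt)

  comp-refl : ∀ v → comp S v v ≡ true
  comp-refl v = go n
    where
    go : ∀ k → reach v k v ≡ true
    go zero    = ==-refl v
    go (suc k) = grow-⊇ (reach v k) (go k)

  comp-adj : ∀ v {a b} → comp S v a ≡ true → adjS S a b ≡ true → comp S v b ≡ true
  comp-adj v e a = comp-Stable v (grow-adj (comp S v) e a)

  -- The component is the least set that contains v and is closed under adjacency; in this form the
  -- number of rounds disappears from all later arguments.
  comp-ind : ∀ {q} v (Q : Fin n → Set q) → Q v → (∀ {a b} → Q a → adjS S a b ≡ true → Q b) →
             ∀ {x} → comp S v x ≡ true → Q x
  comp-ind v Q qv step = go n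
    where
    go : ∀ k {x} → reach v k x ≡ true → Q x
    go zero e = subst Q (sym (==⇒≡ e)) qv
    go (suc k) e with grow⁻ (reach v k) e
    ... | inj₁ e′           = go k e′
    ... | inj₂ (w , e′ , a) = step (go k e′) a

  comp-trans : ∀ {x y z} → comp S x y ≡ true → comp S y z ≡ true → comp S x z ≡ true
  comp-trans {x} {y} xy = comp-ind y (λ z → comp S x z ≡ true) xy (comp-adj x)

  comp-sym : ∀ {x y} → comp S x y ≡ true → comp S y x ≡ true
  comp-sym {x} = comp-ind x (λ y → comp S y x ≡ true) (comp-refl x)
    (λ {a} {b} ax ab → comp-trans (comp-adj b (comp-refl b) (adjS-sym S {a} ordered ab)) ax)

-- Edge and cycle components

-- Complex conjugation: ω̄ = 1 - ω, so a + bω goes to (a + b) - bω.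
conj : ℤω → ℤω
conj (mkω a b) = mkω (a ℤ.+ b) (ℤ.- b)

conj-* : ∀ x y → conj (x *ω y) ≡ conj x *ω conj y
conj-* (mkω a b) (mkω c d) = cong₂ mkω (eqr a b c d) (eqi a b c d)
  where
  eqr : ∀ a b c d → (a ℤ.* c ℤ.- b ℤ.* d) ℤ.+ (a ℤ.* d ℤ.+ b ℤ.* c ℤ.+ b ℤ.* d)
                    ≡ (a ℤ.+ b) ℤ.* (c ℤ.+ d) ℤ.- (ℤ.- b) ℤ.* (ℤ.- d)
  eqr = solve-∀
  eqi : ∀ a b c d → ℤ.- (a ℤ.* d ℤ.+ b ℤ.* c ℤ.+ b ℤ.* d)
                    ≡ (a ℤ.+ b) ℤ.* (ℤ.- d) ℤ.+ (ℤ.- b) ℤ.* (c ℤ.+ d) ℤ.+ (ℤ.- b) ℤ.* (ℤ.- d)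
  eqi = solve-∀

-- The constructor with exponent i stands at the i-th power of ω. The set is stable under
-- multiplication by the nonzero entries of N, so a mixed cycle has one of these six weights and
-- statements about weights become finite checks.
data SixthRoot : ℤω → Set where
  ζ⁰ : SixthRoot 1ω
  ζ¹ : SixthRoot ω
  ζ² : SixthRoot (-ω ω̄)
  ζ³ : SixthRoot (-ω 1ω)
  ζ⁴ : SixthRoot (-ω ω)
  ζ⁵ : SixthRoot ω̄

entry-SixthRoot : ∀ {k} → isEdge k ≡ true → SixthRoot (entry k)
entry-SixthRoot {undir} _ = ζ⁰
entry-SixthRoot {arc}   _ = ζ¹
entry-SixthRoot {rarc}  _ = ζ⁵

entry-*-SixthRoot : ∀ {k x} → isEdge k ≡ true → SixthRoot x → SixthRoot (entry k *ω x)
entry-*-SixthRoot {undir} _ ζ⁰ = ζ⁰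
entry-*-SixthRoot {undir} _ ζ¹ = ζ¹
entry-*-SixthRoot {undir} _ ζ² = ζ²
entry-*-SixthRoot {undir} _ ζ³ = ζ³
entry-*-SixthRoot {undir} _ ζ⁴ = ζ⁴
entry-*-SixthRoot {undir} _ ζ⁵ = ζ⁵
entry-*-SixthRoot {arc}   _ ζ⁰ = ζ¹
entry-*-SixthRoot {arc}   _ ζ¹ = ζ²
entry-*-SixthRoot {arc}   _ ζ² = ζ³
entry-*-SixthRoot {arc}   _ ζ³ = ζ⁴
entry-*-SixthRoot {arc}   _ ζ⁴ = ζ⁵
entry-*-SixthRoot {arc}   _ ζ⁵ = ζ⁰
entry-*-SixthRoot {rarc}  _ ζ⁰ = ζ⁵
entry-*-SixthRoot {rarc}  _ ζ¹ = ζ⁰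
entry-*-SixthRoot {rarc}  _ ζ² = ζ¹
entry-*-SixthRoot {rarc}  _ ζ³ = ζ²
entry-*-SixthRoot {rarc}  _ ζ⁴ = ζ³
entry-*-SixthRoot {rarc}  _ ζ⁵ = ζ⁴

entry-flip : ∀ k → entry (flipK k) ≡ conj (entry k)
entry-flip none  = refl
entry-flip undir = refl
entry-flip arc   = refl
entry-flip rarc  = refl

entry-*-flip : ∀ {k} → isEdge k ≡ true → entry k *ω entry (flipK k) ≡ 1ω
entry-*-flip {undir} _ = refl
entry-*-flip {arc}   _ = refl
entry-*-flip {rarc}  _ = refl

sgn dbl : Bool → ℤ
sgn b = if b then -[1+ 0 ] else + 1
dbl b = if b then + 2 else + 1

-- The contribution of a vertex to the sign and the power of two of an elementary subgraph.
factor : Bool → Bool → ℤω → ℤ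
factor rep cyc w = sgn rep ℤ.* (dbl (cyc ∧ (w ==ω 1ω)) ℤ.* (sgn (cyc ∧ (w ==ω (-ω 1ω)))
  ℤ.* (dbl (cyc ∧ (w ==ω (-ω 1ω))) ℤ.* sgn (cyc ∧ ((w ==ω (-ω ω)) ∨ (w ==ω (-ω ω̄)))))))

-- For the powers 0 to 5 of ω the right side is -2, -1, 1, 2, 1, -1. The factor 2 occurs exactly for
-- positive and negative cycles. The sign -1 belonging to every component is cancelled exactly for
-- negative and semi-negative cycles. These are the exponents in the theorem.
factor-SixthRoot : ∀ {w} → SixthRoot w → fromℤ (factor true true w) ≡ -ω (w +ω conj w)
factor-SixthRoot ζ⁰ = refl
factor-SixthRoot ζ¹ = refl
factor-SixthRoot ζ² = refl
factor-SixthRoot ζ³ = refl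
factor-SixthRoot ζ⁴ = refl
factor-SixthRoot ζ⁵ = refl

¬true⇒false : ∀ {b} → ¬ (b ≡ true) → b ≡ false
¬true⇒false {false} _ = refl
¬true⇒false {true}  h = contradiction refl h

≡ᵇ-true : ∀ {m k} → m ≡ k → (m ℕ.≡ᵇ k) ≡ true
≡ᵇ-true {m} {k} e = T⇒≡ (ℕₚ.≡⇒≡ᵇ m k e)

≡ᵇ-false : ∀ {m k} → m ≢ k → (m ℕ.≡ᵇ k) ≡ false
≡ᵇ-false {m} {k} ne = ¬true⇒false (λ e → ne (ℕₚ.≡ᵇ⇒≡ m k (≡⇒T e)))

headM-singleton : ∀ {A : Set} {y : A} {xs} → y ∈ xs → (∀ {z} → z ∈ xs → z ≡ y) → headM xs ≡ just y
headM-singleton {xs = x ∷ xs} _ all = cong just (all (here refl))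

lastOf : ∀ {A : Set} → A → List A → A
lastOf w []      = w
lastOf w (y ∷ r) = lastOf y r

lastOf-∈ : ∀ {A : Set} (w : A) r → lastOf w r ∈ w ∷ r
lastOf-∈ w []      = here refl
lastOf-∈ w (y ∷ r) = there (lastOf-∈ y r)

module Subgraph {n : ℕ} (G : MixedGraph n) (S : Edges n) (S∈ : S ∈ sublists (edges G)) where

  S-ordered : Ordered S
  S-ordered m = proj₁ (∈-edges⁻ G (∈-sublists S∈ m))

  open Component S S-ordered public

  nb : Fin n → List (Fin n)
  nb = nbrs S

  infix 4 _~_
  _~_ : Fin n → Fin n → Set
  a ~ b = adjS S a b ≡ true

  ~-sym : ∀ {a b} → a ~ b → b ~ a
  ~-sym {a} = adjS-sym S {a} S-ordered

  nb-Unique : ∀ v → Unique (nb v)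
  nb-Unique = nbrs-Unique S-ordered (sublists-Unique (edges-Unique G) S∈)

  ~⇒∈ : ∀ {a b} → a ~ b → b ∈ nb a
  ~⇒∈ {a} = adjS⁻ S {a}

  ∈⇒~ : ∀ {a b} → b ∈ nb a → a ~ b
  ∈⇒~ {a} = adjS⁺ S {a}

  ~-edge : ∀ {a b} → a ~ b → isEdge (kind G a b) ≡ true
  ~-edge {a} {b} ab with ∈-nbrs⁻ S (~⇒∈ ab)
  ... | inj₁ m = proj₂ (∈-edges⁻ G (∈-sublists S∈ m))
  ... | inj₂ m with kind G a b | kind G b a | flip-sym G a b | proj₂ (∈-edges⁻ G (∈-sublists S∈ m))
  ...   | none  | .none | refl | ()
  ...   | undir | _     | refl | _ = refl
  ...   | arc   | _     | refl | _ = refl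
  ...   | rarc  | _     | refl | _ = refl

  ~⇒≢ : ∀ {a b} → a ~ b → a ≢ b
  ~⇒≢ {a} ab refl with ∈-nbrs⁻ S (~⇒∈ {a} ab)
  ... | inj₁ m = ℕₚ.<-irrefl refl (S-ordered m)
  ... | inj₂ m = ℕₚ.<-irrefl refl (S-ordered m)

  N-flip : ∀ a b → N G b a ≡ conj (N G a b)
  N-flip a b = trans (cong entry (flip-sym G a b)) (entry-flip (kind G a b))

  N-*-flip : ∀ {a b} → a ~ b → N G a b *ω N G b a ≡ 1ω
  N-*-flip {a} {b} ab = trans (cong (λ k → N G a b *ω entry k) (flip-sym G a b)) (entry-*-flip (~-edge ab))

  record Link (p w y : Fin n) : Set where
    constructor link
    field
      p≢y  : p ≢ y
      w~p  : w ~ p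
      w~y  : w ~ y
      only : ∀ {z} → w ~ z → z ≡ p ⊎ z ≡ y
  open Link public

  Link-sym : ∀ {p w y} → Link p w y → Link y w p
  Link-sym l = link (λ e → p≢y l (sym e)) (w~y l) (w~p l) (Sum.swap ∘ only l)

  deg≥ : ∀ {v l} → Unique l → (∀ {y} → y ∈ l → v ~ y) → length l ≤ deg S v
  deg≥ u h = Unique-⊆⇒length-≤ u (~⇒∈ ∘ h)

  deg≤ : ∀ {v l} → (∀ {y} → v ~ y → y ∈ l) → deg S v ≤ length l
  deg≤ {v} h = Unique-⊆⇒length-≤ (nb-Unique v) (h ∘ ∈⇒~)

  unique₂ : ∀ {a b : Fin n} → a ≢ b → Unique (a ∷ b ∷ [])
  unique₂ ab = (ab ∷ []) ∷ [] ∷ []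

  unique₃ : ∀ {a b c : Fin n} → a ≢ b → a ≢ c → b ≢ c → Unique (a ∷ b ∷ c ∷ [])
  unique₃ ab ac bc = (ab ∷ ac ∷ []) ∷ (bc ∷ []) ∷ [] ∷ []

  deg≥₃ : ∀ {v a b c} → a ≢ b → a ≢ c → b ≢ c → v ~ a → v ~ b → v ~ c → 3 ≤ deg S v
  deg≥₃ ab ac bc va vb vc = deg≥ (unique₃ ab ac bc)
    λ { (here refl) → va ; (there (here refl)) → vb ; (there (there (here refl))) → vc }

  Link⇒deg≡2 : ∀ {p w y} → Link p w y → deg S w ≡ 2
  Link⇒deg≡2 {p} {w} {y} l = ℕₚ.≤-antisym
    (deg≤ {w} {p ∷ y ∷ []} λ wz → Sum.[ here , there ∘ here ]′ (only l wz))
    (deg≥ (unique₂ (p≢y l)) λ { (here refl) → w~p l ; (there (here refl)) → w~y l })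

  deg≡2⇒only : ∀ {v a b} → deg S v ≡ 2 → a ≢ b → v ~ a → v ~ b → ∀ {y} → v ~ y → y ≡ a ⊎ y ≡ b
  deg≡2⇒only {v} {a} {b} d ab va vb {y} vy with y Finₚ.≟ a | y Finₚ.≟ b
  ... | yes e | _     = inj₁ e
  ... | no _  | yes e = inj₂ e
  ... | no ya | no yb = contradiction (subst (3 ≤_) d (deg≥₃ ab (ya ∘ sym) (yb ∘ sym) va vb vy))
                          λ { (s≤s (s≤s ())) }

  inV-deg : ∀ {v} → deg S v ≢ 0 → inV S v ≡ true
  inV-deg ne = cong not (≡ᵇ-false ne)

  inV-~ : ∀ {v y} → v ~ y → inV S v ≡ true
  inV-~ {v} {y} vy = inV-deg (λ d → contradiction
    (subst (1 ≤_) d (deg≥ {v} {y ∷ []} ([] ∷ []) λ { (here refl) → vy })) λ ())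

  isRep⁺ : ∀ {u} → inV S u ≡ true → (∀ {y} → comp S u y ≡ true → u Fin.≤ y) → isRep S u ≡ true
  isRep⁺ {u} iu h = cong₂ _∧_ iu (allL⁺ _ (allFin n) (λ {y} _ → ok y))
    where
    ok : ∀ y → (not (comp S u y) ∨ ⌊ u Fin.≤? y ⌋) ≡ true
    ok y with comp S u y in eq
    ... | false = refl
    ... | true with u Fin.≤? y
    ...   | yes _ = refl
    ...   | no ¬p = contradiction (h eq) ¬p

  isRep-false : ∀ {x u} → comp S x u ≡ true → u Fin.< x → isRep S x ≡ false
  isRep-false {x} {u} xu u<x = trans
    (cong (inV S x ∧_) (allL-false _ (∈-allFin u) (trans (cong (λ b → not b ∨ ⌊ x Fin.≤? u ⌋) xu) lem)))
    (Boolₚ.∧-zeroʳ (inV S x))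
    where
    lem : ⌊ x Fin.≤? u ⌋ ≡ false
    lem with x Fin.≤? u
    ... | yes p = contradiction u<x (ℕₚ.≤⇒≯ p)
    ... | no _  = refl

  compIsCycle⁺ : ∀ {u} → (∀ {y} → comp S u y ≡ true → deg S y ≡ 2) → compIsCycle S u ≡ true
  compIsCycle⁺ {u} h = allL⁺ _ (allFin n) (λ {y} _ → ok y)
    where
    ok : ∀ y → (not (comp S u y) ∨ (deg S y ℕ.≡ᵇ 2)) ≡ true
    ok y with comp S u y in eq
    ... | false = refl
    ... | true  = ≡ᵇ-true (h eq)

  compIsCycle-false : ∀ {u y} → comp S u y ≡ true → deg S y ≢ 2 → compIsCycle S u ≡ false
  compIsCycle-false {u} {y} uy d = allL-false _ (∈-allFin y)
    (cong₂ (λ a b → not a ∨ b) uy (≡ᵇ-false d))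

  compIsEdge-false : ∀ {u a b c} → a ≢ b → a ≢ c → b ≢ c →
    comp S u a ≡ true → comp S u b ≡ true → comp S u c ≡ true → compIsEdge S u ≡ false
  compIsEdge-false {u} ab ac bc ua ub uc = ≡ᵇ-false λ e → contradiction
    (subst (3 ≤_) e (length≤count {p = comp S u} (unique₃ ab ac bc)
      λ { (here refl) → ua ; (there (here refl)) → ub ; (there (there (here refl))) → uc }))
    λ { (s≤s (s≤s ())) }

  elem : Fin n → Bool
  elem v = compIsEdge S v ∨ compIsCycle S v

  ψ : Fin n → ℤ
  ψ v = factor (isRep S v) (isCycleRep S v) (cycleWeight G S v)

  ψ-nonrep : ∀ {x} → isRep S x ≡ false → ψ x ≡ + 1
  ψ-nonrep e rewrite e = refl

  record IsEdge (u w : Fin n) : Set where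
    field
      u~w   : u ~ w
      onlyᵘ : ∀ {y} → u ~ y → y ≡ w
      onlyʷ : ∀ {y} → w ~ y → y ≡ u
  open IsEdge public

  IsEdge-sym : ∀ {u w} → IsEdge u w → IsEdge w u
  IsEdge-sym e = record { u~w = ~-sym (u~w e) ; onlyᵘ = onlyʷ e ; onlyʷ = onlyᵘ e }

  module _ {u w : Fin n} (e : IsEdge u w) where

    private
      comp⇒∈ : ∀ {x} → comp S u x ≡ true → x ∈ u ∷ w ∷ []
      comp⇒∈ = comp-ind u (_∈ u ∷ w ∷ []) (here refl)
        λ { (here refl) a → there (here (onlyᵘ e a)) ; (there (here refl)) a → here (onlyʷ e a) }

    IsEdge⇒comp : ∀ {x} → comp S u x ≡ true → x ≡ u ⊎ x ≡ w
    IsEdge⇒comp c with comp⇒∈ c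
    ... | here refl         = inj₁ refl
    ... | there (here refl) = inj₂ refl

    IsEdge⇒compIsEdge : compIsEdge S u ≡ true
    IsEdge⇒compIsEdge = ≡ᵇ-true (ℕₚ.≤-antisym (count≤length comp⇒∈)
      (length≤count {p = comp S u} (unique₂ (~⇒≢ (u~w e)))
        λ { (here refl) → comp-refl u ; (there (here refl)) → comp-adj u (comp-refl u) (u~w e) }))

    IsEdge⇒elem : elem u ≡ true
    IsEdge⇒elem = cong (_∨ compIsCycle S u) IsEdge⇒compIsEdge

    IsEdge⇒deg≢2 : deg S u ≢ 2
    IsEdge⇒deg≢2 d = contradiction (subst (_≤ 1) d (deg≤ {u} {w ∷ []} (here ∘ onlyᵘ e))) λ { (s≤s ()) }

    IsEdge⇒¬cycle : compIsCycle S u ≡ false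
    IsEdge⇒¬cycle = compIsCycle-false (comp-refl u) IsEdge⇒deg≢2

    ψ-edge-rep : u Fin.< w → ψ u ≡ -[1+ 0 ]
    ψ-edge-rep u<w = cong₂ (λ a b → factor a b (cycleWeight G S u)) rep (trans (cong (isRep S u ∧_) IsEdge⇒¬cycle) (Boolₚ.∧-zeroʳ _))
      where
      rep : isRep S u ≡ true
      rep = isRep⁺ (inV-~ (u~w e)) λ c → Sum.[ (λ { refl → ℕₚ.≤-refl }) , (λ { refl → ℕₚ.<⇒≤ u<w }) ]′ (IsEdge⇒comp c)

    ψ-edge-other : u Fin.< w → ψ w ≡ + 1
    ψ-edge-other u<w = ψ-nonrep (isRep-false (comp-adj w (comp-refl w) (~-sym (u~w e))) u<w)

  -- The walk p, w, r, v with no branching at w and along r. The ends p and v carry no condition on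
  -- their degree, so p = v = u describes a cycle except for the degree of its root, which `IsCycle`
  -- adds.
  PathOK : Fin n → Fin n → List (Fin n) → Fin n → Set
  PathOK p w []      v = Link p w v
  PathOK p w (y ∷ r) v = Link p w y × PathOK w y r v

  wt : Fin n → List (Fin n) → Fin n → ℤω
  wt w []      v = N G w v
  wt w (y ∷ r) v = N G w y *ω wt y r v

  path-nbr : ∀ {p w} r {v} → PathOK p w r v → ∀ {x y} → x ∈ w ∷ r → x ~ y → y ≡ p ⊎ y ∈ w ∷ r ⊎ y ≡ v
  path-nbr [] l (here refl) xy with only l xy
  ... | inj₁ e = inj₁ e
  ... | inj₂ e = inj₂ (inj₂ e)
  path-nbr (z ∷ r) (l , _) (here refl) xy with only l xy
  ... | inj₁ e = inj₁ e
  ... | inj₂ e = inj₂ (inj₁ (there (here e)))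
  path-nbr (z ∷ r) (_ , ok) (there x∈) xy with path-nbr r ok x∈ xy
  ... | inj₁ e        = inj₂ (inj₁ (here e))
  ... | inj₂ (inj₁ m) = inj₂ (inj₁ (there m))
  ... | inj₂ (inj₂ e) = inj₂ (inj₂ e)

  path-deg : ∀ {p w} r {v} → PathOK p w r v → ∀ {x} → x ∈ w ∷ r → deg S x ≡ 2
  path-deg []      l        (here refl) = Link⇒deg≡2 l
  path-deg (z ∷ r) (l , _)  (here refl) = Link⇒deg≡2 l
  path-deg (z ∷ r) (_ , ok) (there x∈)  = path-deg r ok x∈

  path-comp : ∀ {u p w} r {v} → PathOK p w r v → comp S u w ≡ true → ∀ {x} → x ∈ w ∷ r → comp S u x ≡ true
  path-comp r ok c (here refl) = c
  path-comp {u} (z ∷ r) (l , ok) c (there x∈) = path-comp r ok (comp-adj u c (w~y l)) x∈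

  path-last : ∀ {p w} r {v} → PathOK p w r v → lastOf w r ~ v
  path-last []      l        = w~y l
  path-last (z ∷ r) (_ , ok) = path-last r ok

  path-start : ∀ {p w} r {v} → PathOK p w r v → w ~ p
  path-start []      l       = w~p l
  path-start (z ∷ r) (l , _) = w~p l

  path-SixthRoot : ∀ {p w} r {v} → PathOK p w r v → SixthRoot (wt w r v)
  path-SixthRoot []      l        = entry-SixthRoot (~-edge (w~y l))
  path-SixthRoot (z ∷ r) (l , ok) = entry-*-SixthRoot (~-edge (w~y l)) (path-SixthRoot r ok)

  -- Each link leaves only one way on, so two such paths can differ only in where they stop;
  -- excluding v from the interior of both settles that.
  path-det : ∀ {p w} r r′ {v} → PathOK p w r v → PathOK p w r′ v → v ∉ r → v ∉ r′ → r ≡ r′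
  path-det []      []        _        _          _  _   = refl
  path-det []      (y ∷ r′)  l        (l′ , _)   _  v∉′ with only l (w~y l′)
  ... | inj₁ e    = contradiction (sym e) (p≢y l′)
  ... | inj₂ refl = contradiction (here refl) v∉′
  path-det (y ∷ r) []        (l , _)  l′         v∉ _   with only l′ (w~y l)
  ... | inj₁ e    = contradiction (sym e) (p≢y l)
  ... | inj₂ refl = contradiction (here refl) v∉
  path-det (y ∷ r) (y′ ∷ r′) (l , ok) (l′ , ok′) v∉ v∉′ with only l (w~y l′)
  ... | inj₁ e    = contradiction (sym e) (p≢y l′)
  ... | inj₂ refl = cong (y ∷_) (path-det r r′ ok ok′ (v∉ ∘ there) (v∉′ ∘ there))

  -- acc is the traversed part of a closed walk from u, most recent vertex first;
  -- P is the weight of that part.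
  module _ (u : Fin n) where

    Back : Fin n → Fin n → List (Fin n) → Set
    Back p w []        = p ≡ u
    Back p w (q ∷ acc) = p ≡ q × PathOK w q acc u

    private
      extend : ∀ {p w y} acc → Back p w acc → Link p w y → PathOK y w acc u
      extend []        refl        l = Link-sym l
      extend (q ∷ acc) (refl , ok) l = Link-sym l , ok

    -- `N G b a` is the conjugate of `N G a b`, so a reversed walk has the conjugate weight. The
    -- hypothesis on `wt w acc u` says this for the part reversed so far, and each step moves one
    -- entry across.
    path-reverse : ∀ {p w} r acc P → Back p w acc → PathOK p w r u → wt w acc u ≡ conj P →
      u ∉ acc → u ∉ w ∷ r →
      ∃ λ acc′ → PathOK u (lastOf w r) acc′ u × u ∉ acc′ ×
        N G u (lastOf w r) *ω wt (lastOf w r) acc′ u ≡ conj (P *ω wt w r u)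
    path-reverse {p} {w} [] acc P b l e u∉acc u∉ = acc , extend acc b l , u∉acc , (begin
      N G u w *ω wt w acc u         ≡⟨ cong₂ _*ω_ (N-flip w u) e ⟩
      conj (N G w u) *ω conj P      ≡⟨ *ω-comm (conj (N G w u)) (conj P) ⟩
      conj P *ω conj (N G w u)      ≡⟨ conj-* P (N G w u) ⟨
      conj (P *ω N G w u)           ∎)
      where open ≡-Reasoning
    path-reverse {p} {w} (y ∷ r) acc P b (l , ok) e u∉acc u∉
      with path-reverse r (w ∷ acc) (P *ω N G w y) (refl , extend acc b l) ok
             (trans (cong₂ _*ω_ (N-flip w y) e)
               (trans (*ω-comm (conj (N G w y)) (conj P)) (sym (conj-* P (N G w y)))))
             (λ { (here e) → u∉ (here e) ; (there m) → u∉acc m }) (u∉ ∘ there)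
    ... | acc′ , ok′ , u∉′ , e′ =
          acc′ , ok′ , u∉′ , trans e′ (cong conj (*ω-assoc P (N G w y) (wt y r u)))

  record IsCycle (u a : Fin n) (r : List (Fin n)) : Set where
    field
      pathOK : PathOK u a r u
      unique : Unique (u ∷ a ∷ r)
      root   : deg S u ≡ 2
  open IsCycle public

  module _ {u a : Fin n} {r : List (Fin n)} (cy : IsCycle u a r) where

    private
      u∉ : u ∉ a ∷ r
      u∉ m with unique cy
      ... | h ∷ _ = All.lookup h m refl

    -- A cycle has length at least three: with `r` empty, the link at `a` would have u as both of
    -- its neighbours.
    a≢last : a ≢ lastOf a r
    a≢last = go r (pathOK cy) (unique cy)
      where
      go : ∀ r → PathOK u a r u → Unique (u ∷ a ∷ r) → a ≢ lastOf a r
      go []      l _           _ = p≢y l refl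
      go (y ∷ r) _ (_ ∷ h ∷ _) e = All.lookup h (lastOf-∈ y r) e

    root-nbrs : ∀ {y} → u ~ y → y ≡ a ⊎ y ≡ lastOf a r
    root-nbrs = deg≡2⇒only (root cy) a≢last (~-sym (path-start r (pathOK cy))) (~-sym (path-last r (pathOK cy)))

    cycle-closed : ∀ {x y} → x ∈ u ∷ a ∷ r → x ~ y → y ∈ u ∷ a ∷ r
    cycle-closed (here refl) xy with root-nbrs xy
    ... | inj₁ refl = there (here refl)
    ... | inj₂ refl = there (lastOf-∈ a r)
    cycle-closed (there x∈) xy with path-nbr r (pathOK cy) x∈ xy
    ... | inj₁ refl        = here refl
    ... | inj₂ (inj₁ m)    = there m
    ... | inj₂ (inj₂ refl) = here refl

    comp⇒cycle : ∀ {x} → comp S u x ≡ true → x ∈ u ∷ a ∷ r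
    comp⇒cycle = comp-ind u (_∈ u ∷ a ∷ r) (here refl) cycle-closed

    cycle⇒comp : ∀ {x} → x ∈ u ∷ a ∷ r → comp S u x ≡ true
    cycle⇒comp (here refl) = comp-refl u
    cycle⇒comp (there x∈)  =
      path-comp r (pathOK cy) (comp-adj u (comp-refl u) (~-sym (path-start r (pathOK cy)))) x∈

    cycle-deg : ∀ {x} → x ∈ u ∷ a ∷ r → deg S x ≡ 2
    cycle-deg (here refl) = root cy
    cycle-deg (there x∈)  = path-deg r (pathOK cy) x∈

    cycle⇒compIsCycle : ∀ {x} → x ∈ u ∷ a ∷ r → compIsCycle S x ≡ true
    cycle⇒compIsCycle x∈ = compIsCycle⁺ (λ c → cycle-deg (comp⇒cycle (comp-trans (cycle⇒comp x∈) c)))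

    cycle⇒elem : ∀ {x} → x ∈ u ∷ a ∷ r → elem x ≡ true
    cycle⇒elem {x} x∈ = ∨-trueʳ (compIsEdge S x) (cycle⇒compIsCycle x∈)

    cycle⇒inV : ∀ {x} → x ∈ u ∷ a ∷ r → inV S x ≡ true
    cycle⇒inV {x} x∈ = inV-deg (λ d → contradiction (trans (sym (cycle-deg x∈)) d) λ ())

    -- The cycle is closed under adjacency, hence is the whole component. Subtracting 2 leaves
    -- `length r`, the number of moves that `cycleWeight` makes between its first step and the
    -- closing one.
    compSize-cycle : compSize S u ≡ suc (suc (length r))
    compSize-cycle = ℕₚ.≤-antisym (count≤length comp⇒cycle)
      (length≤count {p = comp S u} (unique cy) cycle⇒comp)

    ψ-cycle-other : (∀ {x} → x ∈ a ∷ r → u Fin.< x) → ∀ {x} → x ∈ a ∷ r → ψ x ≡ + 1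
    ψ-cycle-other h x∈ = ψ-nonrep (isRep-false (comp-sym (cycle⇒comp (there x∈))) (h x∈))

  -- The loop local to cycleWeight has no name; after two steps from v all its arguments are
  -- distinct variables, so that unification can recover it.
  private
    next : Fin n → Fin n → Maybe (Fin n)
    next p w = headM (List.filterᵇ (λ x → not ⌊ x Finₚ.≟ p ⌋) (nb w))

    mutual
      loop : Fin n → Fin n → ℕ → Fin n → Fin n → ℤω
      loop = _

      loop-eq : ∀ v v₂ y z m → headM (nb v) ≡ just v₂ → next v v₂ ≡ just y → next v₂ y ≡ just z →
        compSize S v ℕ.∸ 2 ≡ suc (suc m) →
        cycleWeight G S v ≡ N G v v₂ *ω (N G v₂ y *ω (N G y z *ω loop v v₂ m y z))
      loop-eq v v₂ y z m e₁ e₂ e₃ e₄ with headM (nb v)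
      loop-eq v v₂ y z m refl e₂ e₃ e₄ | just _ with compSize S v ℕ.∸ 2
      loop-eq v v₂ y z m refl e₂ e₃ refl | just _ | _ with next v v₂
      loop-eq v v₂ y z m refl refl e₃ refl | just _ | _ | just _ with next v₂ y
      loop-eq v v₂ y z m refl refl refl refl | just _ | _ | just _ | just _ = refl

    loop-suc : ∀ v v₂ m p w {y} → next p w ≡ just y → loop v v₂ (suc m) p w ≡ N G w y *ω loop v v₂ m w y
    loop-suc v v₂ m p w e rewrite e = refl

    triangle-eq : ∀ v v₂ y → headM (nb v) ≡ just v₂ → next v v₂ ≡ just y → compSize S v ℕ.∸ 2 ≡ 1 →
      cycleWeight G S v ≡ N G v v₂ *ω (N G v₂ y *ω N G y v)
    triangle-eq v v₂ y e₁ e₂ e₃ with headM (nb v)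
    triangle-eq v v₂ y refl e₂ e₃ | just _ with compSize S v ℕ.∸ 2
    triangle-eq v v₂ y refl e₂ refl | just _ | _ with next v v₂
    triangle-eq v v₂ y refl refl refl | just _ | _ | just _ = refl

    next-Link : ∀ {p w y} → Link p w y → next p w ≡ just y
    next-Link {p} {w} {y} l = headM-singleton
      (∈-filter⁺ (Boolₚ.T? ∘ not ∘ (_== p)) (~⇒∈ (w~y l)) (≡⇒T (cong not (≢⇒== (λ e → p≢y l (sym e))))))
      λ {z} z∈ → other (∈-filter⁻ (Boolₚ.T? ∘ not ∘ (_== p)) {xs = nb w} z∈)
      where
      other : ∀ {z} → z ∈ nb w × T (not (z == p)) → z ≡ y
      other {z} (z∈ , t) with only l (∈⇒~ z∈)
      ... | inj₂ e    = e
      ... | inj₁ refl = true≢false (T⇒≡ t) (cong not (==-refl z))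

    loop-path : ∀ v v₂ {p w} r → PathOK p w r v → loop v v₂ (length r) p w ≡ wt w r v
    loop-path v v₂         []      l        = refl
    loop-path v v₂ {p} {w} (y ∷ r) (l , ok) =
      trans (loop-suc v v₂ (length r) p w (next-Link l)) (cong (N G w y *ω_) (loop-path v v₂ r ok))

  -- `cycleWeight` sets out towards the first listed neighbour, so the hypothesis on `headM` fixes
  -- the direction. A triangle is treated separately because its walk ends before the two steps that
  -- `loop-eq` takes.
  cycleWeight-cycle : ∀ {u a r} → IsCycle u a r → headM (nb u) ≡ just a → cycleWeight G S u ≡ wt u (a ∷ r) u
  cycleWeight-cycle {u} {a} {[]}        cy e = contradiction refl (p≢y (pathOK cy))
  cycleWeight-cycle {u} {a} {y ∷ []}    cy e with pathOK cy
  ... | l , _ = triangle-eq u a y e (next-Link l) (cong (ℕ._∸ 2) (compSize-cycle cy))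
  cycleWeight-cycle {u} {a} {y ∷ z ∷ r} cy e with pathOK cy
  ... | l , l′ , ok = trans
    (loop-eq u a y z (length r) e (next-Link l) (next-Link l′) (cong (ℕ._∸ 2) (compSize-cycle cy)))
    (cong (λ t → N G u a *ω (N G a y *ω (N G y z *ω t))) (loop-path u a r ok))

  -- Since u is least on the cycle it is the representative and carries the full factor. The value
  -- is unchanged when the weight is conjugated, so the direction chosen by `cycleWeight` does not
  -- matter.
  ψ-cycle-root : ∀ {u a r} → IsCycle u a r → headM (nb u) ≡ just a → (∀ {x} → x ∈ a ∷ r → u Fin.< x) →
    fromℤ (ψ u) ≡ -ω (wt u (a ∷ r) u +ω conj (wt u (a ∷ r) u))
  ψ-cycle-root {u} {a} {r} cy e h = begin
    fromℤ (factor (isRep S u) (isRep S u ∧ compIsCycle S u) (cycleWeight G S u))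
      ≡⟨ cong (λ b → fromℤ (factor b (b ∧ compIsCycle S u) (cycleWeight G S u))) rep ⟩
    fromℤ (factor true (compIsCycle S u) (cycleWeight G S u))
      ≡⟨ cong₂ (λ b w → fromℤ (factor true b w)) (cycle⇒compIsCycle cy (here refl)) (cycleWeight-cycle cy e) ⟩
    fromℤ (factor true true (wt u (a ∷ r) u))
      ≡⟨ factor-SixthRoot (entry-*-SixthRoot (~-edge (~-sym (path-start r (pathOK cy)))) (path-SixthRoot r (pathOK cy))) ⟩
    -ω (wt u (a ∷ r) u +ω conj (wt u (a ∷ r) u)) ∎
    where
    open ≡-Reasoning
    rep : isRep S u ≡ true
    rep = isRep⁺ (cycle⇒inV cy (here refl)) (min ∘ comp⇒cycle cy)
      where
      min : ∀ {y} → y ∈ u ∷ a ∷ r → u Fin.≤ y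
      min (here refl) = ℕₚ.≤-refl
      min (there y∈)  = ℕₚ.<⇒≤ (h y∈)

-- The walks whose edge set is a given subgraph

module _ {n : ℕ} where

  Symmetricᵘ : Used n → Set
  Symmetricᵘ U = ∀ {a b} → U a b ≡ true → U b a ≡ true

  module _ {U : Used n} {w x : Fin n} where

    add-mono : ∀ {a b} → U a b ≡ true → add w x U a b ≡ true
    add-mono {a} {b} e = cong (_∨ (((a == w) ∧ (b == x)) ∨ ((a == x) ∧ (b == w)))) e

    add-here : add w x U w x ≡ true
    add-here = ∨-trueʳ (U w x) (cong (_∨ ((w == x) ∧ (x == w))) (cong₂ _∧_ (==-refl w) (==-refl x)))

    add-here′ : add w x U x w ≡ true
    add-here′ = ∨-trueʳ (U x w) (∨-trueʳ _ (cong₂ _∧_ (==-refl x) (==-refl w)))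

    add⁻ : ∀ {a b} → add w x U a b ≡ true → U a b ≡ true ⊎ (a ≡ w × b ≡ x) ⊎ (a ≡ x × b ≡ w)
    add⁻ {a} {b} e with ∨-true {U a b} e
    ... | inj₁ h = inj₁ h
    ... | inj₂ h with ∨-true {(a == w) ∧ (b == x)} h
    ...   | inj₁ k with ∧-true {a == w} k
    ...     | k₁ , k₂ = inj₂ (inj₁ (==⇒≡ k₁ , ==⇒≡ k₂))
    add⁻ {a} {b} e | inj₂ h | inj₂ k with ∧-true {a == x} k
    ...     | k₁ , k₂ = inj₂ (inj₂ (==⇒≡ k₁ , ==⇒≡ k₂))

    add-sym : Symmetricᵘ U → Symmetricᵘ (add w x U)
    add-sym s e with add⁻ e
    ... | inj₁ h                        = add-mono (s h)
    ... | inj₂ (inj₁ (refl , refl)) = add-here′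
    ... | inj₂ (inj₂ (refl , refl)) = add-here

    add-false : ∀ {a b} → U a b ≡ false → ¬ (a ≡ w × b ≡ x) → ¬ (a ≡ x × b ≡ w) → add w x U a b ≡ false
    add-false e h k = ¬true⇒false (λ t → case (add⁻ t))
      where
      case : _ → ⊥
      case (inj₁ t)        = true≢false t e
      case (inj₂ (inj₁ t)) = h t
      case (inj₂ (inj₂ t)) = k t

  ∈-remove⁻ : ∀ {w x : Fin n} V → x ∈ remove w V → x ∈ V × x ≢ w
  ∈-remove⁻ {w} V = ∈-filter⁻ (λ y → ¬? (y Finₚ.≟ w)) {xs = V}

  ∈-remove⁺ : ∀ {w x : Fin n} {V} → x ∈ V → x ≢ w → x ∈ remove w V
  ∈-remove⁺ {w} = ∈-filter⁺ (λ y → ¬? (y Finₚ.≟ w))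

  removes : List (Fin n) → List (Fin n) → List (Fin n)
  removes []      V = V
  removes (y ∷ r) V = removes r (remove y V)

  Sorted : List (Fin n) → Set
  Sorted = AllPairs Fin._<_

  Sorted⇒Unique : ∀ {V} → Sorted V → Unique V
  Sorted⇒Unique = AllPairs.map (λ { lt refl → ℕₚ.<-irrefl refl lt })

  remove-Sorted : ∀ w {V} → Sorted V → Sorted (remove w V)
  remove-Sorted w = AllPairsₚ.filter⁺ (λ y → ¬? (y Finₚ.≟ w))

-- xI − N(G) over a ring that receives ℤ[ω] through ν.
record CharacteristicMatrix {c ℓ} (R : CommutativeRing c ℓ) {n : ℕ} (G : MixedGraph n) : Set (c ⊔ ℓ) where
  open CommutativeRing R
  field
    x      : Carrier
    ν      : ℤω → Carrier
    ν-0    : ν 0ω ≈ 0#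
    ν-1    : ν 1ω ≈ 1#
    ν-+    : ∀ a b → ν (a +ω b) ≈ ν a + ν b
    ν-*    : ∀ a b → ν (a *ω b) ≈ ν a * ν b
    ν-neg  : ∀ a → ν (-ω a) ≈ - ν a
    M      : Fin n → Fin n → Carrier
    M-diag : ∀ u → M u u ≈ x
    M-off  : ∀ {a b} → a ≢ b → M a b ≈ - ν (N G a b)

module FixedSubgraph {c ℓ} {R : CommutativeRing c ℓ} {n : ℕ} {G : MixedGraph n}
  (𝓜 : CharacteristicMatrix R G) (S : Edges n) (S∈ : S ∈ sublists (edges G)) where

  open CommutativeRing R hiding (zero) renaming (refl to ≈-refl; sym to ≈-sym; trans to ≈-trans)
  open CharacteristicMatrix 𝓜 renaming (x to X′)
  open import Algebra.Properties.Ring ring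
    using (-0#≈0#; -‿involutive; -‿distribʳ-*; -‿distribˡ-*)
  open RingSums R
  open Determinant R
  open Walks M
  open Subgraph G S S∈

  L : Used n → Carrier
  L = leaf R (edges G) S

  leaf-mismatch : ∀ {i j U} → (i , j) ∈ edges G → agree (adjS S i j) (U i j) ≡ false → L U ≈ 0#
  leaf-mismatch {U = U} m e = reflexive (cong (λ b → if b then 1# else 0#)
    (allL-false (λ (i , j) → agree (adjS S i j) (U i j)) m e))

  edge-listed : ∀ {a b} → isEdge (kind G a b) ≡ true → (a , b) ∈ edges G ⊎ (b , a) ∈ edges G
  edge-listed {a} {b} e with Finₚ.<-cmp a b
  ... | tri< lt _ _ = inj₁ (∈-edges⁺ G lt e)
  ... | tri≈ _ refl _ =
    true≢false e (cong isEdge (loopless G a))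
  ... | tri> _ _ gt = inj₂ (∈-edges⁺ G gt (flip-edge (kind G a b) (flip-sym G a b) e))
    where
    flip-edge : ∀ k {k′} → k′ ≡ flipK k → isEdge k ≡ true → isEdge k′ ≡ true
    flip-edge undir refl _ = refl
    flip-edge arc   refl _ = refl
    flip-edge rarc  refl _ = refl

  ≁-sym : ∀ {a b} → adjS S a b ≡ false → adjS S b a ≡ false
  ≁-sym {a} {b} e = ¬true⇒false (λ t → true≢false (~-sym {b} {a} t) e)

  leaf-missing : ∀ {a b U} → Symmetricᵘ U → a ~ b → U a b ≡ false → L U ≈ 0#
  leaf-missing {a} {b} {U} sy ab e with edge-listed (~-edge ab)
  ... | inj₁ m = leaf-mismatch {U = U} m (cong₂ agree ab e)
  ... | inj₂ m = leaf-mismatch {U = U} m (cong₂ agree (~-sym ab) (¬true⇒false (λ t → true≢false (sy t) e)))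

  leaf-surplus : ∀ {a b} → isEdge (kind G a b) ≡ true → adjS S a b ≡ false →
                 ∀ U → Symmetricᵘ U → U a b ≡ true → L U ≈ 0#
  leaf-surplus {a} {b} ed ne U sy e with edge-listed ed
  ... | inj₁ m = leaf-mismatch {U = U} m (cong₂ agree ne e)
  ... | inj₂ m = leaf-mismatch {U = U} m (cong₂ agree (≁-sym {a} {b} ne) (sy e))

  leaf-match : ∀ {U} → (∀ {a b} → a ≢ b → adjS S a b ≡ U a b) → L U ≈ 1#
  leaf-match {U} h = reflexive (cong (λ b → if b then 1# else 0#)
    (allL⁺ (λ (i , j) → agree (adjS S i j) (U i j)) (edges G) λ {(i , j)} m →
      trans (cong (agree (adjS S i j)) (sym (h (λ { refl → ℕₚ.<-irrefl refl (proj₁ (∈-edges⁻ G m)) }))))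
              (agree-refl (adjS S i j))))

  -- Reasons why no completion of a partial walk uses exactly the edges of S: it has used an
  -- edge outside S, or it has left the vertex a without using an edge of S at a.
  data Dead (V : List (Fin n)) (U : Used n) : Set ℓ where
    surplus : ∀ a b → (∀ U′ → Symmetricᵘ U′ → U′ a b ≡ true → L U′ ≈ 0#) → U a b ≡ true → Dead V U
    missing : ∀ a b → a ~ b → U a b ≡ false → a ∉ V → Dead V U

  -- Both reasons persist to the end: traversed edges stay recorded, and every pair still to be
  -- recorded has both ends among w, v and `V`, so an edge of S at a vertex outside these can no
  -- longer be added.
  Pf-dead : ∀ f V U → Symmetricᵘ U → Dead V U → Pf f L V U ≈ 0#
  Df-dead : ∀ f V U w v → Symmetricᵘ U → Dead (w ∷ v ∷ V) U → Df f L V U w v ≈ 0#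
  Pf-dead f [] U sy (surplus a b k e)    = k U sy e
  Pf-dead f [] U sy (missing a b ab e _) = leaf-missing {U = U} sy ab e
  Pf-dead f (u ∷ V) U sy d = Df-dead f V U u u sy (dup d)
    where
    dup : Dead (u ∷ V) U → Dead (u ∷ u ∷ V) U
    dup (surplus a b k e)     = surplus a b k e
    dup (missing a b ab e a∉) = missing a b ab e λ { (here p) → a∉ (here p) ; (there p) → a∉ p }
  Df-dead zero    V U w v sy d = ≈-refl
  Df-dead (suc f) V U w v sy d = ≈-trans (+-cong
      (≈-trans (*-congˡ (Pf-dead f V (add w v U) (add-sym {U = U} sy) (close d))) (zeroʳ _))
      (-‿cong (∑-zero∈ V (λ {x} x∈ → ≈-trans
        (*-congˡ (Df-dead f (remove x V) (add w x U) x v (add-sym {U = U} sy) (move x∈ d))) (zeroʳ _)))))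
      (-‿inverseʳ 0#)
    where
    close : Dead (w ∷ v ∷ V) U → Dead V (add w v U)
    close (surplus a b k e)     = surplus a b k (add-mono {U = U} e)
    close (missing a b ab e a∉) = missing a b ab
      (add-false {U = U} e (a∉ ∘ here ∘ proj₁) (a∉ ∘ there ∘ here ∘ proj₁)) (a∉ ∘ there ∘ there)
    move : ∀ {x} → x ∈ V → Dead (w ∷ v ∷ V) U → Dead (x ∷ v ∷ remove x V) (add w x U)
    move x∈ (surplus a b k e)     = surplus a b k (add-mono {U = U} e)
    move x∈ (missing a b ab e a∉) = missing a b ab
      (add-false {U = U} e (a∉ ∘ here ∘ proj₁) (λ { (refl , _) → a∉ (there (there x∈)) }))
      λ { (here refl)         → a∉ (there (there x∈))
        ; (there (here p))      → a∉ (there (here p))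
        ; (there (there p))     → a∉ (there (there (proj₁ (∈-remove⁻ V p)))) }

  move-dead : ∀ f V U w v x → Symmetricᵘ U → Dead (x ∷ v ∷ remove x V) (add w x U) →
              M w x * Df f L (remove x V) (add w x U) x v ≈ 0#
  move-dead f V U w v x sy d =
    ≈-trans (*-congˡ (Df-dead f (remove x V) (add w x U) x v (add-sym {U = U} sy) d)) (zeroʳ _)

  close-dead : ∀ f V U w v → Symmetricᵘ U → Dead V (add w v U) → M w v * Pf f L V (add w v U) ≈ 0#
  close-dead f V U w v sy d = ≈-trans (*-congˡ (Pf-dead f V (add w v U) (add-sym {U = U} sy) d)) (zeroʳ _)

  M-none : ∀ {a b} → a ≢ b → kind G a b ≡ none → M a b ≈ 0#
  M-none {a} {b} ab k = ≈-trans (M-off ab) (≈-trans (-‿cong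
    (≈-trans (reflexive (cong (ν ∘ entry) k)) ν-0)) -0#≈0#)

  data Edge? (a b : Fin n) : Set where
    absent  : kind G a b ≡ none → Edge? a b
    present : isEdge (kind G a b) ≡ true → Edge? a b

  edge? : ∀ a b → Edge? a b
  edge? a b with kind G a b in eq
  ... | none  = absent eq
  ... | undir = present (cong isEdge eq)
  ... | arc   = present (cong isEdge eq)
  ... | rarc  = present (cong isEdge eq)

  move-≁ : ∀ f V U w v x → Symmetricᵘ U → w ≢ x → adjS S w x ≡ false →
           M w x * Df f L (remove x V) (add w x U) x v ≈ 0#
  move-≁ f V U w v x sy wx ne with edge? w x
  ... | absent k  = ≈-trans (*-congʳ (M-none wx k)) (zeroˡ _)
  ... | present e = move-dead f V U w v x sy (surplus w x (leaf-surplus e ne) (add-here {U = U}))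

  close-≁ : ∀ f V U w v → Symmetricᵘ U → w ≢ v → adjS S w v ≡ false →
            M w v * Pf f L V (add w v U) ≈ 0#
  close-≁ f V U w v sy wv ne with edge? w v
  ... | absent k  = ≈-trans (*-congʳ (M-none wv k)) (zeroˡ _)
  ... | present e = close-dead f V U w v sy (surplus w v (leaf-surplus e ne) (add-here {U = U}))

  -- The contribution of an elementary component sits on its least vertex, and `ψ` is 1 on the
  -- others. The vertices removed while walking such a component therefore do not change the product
  -- of `φ`.
  φ : Fin n → Carrier
  φ v = if inV S v then (if elem v then ν (fromℤ (ψ v)) else 0#) else X′

  φ-elem : ∀ {v} → inV S v ≡ true → elem v ≡ true → φ v ≈ ν (fromℤ (ψ v))
  φ-elem {v} i e = reflexive (cong₂ (λ a b → if a then (if b then ν (fromℤ (ψ v)) else 0#) else X′) i e)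

  φ-nonelem : ∀ {v} → inV S v ≡ true → elem v ≡ false → φ v ≈ 0#
  φ-nonelem {v} i e = reflexive (cong₂ (λ a b → if a then (if b then ν (fromℤ (ψ v)) else 0#) else X′) i e)

  φ-isolated : ∀ {v} → nb v ≡ [] → φ v ≈ X′
  φ-isolated {v} e = reflexive (cong (λ l → if not (length l ℕ.≡ᵇ 0) then (if elem v then ν (fromℤ (ψ v)) else 0#) else X′) e)

  ∏-remove : ∀ {x} V → φ x ≈ 1# → ∏ (remove x V) φ ≈ ∏ V φ
  ∏-remove     []      e = ≈-refl
  ∏-remove {x} (y ∷ V) e with y Finₚ.≟ x
  ... | no _       = *-congˡ (∏-remove V e)
  ... | yes refl = ≈-trans (∏-remove V e) (≈-trans (≈-sym (*-identityˡ _)) (*-congʳ (≈-sym e)))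

  ∏-removes : ∀ r V → (∀ {x} → x ∈ r → φ x ≈ 1#) → ∏ (removes r V) φ ≈ ∏ V φ
  ∏-removes []      V e = ≈-refl
  ∏-removes (y ∷ r) V e = ≈-trans (∏-removes r (remove y V) (e ∘ there)) (∏-remove V (e (here refl)))

  ∑-single : ∀ {y} V {f : Fin n → Carrier} → Unique V → y ∈ V → (∀ {x} → x ∈ V → x ≢ y → f x ≈ 0#) →
             ∑ V f ≈ f y
  ∑-single (y ∷ V) (y∉ ∷ _) (here refl) h = ≈-trans
    (+-congˡ (∑-zero∈ V (λ x∈ → h (there x∈) (λ { refl → All.lookup y∉ x∈ refl })))) (+-identityʳ _)
  ∑-single (z ∷ V) (z∉ ∷ u) (there y∈) h = ≈-trans
    (+-cong (h (here refl) (All.lookup z∉ y∈)) (∑-single V u y∈ (h ∘ there))) (+-identityˡ _)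

  ∑-pair : ∀ {y z} V {f : Fin n → Carrier} → Unique V → y ∈ V → z ∈ V → y ≢ z →
           (∀ {x} → x ∈ V → x ≢ y → x ≢ z → f x ≈ 0#) → ∑ V f ≈ f y + f z
  ∑-pair (y ∷ V) (y∉ ∷ u) (here refl) (here refl) yz h = contradiction refl yz
  ∑-pair (y ∷ V) (y∉ ∷ u) (here refl) (there z∈) yz h = +-congˡ
    (∑-single V u z∈ (λ x∈ xz → h (there x∈) (λ { refl → All.lookup y∉ x∈ refl }) xz))
  ∑-pair (z ∷ V) (z∉ ∷ u) (there y∈) (here refl) yz h = ≈-trans (+-congˡ
    (∑-single V u y∈ (λ x∈ xy → h (there x∈) xy (λ { refl → All.lookup z∉ x∈ refl })))) (+-comm _ _)
  ∑-pair (x ∷ V) (x∉ ∷ u) (there y∈) (there z∈) yz h = ≈-trans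
    (+-cong (h (here refl) (All.lookup x∉ y∈) (All.lookup x∉ z∈)) (∑-pair V u y∈ z∈ yz (h ∘ there)))
    (+-identityˡ _)

  x-0≈x : ∀ {x y} → y ≈ 0# → x - y ≈ x
  x-0≈x e = ≈-trans (+-congˡ (≈-trans (-‿cong e) -0#≈0#)) (+-identityʳ _)

  0-x≈-x : ∀ {x y} → x ≈ 0# → x - y ≈ - y
  0-x≈-x e = ≈-trans (+-congʳ e) (+-identityˡ _)

  -- The state when no walk is open: `V` is a union of components of S that are still untouched, and
  -- outside `V` exactly the edges of S have been used. The condition a ≢ b in `sub` makes room for
  -- the diagonal pair recorded at an isolated vertex. Sortedness makes the head of `V` the least
  -- vertex of its component.
  record Between (V : List (Fin n)) (U : Used n) : Set where
    field
      sorted : Sorted V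
      usym   : Symmetricᵘ U
      closed : ∀ {a b} → a ∈ V → a ~ b → b ∈ V
      out    : ∀ {a b} → a ∉ V → a ~ b → U a b ≡ true
      sub    : ∀ {a b} → a ≢ b → U a b ≡ true → a ~ b
      new    : ∀ {a b} → a ∈ V → U a b ≡ false

  -- The state of a walk that started at v with the edge va and has reached w through the edge pw.
  record Walking (V : List (Fin n)) (U : Used n) (w v p a : Fin n) : Set where
    field
      sorted : Sorted V
      usym   : Symmetricᵘ U
      w∉     : w ∉ V
      v∉     : v ∉ V
      p∉     : p ∉ V
      w≢v    : w ≢ v
      w~p′   : w ~ p
      v~a    : v ~ a
      closed : ∀ {b y} → b ∈ V → b ~ y → y ∈ V ⊎ y ≡ w ⊎ y ≡ v
      nbrʷ   : ∀ {y} → w ~ y → y ≡ p ⊎ y ∈ V ⊎ y ≡ v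
      Uwp    : U w p ≡ true
      Uw     : ∀ {b} → U w b ≡ true → b ≡ p
      Uva    : U v a ≡ true
      Uv     : ∀ {b} → U v b ≡ true → b ≡ a
      new    : ∀ {b y} → b ∈ V → U b y ≡ false
      out    : ∀ {b y} → b ∉ V → b ≢ w → b ≢ v → b ~ y → U b y ≡ true
      sub    : ∀ {b y} → b ≢ y → U b y ≡ true → b ~ y
      reachʷ : comp S v w ≡ true
      reachᵖ : comp S v p ≡ true

  -- A stuck walk also certifies that the component is neither an edge nor a cycle, so that `φ v` is
  -- zero as well. For a cycle the path is returned, so that the walks in the two directions can be
  -- compared afterwards.
  data Outcome (f : ℕ) (V : List (Fin n)) (U : Used n) (w v p : Fin n) : Set ℓ where
    stuck : Df f L V U w v ≈ 0# → compIsEdge S v ≡ false → compIsCycle S v ≡ false → Outcome f V U w v p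
    edge  : p ≡ v → IsEdge v w → Df f L V U w v ≈ M w v * ∏ V φ → Outcome f V U w v p
    cycle : ∀ r → (∀ {x} → x ∈ r → x ∈ V) → Unique r → PathOK p w r v → deg S v ≡ 2 →
            Df f L V U w v ≈ (- ν (wt w r v)) * ∏ (removes r V) φ → Outcome f V U w v p

  others : Fin n → Fin n → List (Fin n)
  others w p = remove p (nb w)

  others⁻ : ∀ {w p y} → y ∈ others w p → w ~ y × y ≢ p
  others⁻ {w} m with ∈-remove⁻ (nb w) m
  ... | y∈ , ne = ∈⇒~ {w} y∈ , ne

  others⁺ : ∀ {w p y} → w ~ y → y ≢ p → y ∈ others w p
  others⁺ {w} wy ne = ∈-remove⁺ (~⇒∈ {w} wy) ne

  -- By the link, wp and wy are the only edges of S at w. Once wy is recorded, w has nothing left to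
  -- contribute and joins the finished vertices.
  advance : ∀ {V U w v p a y} → Walking V U w v p a → Link p w y → y ∈ V →
            Walking (remove y V) (add w y U) y v w a
  advance {V} {U} {w} {v} {p} {a} {y} W l y∈ = record
    { sorted = remove-Sorted y sorted
    ; usym   = add-sym {U = U} usym
    ; w∉     = λ m → proj₂ (∈-remove⁻ V m) refl
    ; v∉     = v∉ ∘ proj₁ ∘ ∈-remove⁻ V
    ; p∉     = w∉ ∘ proj₁ ∘ ∈-remove⁻ V
    ; w≢v    = λ { refl → v∉ y∈ }
    ; w~p′   = ~-sym (w~y l)
    ; v~a    = v~a
    ; closed = λ {b} {z} b∈ bz → cl (proj₁ (∈-remove⁻ V b∈)) (proj₂ (∈-remove⁻ V b∈)) bz (closed (proj₁ (∈-remove⁻ V b∈)) bz)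
    ; nbrʷ   = λ {z} yz → nb′ yz (closed y∈ yz)
    ; Uwp    = add-here′ {U = U}
    ; Uw     = λ t → uw (add⁻ {U = U} t)
    ; Uva    = add-mono {U = U} Uva
    ; Uv     = λ t → uv (add⁻ {U = U} t)
    ; new    = λ b∈ → add-false {U = U} (new (proj₁ (∈-remove⁻ V b∈)))
                 (λ { (refl , _) → w∉ (proj₁ (∈-remove⁻ V b∈)) }) (proj₂ (∈-remove⁻ V b∈) ∘ proj₁)
    ; out    = ou
    ; sub    = λ ne t → su ne (add⁻ {U = U} t)
    ; reachʷ = comp-adj v reachʷ (w~y l)
    ; reachᵖ = reachʷ }
    where
    open Walking W
    cl : ∀ {b z} → b ∈ V → b ≢ y → b ~ z → z ∈ V ⊎ z ≡ w ⊎ z ≡ v → z ∈ remove y V ⊎ z ≡ y ⊎ z ≡ v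
    cl {b} {z} b∈ by bz (inj₁ z∈) with z Finₚ.≟ y
    ... | yes e = inj₂ (inj₁ e)
    ... | no ne = inj₁ (∈-remove⁺ z∈ ne)
    cl b∈ by bz (inj₂ (inj₁ refl)) with only l (~-sym bz)
    ... | inj₁ refl = contradiction b∈ p∉
    ... | inj₂ e      = contradiction e by
    cl b∈ by bz (inj₂ (inj₂ e)) = inj₂ (inj₂ e)
    nb′ : ∀ {z} → y ~ z → z ∈ V ⊎ z ≡ w ⊎ z ≡ v → z ≡ w ⊎ z ∈ remove y V ⊎ z ≡ v
    nb′ yz (inj₁ z∈)       = inj₂ (inj₁ (∈-remove⁺ z∈ (≢-sym (~⇒≢ yz))))
    nb′ yz (inj₂ (inj₁ e)) = inj₁ e
    nb′ yz (inj₂ (inj₂ e)) = inj₂ (inj₂ e)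
    uw : ∀ {b} → U y b ≡ true ⊎ (y ≡ w × b ≡ y) ⊎ (y ≡ y × b ≡ w) → b ≡ w
    uw (inj₁ t)                 = true≢false t (new y∈)
    uw (inj₂ (inj₁ (refl , _))) = contradiction y∈ w∉
    uw (inj₂ (inj₂ (_ , e)))    = e
    uv : ∀ {b} → U v b ≡ true ⊎ (v ≡ w × b ≡ y) ⊎ (v ≡ y × b ≡ w) → b ≡ a
    uv (inj₁ t)                   = Uv t
    uv (inj₂ (inj₁ (e , _)))      = contradiction (sym e) w≢v
    uv (inj₂ (inj₂ (refl , _))) = contradiction y∈ v∉
    ouʷ : ∀ {z} → z ≡ p ⊎ z ≡ y → add w y U w z ≡ true
    ouʷ (inj₁ refl) = add-mono {U = U} Uwp
    ouʷ (inj₂ refl) = add-here {U = U}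
    ou : ∀ {b z} → b ∉ remove y V → b ≢ y → b ≢ v → b ~ z → add w y U b z ≡ true
    ou {b} {z} b∉ by bv bz = go (b Finₚ.≟ w) bz
      where
      go : Dec (b ≡ w) → b ~ z → add w y U b z ≡ true
      go (yes refl) wz = ouʷ (only l wz)
      go (no bw)      bz = add-mono {U = U} (out (λ m → b∉ (∈-remove⁺ m by)) bw bv bz)
    su : ∀ {b z} → b ≢ z → U b z ≡ true ⊎ (b ≡ w × z ≡ y) ⊎ (b ≡ y × z ≡ w) → b ~ z
    su ne (inj₁ t)                        = sub ne t
    su ne (inj₂ (inj₁ (refl , refl))) = w~y l
    su ne (inj₂ (inj₂ (refl , refl))) = ~-sym (w~y l)

  -- Serves both ways of closing: a cycle, and the return along a single edge, where p is v and a is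
  -- w.
  finish : ∀ {V U w v p a} → Walking V U w v p a → w ~ v → (∀ {y} → w ~ y → y ≡ p ⊎ y ≡ v) →
           (∀ {y} → v ~ y → y ≡ a ⊎ y ≡ w) → Between V (add w v U)
  finish {V} {U} {w} {v} {p} {a} W wv onlyw onlyv = record
    { sorted = sorted
    ; usym   = add-sym {U = U} usym
    ; closed = λ b∈ bz → cl b∈ bz (closed b∈ bz)
    ; out    = ou
    ; sub    = λ ne t → su ne (add⁻ {U = U} t)
    ; new    = λ b∈ → add-false {U = U} (new b∈) (λ { (refl , _) → w∉ b∈ }) (λ { (refl , _) → v∉ b∈ }) }
    where
    open Walking W
    cl : ∀ {b z} → b ∈ V → b ~ z → z ∈ V ⊎ z ≡ w ⊎ z ≡ v → z ∈ V
    cl b∈ bz (inj₁ z∈) = z∈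
    cl b∈ bz (inj₂ (inj₁ refl)) with onlyw (~-sym bz)
    ... | inj₁ refl = contradiction b∈ p∉
    ... | inj₂ refl = contradiction b∈ v∉
    cl b∈ bz (inj₂ (inj₂ refl)) with onlyv (~-sym bz)
    ... | inj₁ refl = true≢false (usym Uva) (new b∈)
    ... | inj₂ refl = contradiction b∈ w∉
    ouʷ : ∀ {z} → z ≡ p ⊎ z ≡ v → add w v U w z ≡ true
    ouʷ (inj₁ refl) = add-mono {U = U} Uwp
    ouʷ (inj₂ refl) = add-here {U = U}
    ouᵛ : ∀ {z} → z ≡ a ⊎ z ≡ w → add w v U v z ≡ true
    ouᵛ (inj₁ refl) = add-mono {U = U} Uva
    ouᵛ (inj₂ refl) = add-here′ {U = U}
    ou : ∀ {b z} → b ∉ V → b ~ z → add w v U b z ≡ true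
    ou {b} {z} b∉ bz = go (b Finₚ.≟ w) (b Finₚ.≟ v) bz
      where
      go : Dec (b ≡ w) → Dec (b ≡ v) → b ~ z → add w v U b z ≡ true
      go (yes refl) _            wz = ouʷ (onlyw wz)
      go (no _)       (yes refl) vz = ouᵛ (onlyv vz)
      go (no bw)      (no bv)      bz = add-mono {U = U} (out b∉ bw bv bz)
    su : ∀ {b z} → b ≢ z → U b z ≡ true ⊎ (b ≡ w × z ≡ v) ⊎ (b ≡ v × z ≡ w) → b ~ z
    su ne (inj₁ t)                        = sub ne t
    su ne (inj₂ (inj₁ (refl , refl))) = wv
    su ne (inj₂ (inj₂ (refl , refl))) = ~-sym wv

  module _ {V U w v p a} (W : Walking V U w v p a) where
    open Walking W

    skip-move : ∀ f {x y} → w ~ y → y ≢ p → x ∈ V → x ≢ y →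
                M w x * Df f L (remove x V) (add w x U) x v ≈ 0#
    skip-move f {x} {y} wy yp x∈ xy = move-dead f V U w v x usym
      (missing w y wy (add-false {U = U} (¬true⇒false (yp ∘ Uw)) (λ { (_ , e) → xy (sym e) }) (λ { (refl , _) → w∉ x∈ }))
        λ { (here refl) → w∉ x∈ ; (there (here e)) → w≢v e ; (there (there m)) → w∉ (proj₁ (∈-remove⁻ V m)) })

    skip-close : ∀ f {y} → w ~ y → y ≢ p → v ≢ y → M w v * Pf f L V (add w v U) ≈ 0#
    skip-close f {y} wy yp vy = close-dead f V U w v usym
      (missing w y wy (add-false {U = U} (¬true⇒false (yp ∘ Uw)) (λ { (_ , e) → vy (sym e) }) (w≢v ∘ proj₁)) w∉)

    root-close : ∀ f {z} → v ~ z → z ≢ a → z ≢ w → M w v * Pf f L V (add w v U) ≈ 0#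
    root-close f {z} vz za zw = close-dead f V U w v usym
      (missing v z vz (add-false {U = U} (¬true⇒false (za ∘ Uv)) (w≢v ∘ sym ∘ proj₁) (zw ∘ proj₂)) v∉)

  -- After the first step p and v are both the root, and w and a are both its chosen neighbour.
  Begin : ∀ {u V U y} → Between (u ∷ V) U → u ~ y → Walking (remove y V) (add u y U) y u u y
  Begin {u} {V} {U} {y} B uy = record
    { sorted = remove-Sorted y (AllPairs.tail sorted)
    ; usym   = add-sym {U = U} usym
    ; w∉     = λ m → proj₂ (∈-remove⁻ V m) refl
    ; v∉     = u∉ ∘ proj₁ ∘ ∈-remove⁻ V
    ; p∉     = u∉ ∘ proj₁ ∘ ∈-remove⁻ V
    ; w≢v    = ≢-sym (~⇒≢ uy)
    ; w~p′   = ~-sym uy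
    ; v~a    = uy
    ; closed = λ b∈ bz → cl (closed (there (proj₁ (∈-remove⁻ V b∈))) bz)
    ; nbrʷ   = λ yz → nb′ yz (closed y∈ yz)
    ; Uwp    = add-here′ {U = U}
    ; Uw     = λ t → uw (add⁻ {U = U} t)
    ; Uva    = add-here {U = U}
    ; Uv     = λ t → uv (add⁻ {U = U} t)
    ; new    = λ b∈ → add-false {U = U} (new (there (proj₁ (∈-remove⁻ V b∈))))
                 (λ { (refl , _) → u∉ (proj₁ (∈-remove⁻ V b∈)) }) (proj₂ (∈-remove⁻ V b∈) ∘ proj₁)
    ; out    = λ b∉ by bu bz → add-mono {U = U} (out (λ { (here e) → bu e ; (there m) → b∉ (∈-remove⁺ m by) }) bz)
    ; sub    = λ ne t → su ne (add⁻ {U = U} t)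
    ; reachʷ = comp-adj u (comp-refl u) uy
    ; reachᵖ = comp-refl u }
    where
    open Between B
    u∉ : u ∉ V
    u∉ m = ℕₚ.<-irrefl refl (All.lookup (AllPairs.head sorted) m)
    y∈ : y ∈ u ∷ V
    y∈ = closed (here refl) uy
    cl : ∀ {z} → z ∈ u ∷ V → z ∈ remove y V ⊎ z ≡ y ⊎ z ≡ u
    cl (here e) = inj₂ (inj₂ e)
    cl {z} (there m) with z Finₚ.≟ y
    ... | yes e = inj₂ (inj₁ e)
    ... | no ne = inj₁ (∈-remove⁺ m ne)
    nb′ : ∀ {z} → y ~ z → z ∈ u ∷ V → z ≡ u ⊎ z ∈ remove y V ⊎ z ≡ u
    nb′ yz (here e)  = inj₁ e
    nb′ yz (there m) = inj₂ (inj₁ (∈-remove⁺ m (≢-sym (~⇒≢ yz))))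
    uw : ∀ {b} → U y b ≡ true ⊎ (y ≡ u × b ≡ y) ⊎ (y ≡ y × b ≡ u) → b ≡ u
    uw (inj₁ t)              = true≢false t (new y∈)
    uw (inj₂ (inj₁ (e , _))) = contradiction (sym e) (~⇒≢ uy)
    uw (inj₂ (inj₂ (_ , e))) = e
    uv : ∀ {b} → U u b ≡ true ⊎ (u ≡ u × b ≡ y) ⊎ (u ≡ y × b ≡ u) → b ≡ y
    uv (inj₁ t)              = true≢false t (new (here refl))
    uv (inj₂ (inj₁ (_ , e))) = e
    uv (inj₂ (inj₂ (e , _))) = contradiction e (~⇒≢ uy)
    su : ∀ {b z} → b ≢ z → U b z ≡ true ⊎ (b ≡ u × z ≡ y) ⊎ (b ≡ y × z ≡ u) → b ~ z
    su ne (inj₁ t)                        = sub ne t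
    su ne (inj₂ (inj₁ (refl , refl))) = uy
    su ne (inj₂ (inj₂ (refl , refl))) = ~-sym uy

  Df-zero : ∀ f V U w v → M w v * Pf f L V (add w v U) ≈ 0# →
    (∀ {x} → x ∈ V → M w x * Df f L (remove x V) (add w x U) x v ≈ 0#) → Df (suc f) L V U w v ≈ 0#
  Df-zero f V U w v e h = ≈-trans (x-0≈x (∑-zero∈ V h)) e

  Begin-∈ : ∀ {u V U y} → Between (u ∷ V) U → u ~ y → y ∈ V
  Begin-∈ B uy with Between.closed B (here refl) uy
  ... | here refl = contradiction refl (~⇒≢ uy)
  ... | there m     = m

  isolate : ∀ {u V U} → Between (u ∷ V) U → nb u ≡ [] → Between V (add u u U)
  isolate {u} {V} {U} B e = record
    { sorted = AllPairs.tail sorted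
    ; usym   = add-sym {U = U} usym
    ; closed = λ a∈ ab → cl a∈ ab (closed (there a∈) ab)
    ; out    = λ a∉ ab → add-mono {U = U} (out (λ { (here refl) → none′ ab ; (there m) → a∉ m }) ab)
    ; sub    = λ ne t → su ne (add⁻ {U = U} t)
    ; new    = λ a∈ → add-false {U = U} (new (there a∈)) (λ { (refl , _) → u∉ a∈ }) (λ { (refl , _) → u∉ a∈ }) }
    where
    open Between B
    u∉ : u ∉ V
    u∉ m = ℕₚ.<-irrefl refl (All.lookup (AllPairs.head sorted) m)
    none′ : ∀ {y} → ¬ (u ~ y)
    none′ {y} uy with subst (y ∈_) e (~⇒∈ uy)
    ... | ()
    cl : ∀ {a b} → a ∈ V → a ~ b → b ∈ u ∷ V → b ∈ V
    cl a∈ ab (here refl) = ⊥-elim (none′ (~-sym ab))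
    cl a∈ ab (there m)     = m
    su : ∀ {a b} → a ≢ b → U a b ≡ true ⊎ (a ≡ u × b ≡ u) ⊎ (a ≡ u × b ≡ u) → a ~ b
    su ne (inj₁ t)                        = sub ne t
    su ne (inj₂ (inj₁ (refl , refl))) = contradiction refl ne
    su ne (inj₂ (inj₂ (refl , refl))) = contradiction refl ne

  neg-*-neg : ∀ x y z → (- x) * ((- y) * z) ≈ (x * y) * z
  neg-*-neg x y z = begin
    (- x) * ((- y) * z)   ≈⟨ *-assoc (- x) (- y) z ⟨
    ((- x) * (- y)) * z   ≈⟨ *-congʳ (-‿distribˡ-* x (- y)) ⟨
    (- (x * - y)) * z     ≈⟨ *-congʳ (-‿cong (-‿distribʳ-* x y)) ⟨
    (- (- (x * y))) * z   ≈⟨ *-congʳ (-‿involutive (x * y)) ⟩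
    (x * y) * z           ∎
    where open import Relation.Binary.Reasoning.Setoid setoid

  -- Every move brings one minus from the recursion and one from the entry of xI - N. They cancel,
  -- so the single minus of the closing step survives whatever the length of the cycle.
  neg-neg-* : ∀ x y z → - ((- x) * ((- y) * z)) ≈ (- (x * y)) * z
  neg-neg-* x y z = ≈-trans (-‿cong (neg-*-neg x y z)) (-‿distribˡ-* (x * y) z)

  -- The sum over the first step of a walk. What lies beyond that step enters through hypotheses, so
  -- the recursion stays between `walk` and `Pf≈∏φ`. The list `l` exposes the first neighbour of u,
  -- which is where `cycleWeight` starts.
  root-step : ∀ f {u V U} → Between (u ∷ V) U →
    (∀ {y} → u ~ y → Outcome f (remove y V) (add u y U) y u u) →
    (nb u ≡ [] → Pf f L V (add u u U) ≈ ∏ V φ) →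
    ∀ l → nb u ≡ l → Df (suc f) L V U u u ≈ φ u * ∏ V φ
  root-step f {u} {V} {U} B walks isolated [] eq = ≈-trans
      (x-0≈x (∑-zero∈ V λ {x} x∈ → move-≁ f V U u u x usym (λ { refl → u∉ x∈ }) (¬true⇒false none′)))
      (*-cong (≈-trans (M-diag u) (≈-sym (φ-isolated eq))) (isolated eq))
    where
    open Between B
    u∉ : u ∉ V
    u∉ m = ℕₚ.<-irrefl refl (All.lookup (AllPairs.head sorted) m)
    none′ : ∀ {y} → ¬ (u ~ y)
    none′ {y} uy with subst (y ∈_) eq (~⇒∈ uy)
    ... | ()
  root-step f {u} {V} {U} B walks isolated (a ∷ l) eq = conclude (walks ua)
    where
    open Between B
    u∉ : u ∉ V
    u∉ m = ℕₚ.<-irrefl refl (All.lookup (AllPairs.head sorted) m)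
    V-Unique : Unique V
    V-Unique = Sorted⇒Unique (AllPairs.tail sorted)
    below : ∀ {x} → x ∈ V → u Fin.< x
    below = All.lookup (AllPairs.head sorted)
    ua : u ~ a
    ua = ∈⇒~ (subst (a ∈_) (sym eq) (here refl))
    a∈ : a ∈ V
    a∈ = Begin-∈ B ua
    term : Fin n → Carrier
    term x = M u x * Df f L (remove x V) (add u x U) x u
    Df≈ : Df (suc f) L V U u u ≈ - ∑ V term
    -- The diagonal term vanishes: closing at once would leave u without its edge ua.
    Df≈ = 0-x≈-x (close-dead f V U u u usym
      (missing u a ua (add-false {U = U} (new (here refl)) (~⇒≢ ua ∘ sym ∘ proj₂) (~⇒≢ ua ∘ sym ∘ proj₂)) u∉))
    term-≁ : ∀ {x} → x ∈ V → ¬ (u ~ x) → term x ≈ 0#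
    term-≁ {x} x∈ ne = move-≁ f V U u u x usym (λ { refl → u∉ x∈ }) (¬true⇒false ne)

    isCycle : ∀ {y r} → (∀ {x} → x ∈ r → x ∈ remove y V) → u ~ y → Unique r → PathOK u y r u → deg S u ≡ 2 →
              IsCycle u y r
    isCycle r⊆ uy ur ok d = record
      { pathOK = ok
      ; unique = (~⇒≢ uy ∷ All.tabulate (λ m → λ { refl → u∉ (proj₁ (∈-remove⁻ V (r⊆ m))) }))
                 ∷ All.tabulate (λ m → λ { refl → proj₂ (∈-remove⁻ V (r⊆ m)) refl }) ∷ ur
      ; root   = d }

    conclude : Outcome f (remove a V) (add u a U) a u u → Df (suc f) L V U u u ≈ φ u * ∏ V φ
    conclude (stuck e e₁ e₂) = begin
      Df (suc f) L V U u u   ≈⟨ Df≈ ⟩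
      - ∑ V term             ≈⟨ -‿cong (∑-zero∈ V (λ {x} x∈ → zero-term x∈ (adjS S u x) refl)) ⟩
      - 0#                   ≈⟨ -0#≈0# ⟩
      0#                     ≈⟨ zeroˡ _ ⟨
      0# * ∏ V φ             ≈⟨ *-congʳ (φ-nonelem (inV-~ ua) (cong₂ _∨_ e₁ e₂)) ⟨
      φ u * ∏ V φ            ∎
      where
      open import Relation.Binary.Reasoning.Setoid setoid
      -- One stuck direction settles all the others: an edge or a cycle found through x would
      -- contradict what the stuck walk says about the component of u.
      from : ∀ {x} → u ~ x → Outcome f (remove x V) (add u x U) x u u → term x ≈ 0#
      from ux (stuck e′ _ _)           = ≈-trans (*-congˡ e′) (zeroʳ _)
      from ux (edge _ ie _)            = true≢false (IsEdge⇒compIsEdge ie) e₁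
      from ux (cycle r r⊆ ur ok d _)   = true≢false (cycle⇒compIsCycle (isCycle r⊆ ux ur ok d) (here refl)) e₂
      zero-term : ∀ {x} → x ∈ V → ∀ b → adjS S u x ≡ b → term x ≈ 0#
      zero-term x∈ true  ux = from ux (walks ux)
      zero-term x∈ false ne = term-≁ x∈ (λ ux → true≢false ux ne)
    conclude (edge _ ie e) = begin
      Df (suc f) L V U u u                              ≈⟨ Df≈ ⟩
      - ∑ V term                                        ≈⟨ -‿cong (∑-single V V-Unique a∈
                                                             (λ x∈ xa → term-≁ x∈ (xa ∘ onlyᵘ ie))) ⟩
      - term a                                          ≈⟨ -‿cong (*-congˡ e) ⟩
      - (M u a * (M a u * ∏ (remove a V) φ))            ≈⟨ -‿cong (*-cong (M-off (~⇒≢ ua)) (*-congʳ (M-off (≢-sym (~⇒≢ ua))))) ⟩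
      - ((- ν (N G u a)) * ((- ν (N G a u)) * ∏ (remove a V) φ))  ≈⟨ neg-neg-* _ _ _ ⟩
      (- (ν (N G u a) * ν (N G a u))) * ∏ (remove a V) φ  ≈⟨ *-cong (-‿cong (ν-* _ _)) (≈-sym (∏-remove V φa)) ⟨
      (- ν (N G u a *ω N G a u)) * ∏ V φ                ≈⟨ *-congʳ (-‿cong (reflexive (cong ν (N-*-flip ua)))) ⟩
      (- ν 1ω) * ∏ V φ                                  ≈⟨ *-congʳ (ν-neg 1ω) ⟨
      ν (-ω 1ω) * ∏ V φ                                 ≈⟨ *-congʳ (≈-trans (φ-elem (inV-~ ua) (IsEdge⇒elem ie))
                                                             (reflexive (cong (ν ∘ fromℤ) (ψ-edge-rep ie (below a∈))))) ⟨
      φ u * ∏ V φ                                       ∎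
      where
      open import Relation.Binary.Reasoning.Setoid setoid
      φa : φ a ≈ 1#
      φa = ≈-trans (φ-elem (inV-~ (~-sym ua)) (IsEdge⇒elem (IsEdge-sym ie)))
        (≈-trans (reflexive (cong (ν ∘ fromℤ) (ψ-edge-other ie (below a∈)))) ν-1)
    conclude (cycle r r⊆ ur ok d e) = second (lastOf a r) refl (walks ub)
      where
      open import Relation.Binary.Reasoning.Setoid setoid
      cy : IsCycle u a r
      cy = isCycle r⊆ ua ur ok d
      ub : u ~ lastOf a r
      ub = ~-sym (path-last r ok)
      W : ℤω
      W = wt u (a ∷ r) u
      on-cycle : ∀ {x} → x ∈ a ∷ r → u Fin.< x
      on-cycle (here refl) = below a∈
      on-cycle (there m)     = below (proj₁ (∈-remove⁻ V (r⊆ m)))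
      φ≈1 : ∀ {x} → x ∈ a ∷ r → φ x ≈ 1#
      φ≈1 m = ≈-trans (φ-elem (cycle⇒inV cy (there m)) (cycle⇒elem cy (there m)))
        (≈-trans (reflexive (cong (ν ∘ fromℤ) (ψ-cycle-other cy on-cycle m))) ν-1)
      contribution : ∀ {y s} → u ~ y → (∀ {x} → x ∈ y ∷ s → x ∈ a ∷ r) →
        Df f L (remove y V) (add u y U) y u ≈ (- ν (wt y s u)) * ∏ (removes s (remove y V)) φ →
        term y ≈ ν (wt u (y ∷ s) u) * ∏ V φ
      contribution {y} {s} uy s⊆ e′ = begin
        M u y * Df f L (remove y V) (add u y U) y u
          ≈⟨ *-cong (M-off (~⇒≢ uy)) e′ ⟩
        (- ν (N G u y)) * ((- ν (wt y s u)) * ∏ (removes s (remove y V)) φ)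
          ≈⟨ neg-*-neg _ _ _ ⟩
        (ν (N G u y) * ν (wt y s u)) * ∏ (removes (y ∷ s) V) φ
          ≈⟨ *-cong (≈-sym (ν-* _ _)) (∏-removes (y ∷ s) V (φ≈1 ∘ s⊆)) ⟩
        ν (wt u (y ∷ s) u) * ∏ V φ ∎
      u∉r : u ∉ a ∷ r
      u∉r m = ℕₚ.<-irrefl refl (on-cycle m)
      second : ∀ b → b ≡ lastOf a r → Outcome f (remove (lastOf a r) V) (add u (lastOf a r) U) (lastOf a r) u u →
               Df (suc f) L V U u u ≈ φ u * ∏ V φ
      second b _  (stuck _ _ e₂) = true≢false (cycle⇒compIsCycle cy (here refl)) e₂
      second b _  (edge _ ie _)  = contradiction d (IsEdge⇒deg≢2 ie)
      second b be (cycle s s⊆ us ok′ d′ e′) = begin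
        Df (suc f) L V U u u                    ≈⟨ Df≈ ⟩
        - ∑ V term                              ≈⟨ -‿cong (∑-pair V V-Unique a∈ (Begin-∈ B ub) (a≢last cy)
                                                     (λ x∈ xa xb → term-≁ x∈ (λ ux → Sum.[ xa , xb ]′ (root-nbrs cy ux)))) ⟩
        - (term a + term (lastOf a r))          ≈⟨ -‿cong (+-cong (contribution ua id e)
                                                     (contribution ub s⊆cycle e′)) ⟩
        - (ν W * ∏ V φ + ν (wt u (lastOf a r ∷ s) u) * ∏ V φ)
                                                ≈⟨ -‿cong (+-congˡ (*-congʳ (reflexive (cong ν weight)))) ⟩
        - (ν W * ∏ V φ + ν (conj W) * ∏ V φ)    ≈⟨ -‿cong (distribʳ _ _ _) ⟨
        - ((ν W + ν (conj W)) * ∏ V φ)          ≈⟨ -‿distribˡ-* _ _ ⟩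
        (- (ν W + ν (conj W))) * ∏ V φ          ≈⟨ *-congʳ (-‿cong (ν-+ W (conj W))) ⟨
        (- ν (W +ω conj W)) * ∏ V φ             ≈⟨ *-congʳ (ν-neg (W +ω conj W)) ⟨
        ν (-ω (W +ω conj W)) * ∏ V φ            ≈⟨ *-congʳ (≈-trans (φ-elem (inV-~ ua) (cycle⇒elem cy (here refl)))
                                                     (reflexive (cong ν (ψ-cycle-root cy (cong headM eq) on-cycle)))) ⟨
        φ u * ∏ V φ                             ∎
        where
        cy′ : IsCycle u (lastOf a r) s
        cy′ = isCycle s⊆ ub us ok′ d′
        u∉s : u ∉ s
        u∉s m = u∉ (proj₁ (∈-remove⁻ V (s⊆ m)))
        s⊆cycle : ∀ {x} → x ∈ lastOf a r ∷ s → x ∈ a ∷ r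
        s⊆cycle {x} m with comp⇒cycle cy (cycle⇒comp cy′ (there m))
        ... | there m′    = m′
        ... | here refl with m
        ...   | here e″   = contradiction e″ (~⇒≢ ub)
        ...   | there m″  = contradiction m″ u∉s
        weight : wt u (lastOf a r ∷ s) u ≡ conj W
        -- The walk found in the other direction and the reversal of the first one are both
        -- unbranched paths from u through `lastOf a r`, so they coincide.
        weight with path-reverse u r [] (N G u a) refl ok (N-flip u a) (λ ()) u∉r
        ... | s′ , okʳ , u∉s′ , eʳ with path-det s s′ ok′ okʳ u∉s u∉s′
        ...   | refl = eʳ

  -- The neighbours of w other than p decide. With none, w has degree one, which only an edge
  -- component allows. With two or more, any step abandons an edge at w. With exactly one the step
  -- is forced, and it either closes the walk or extends it.
  walk : ∀ f {V U w v p a} → Walking V U w v p a → length V < f → Outcome f V U w v p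
  Pf≈∏φ : ∀ f {V U} → Between V U → length V ≤ f → Pf f L V U ≈ ∏ V φ

  walk (suc f) {V} {U} {w} {v} {p} {a} W (s≤s le) with others w p in eq
  walk (suc f) {V} {U} {w} {v} {p} {a} W (s≤s le) | [] with p Finₚ.≟ v
  ... | no pv = stuck
      (Df-zero f V U w v (close-≁ f V U w v usym w≢v (¬true⇒false (λ wv → pv (sym (leaf′ wv))))) moves)
      (compIsEdge-false pv (≢-sym (~⇒≢ w~p′)) (≢-sym w≢v) reachᵖ (comp-refl v) reachʷ)
      (compIsCycle-false reachʷ deg≢2)
    where
    open Walking W
    leaf′ : ∀ {y} → w ~ y → y ≡ p
    leaf′ {y} wy with y Finₚ.≟ p
    ... | yes e = e
    ... | no ne with subst (y ∈_) eq (others⁺ {w} wy ne)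
    ...   | ()
    deg≢2 : deg S w ≢ 2
    deg≢2 d = contradiction (subst (_≤ 1) d (deg≤ {w} {p ∷ []} (here ∘ leaf′))) λ { (s≤s ()) }
    moves : ∀ {x} → x ∈ V → M w x * Df f L (remove x V) (add w x U) x v ≈ 0#
    moves {x} x∈ = move-≁ f V U w v x usym (λ { refl → w∉ x∈ })
      (¬true⇒false (λ wx → p∉ (subst (_∈ V) (leaf′ wx) x∈)))
  ... | yes refl = split (others v a) refl
    where
    open Walking W
    leaf′ : ∀ {y} → w ~ y → y ≡ v
    leaf′ {y} wy with y Finₚ.≟ v
    ... | yes e = e
    ... | no ne with subst (y ∈_) eq (others⁺ {w} wy ne)
    ...   | ()
    w≡a : w ≡ a
    -- As p is v, the pair vw is recorded, and a is the only recorded partner of v: the walk has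
    -- made a single step.
    w≡a = Uv (usym Uwp)
    deg≢2 : deg S w ≢ 2
    deg≢2 d = contradiction (subst (_≤ 1) d (deg≤ {w} {v ∷ []} (here ∘ leaf′))) λ { (s≤s ()) }
    moves : ∀ {x} → x ∈ V → M w x * Df f L (remove x V) (add w x U) x v ≈ 0#
    moves {x} x∈ = move-≁ f V U w v x usym (λ { refl → w∉ x∈ })
      (¬true⇒false (λ wx → v∉ (subst (_∈ V) (leaf′ wx) x∈)))
    split : ∀ l → others v a ≡ l → Outcome (suc f) V U w v v
    split (z ∷ _) eq₂ with others⁻ (subst (z ∈_) (sym eq₂) (here refl))
    ... | vz , za = stuck
      (Df-zero f V U w v (root-close W f vz za (λ e → za (trans e w≡a))) moves)
      (compIsEdge-false (≢-sym w≢v) (~⇒≢ vz) (λ e → za (trans (sym e) w≡a))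
        (comp-refl v) reachʷ (comp-adj v (comp-refl v) vz))
      (compIsCycle-false reachʷ deg≢2)
    split [] eq₂ = edge refl
      (record { u~w = ~-sym w~p′ ; onlyᵘ = onlyv ; onlyʷ = leaf′ })
      (≈-trans (x-0≈x (∑-zero∈ V moves))
        (*-congˡ (Pf≈∏φ f (finish W w~p′ (inj₁ ∘ leaf′) (inj₂ ∘ onlyv)) le)))
      where
      onlyv : ∀ {y} → v ~ y → y ≡ w
      onlyv {y} vy with y Finₚ.≟ a
      ... | yes e = trans e (sym w≡a)
      ... | no ne with subst (y ∈_) eq₂ (others⁺ {v} vy ne)
      ...   | ()
  walk (suc f) {V} {U} {w} {v} {p} {a} W (s≤s le) | y ∷ z ∷ l = stuck
      (Df-zero f V U w v (close′ (v Finₚ.≟ y)) moves)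
      (compIsEdge-false (≢-sym (proj₂ oy)) (≢-sym (proj₂ oz)) y≢z reachᵖ
        (comp-adj v reachʷ (proj₁ oy)) (comp-adj v reachʷ (proj₁ oz)))
      (compIsCycle-false reachʷ λ d → contradiction
        (subst (3 ≤_) d (deg≥₃ (≢-sym (proj₂ oy)) (≢-sym (proj₂ oz)) y≢z w~p′ (proj₁ oy) (proj₁ oz)))
        λ { (s≤s (s≤s ())) })
    where
    open Walking W
    oy : w ~ y × y ≢ p
    oy = others⁻ (subst (y ∈_) (sym eq) (here refl))
    oz : w ~ z × z ≢ p
    oz = others⁻ (subst (z ∈_) (sym eq) (there (here refl)))
    y≢z : y ≢ z
    y≢z with subst Unique eq (Uniqueₚ.filter⁺ (λ x → ¬? (x Finₚ.≟ p)) (nb-Unique w))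
    ... | (ne ∷ _) ∷ _ = ne
    -- At least one of y and z is not the vertex stepped to, and its edge at w is abandoned.
    close′ : Dec (v ≡ y) → M w v * Pf f L V (add w v U) ≈ 0#
    close′ (yes e) = skip-close W f (proj₁ oz) (proj₂ oz) (λ e′ → y≢z (trans (sym e) e′))
    close′ (no ne) = skip-close W f (proj₁ oy) (proj₂ oy) ne
    move′ : ∀ {x} → x ∈ V → Dec (x ≡ y) → M w x * Df f L (remove x V) (add w x U) x v ≈ 0#
    move′ x∈ (yes e) = skip-move W f (proj₁ oz) (proj₂ oz) x∈ (λ e′ → y≢z (trans (sym e) e′))
    move′ x∈ (no ne) = skip-move W f (proj₁ oy) (proj₂ oy) x∈ ne
    moves : ∀ {x} → x ∈ V → M w x * Df f L (remove x V) (add w x U) x v ≈ 0#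
    moves {x} x∈ = move′ x∈ (x Finₚ.≟ y)
  walk (suc f) {V} {U} {w} {v} {p} {a} W (s≤s le) | y ∷ [] = step (y Finₚ.≟ v)
    where
    open Walking W
    oy : w ~ y × y ≢ p
    oy = others⁻ (subst (y ∈_) (sym eq) (here refl))
    onlyw : ∀ {z} → w ~ z → z ≡ p ⊎ z ≡ y
    onlyw {z} wz with z Finₚ.≟ p
    ... | yes e = inj₁ e
    ... | no ne with subst (z ∈_) eq (others⁺ {w} wz ne)
    ...   | here e = inj₂ e
    l : Link p w y
    l = link (≢-sym (proj₂ oy)) w~p′ (proj₁ oy) onlyw
    advanced : y ≢ v → y ∈ V → Outcome f (remove y V) (add w y U) y v w → Outcome (suc f) V U w v p
    advanced yv y∈ o = conclude o
      where
      Df≈ : Df (suc f) L V U w v ≈ - (M w y * Df f L (remove y V) (add w y U) y v)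
      Df≈ = ≈-trans (0-x≈-x (skip-close W f (proj₁ oy) (proj₂ oy) (≢-sym yv)))
        (-‿cong (∑-single V (Sorted⇒Unique sorted) y∈ (skip-move W f (proj₁ oy) (proj₂ oy))))
      conclude : Outcome f (remove y V) (add w y U) y v w → Outcome (suc f) V U w v p
      conclude (stuck e e₁ e₂) =
        stuck (≈-trans Df≈ (≈-trans (-‿cong (≈-trans (*-congˡ e) (zeroʳ _))) -0#≈0#)) e₁ e₂
      -- Beyond this step the predecessor is w, which is not v, so the rest cannot report an edge
      -- component.
      conclude (edge e _ _) = contradiction e w≢v
      conclude (cycle r r⊆ ur ok d e) = cycle (y ∷ r)
        (λ { (here refl) → y∈ ; (there m) → proj₁ (∈-remove⁻ V (r⊆ m)) })
        (All.tabulate (λ m → λ { refl → proj₂ (∈-remove⁻ V (r⊆ m)) refl }) ∷ ur)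
        (l , ok) d
        (≈-trans Df≈ (≈-trans (-‿cong (*-cong (M-off (~⇒≢ (proj₁ oy))) e))
          (≈-trans (neg-neg-* (ν (N G w y)) (ν (wt y r v)) _)
            (*-congʳ (-‿cong (≈-sym (ν-* (N G w y) (wt y r v))))))))
    closing : y ≡ v → Outcome (suc f) V U w v p
    closing refl = split (remove w (others v a)) refl
      where
      w≢a : w ≢ a
      w≢a refl = proj₂ oy (Uw (usym Uva))
      moves : ∀ {x} → x ∈ V → M w x * Df f L (remove x V) (add w x U) x v ≈ 0#
      moves {x} x∈ = skip-move W f (proj₁ oy) (proj₂ oy) x∈ (λ { refl → v∉ x∈ })
      split : ∀ l → remove w (others v a) ≡ l → Outcome (suc f) V U w v p
      -- Here v has a third neighbour z besides a and w. Closing abandons vz, and degree three at v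
      -- excludes a cycle.
      split (z ∷ _) eq₂ = stuck
          (Df-zero f V U w v (root-close W f vz za zw) moves)
          (compIsEdge-false (≢-sym w≢a) (≢-sym za) (≢-sym zw) (comp-adj v (comp-refl v) v~a) reachʷ
            (comp-adj v (comp-refl v) vz))
          (compIsCycle-false (comp-refl v) λ d → contradiction
            (subst (3 ≤_) d (deg≥₃ (≢-sym w≢a) (≢-sym za) (≢-sym zw) v~a (~-sym (proj₁ oy)) vz))
            λ { (s≤s (s≤s ())) })
        where
        z∈ : z ∈ others v a × z ≢ w
        z∈ = ∈-remove⁻ (others v a) (subst (z ∈_) (sym eq₂) (here refl))
        vz : v ~ z
        vz = proj₁ (others⁻ (proj₁ z∈))
        za : z ≢ a
        za = proj₂ (others⁻ {v} (proj₁ z∈))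
        zw : z ≢ w
        zw = proj₂ z∈
      split [] eq₂ = cycle [] (λ ()) [] l
          (Link⇒deg≡2 (link (≢-sym w≢a) v~a (~-sym (proj₁ oy)) onlyv))
          (≈-trans (x-0≈x (∑-zero∈ V moves))
            (*-cong (M-off w≢v) (Pf≈∏φ f (finish W (proj₁ oy) onlyw onlyv) le)))
        where
        onlyv : ∀ {z} → v ~ z → z ≡ a ⊎ z ≡ w
        onlyv {z} vz with z Finₚ.≟ a | z Finₚ.≟ w
        ... | yes e | _     = inj₁ e
        ... | no _  | yes e = inj₂ e
        ... | no za | no zw with subst (z ∈_) eq₂ (∈-remove⁺ (others⁺ {v} vz za) zw)
        ...   | ()
    step : Dec (y ≡ v) → Outcome (suc f) V U w v p
    step (yes e) = closing e
    step (no yv) = advanced yv y∈ (walk f (advance W l y∈) (ℕₚ.<-≤-trans (length-remove-∈ y∈) le))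
      where
      y∈ : y ∈ V
      y∈ with nbrʷ (proj₁ oy)
      ... | inj₁ e        = contradiction e (proj₂ oy)
      ... | inj₂ (inj₁ m) = m
      ... | inj₂ (inj₂ e) = contradiction e yv

  -- With no vertex left, `out` and `sub` say that `U` and S agree off the diagonal, which is all
  -- that `leaf` inspects.
  Pf≈∏φ f {[]} {U} B _ = leaf-match {U = U} λ {a} {b} ab → bool-ext (out (λ ())) (sub ab)
    where
    open Between B
    bool-ext : ∀ {x y} → (x ≡ true → y ≡ true) → (y ≡ true → x ≡ true) → x ≡ y
    bool-ext {true}          h k = sym (h refl)
    bool-ext {false} {false} h k = refl
    bool-ext {false} {true}  h k = k refl
  Pf≈∏φ (suc f) {u ∷ V} {U} B (s≤s le) = root-step f B
    (λ uy → walk f (Begin B uy) (ℕₚ.<-≤-trans (length-remove-∈ (Begin-∈ B uy)) le))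
    (λ e → Pf≈∏φ f (isolate B e) le) (nb u) refl

-- Coefficients

module 𝕡 = CommutativeRing Poly-commutativeRing
open RingSums Poly-commutativeRing using (∑; ∏; ∑-cong∈)
open RingSums ℤₚ.+-*-commutativeRing using () renaming (∏ to ∏ℤ)

monomial : ℕ → ℤω → Poly
monomial zero    z = constP z
monomial (suc m) z = shift (monomial m z)

coeff-monomial : ∀ m z i → coeff (monomial m z) i ≡ (if m ℕ.≡ᵇ i then z else 0ω)
coeff-monomial zero    z zero    = refl
coeff-monomial zero    z (suc i) = refl
coeff-monomial (suc m) z zero    = refl
coeff-monomial (suc m) z (suc i) = coeff-monomial m z i

X-*P : ∀ p → X *P p ≈P shift p
X-*P p i = trans (shift-*P (constP 1ω) p i)
  (shift-cong (constP 1ω *P p) p (*P-identityˡ p) i)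

scaleP-monomial : ∀ a m z → scaleP a (monomial m z) ≈P monomial m (a *ω z)
scaleP-monomial a zero    z i       = refl
scaleP-monomial a (suc m) z zero    = ω.zeroʳ a
scaleP-monomial a (suc m) z (suc i) = scaleP-monomial a m z i

constP-monomial : ∀ a m z → constP a *P monomial m z ≈P monomial m (a *ω z)
constP-monomial a m z i = trans (constP-*P a (monomial m z) i) (scaleP-monomial a m z i)

fromℤ-* : ∀ a b → fromℤ a *ω fromℤ b ≡ fromℤ (a ℤ.* b)
fromℤ-* a b = cong₂ mkω (eqr a b) (eqi a b)
  where
  eqr : ∀ a b → a ℤ.* b ℤ.- + 0 ℤ.* + 0 ≡ a ℤ.* b
  eqr = solve-∀
  eqi : ∀ a b → a ℤ.* + 0 ℤ.+ + 0 ℤ.* b ℤ.+ + 0 ℤ.* + 0 ≡ + 0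
  eqi = solve-∀

∏-zero∈ : ∀ {A : Set} {v : A} V (f : A → Poly) → v ∈ V → f v ≈P [] → ∏ V f ≈P []
∏-zero∈ (x ∷ V) f (here refl) e = 𝕡.trans {f x *P ∏ V f} {[] *P ∏ V f} {[]}
  (𝕡.*-congʳ {∏ V f} {f x} {[]} e) (𝕡.zeroˡ (∏ V f))
∏-zero∈ (x ∷ V) f (there v∈) e = 𝕡.trans {f x *P ∏ V f} {f x *P []} {[]}
  (𝕡.*-congˡ {f x} {∏ V f} {[]} (∏-zero∈ V f v∈ e)) (𝕡.zeroʳ (f x))

-- Each vertex not satisfying `q` contributes one factor x. Requiring `g` to be 1 there lets the
-- coefficient be a product over all vertices, which is the form that `∏-weight` evaluates.
∏-monomial : ∀ {A : Set} (q : A → Bool) (g : A → ℤ) (h : A → Poly) →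
  (∀ v → q v ≡ true → h v ≡ constP (fromℤ (g v))) →
  (∀ v → q v ≡ false → h v ≡ X) → (∀ v → q v ≡ false → g v ≡ + 1) →
  ∀ V → ∏ V h ≈P monomial (length (List.filterᵇ (not ∘ q) V)) (fromℤ (∏ℤ V g))
∏-monomial q g h e₁ e₂ e₃ []      i = refl
∏-monomial q g h e₁ e₂ e₃ (v ∷ V) i with q v in eq
... | true  = begin
  coeff (h v *P ∏ V h) i
    ≡⟨ cong (λ p → coeff (p *P ∏ V h) i) (e₁ v eq) ⟩
  coeff (constP (fromℤ (g v)) *P ∏ V h) i
    ≡⟨ *P-congʳ (constP (fromℤ (g v))) (∏ V h) (monomial m (fromℤ (∏ℤ V g))) (∏-monomial q g h e₁ e₂ e₃ V) i ⟩
  coeff (constP (fromℤ (g v)) *P monomial m (fromℤ (∏ℤ V g))) i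
    ≡⟨ constP-monomial (fromℤ (g v)) m (fromℤ (∏ℤ V g)) i ⟩
  coeff (monomial m (fromℤ (g v) *ω fromℤ (∏ℤ V g))) i
    ≡⟨ cong (λ z → coeff (monomial m z) i) (fromℤ-* (g v) (∏ℤ V g)) ⟩
  coeff (monomial m (fromℤ (g v ℤ.* ∏ℤ V g))) i ∎
  where
  open ≡-Reasoning
  m : ℕ
  m = length (List.filterᵇ (not ∘ q) V)
... | false = begin
  coeff (h v *P ∏ V h) i
    ≡⟨ cong (λ p → coeff (p *P ∏ V h) i) (e₂ v eq) ⟩
  coeff (X *P ∏ V h) i
    ≡⟨ X-*P (∏ V h) i ⟩
  coeff (shift (∏ V h)) i
    ≡⟨ shift-cong (∏ V h) (monomial m (fromℤ (∏ℤ V g))) (∏-monomial q g h e₁ e₂ e₃ V) i ⟩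
  coeff (shift (monomial m (fromℤ (∏ℤ V g)))) i
    ≡⟨ cong (λ z → coeff (shift (monomial m (fromℤ z))) i)
         (trans (cong (ℤ._* ∏ℤ V g) (e₃ v eq)) (ℤₚ.*-identityˡ (∏ℤ V g))) ⟨
  coeff (shift (monomial m (fromℤ (g v ℤ.* ∏ℤ V g)))) i ∎
  where
  open ≡-Reasoning
  m : ℕ
  m = length (List.filterᵇ (not ∘ q) V)

length-filter-split : ∀ {A : Set} (q : A → Bool) V →
  length (List.filterᵇ (not ∘ q) V) ℕ.+ length (List.filterᵇ q V) ≡ length V
length-filter-split q []      = refl
length-filter-split q (v ∷ V) with q v
... | true  = trans (ℕₚ.+-suc _ _) (cong suc (length-filter-split q V))
... | false = cong suc (length-filter-split q V)

∏ℤ-* : ∀ {A : Set} (f g : A → ℤ) V → ∏ℤ V (λ v → f v ℤ.* g v) ≡ ∏ℤ V f ℤ.* ∏ℤ V g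
∏ℤ-* f g []      = refl
∏ℤ-* f g (v ∷ V) = trans (cong (f v ℤ.* g v ℤ.*_) (∏ℤ-* f g V)) (lem (f v) (g v) _ _)
  where
  lem : ∀ a b c d → a ℤ.* b ℤ.* (c ℤ.* d) ≡ a ℤ.* c ℤ.* (b ℤ.* d)
  lem = solve-∀

∏ℤ-sgn : ∀ {A : Set} (q : A → Bool) V → ∏ℤ V (sgn ∘ q) ≡ minusOnePow (length (List.filterᵇ q V))
∏ℤ-sgn q []      = refl
∏ℤ-sgn q (v ∷ V) with q v
... | true  = trans (cong (-[1+ 0 ] ℤ.*_) (∏ℤ-sgn q V)) (ℤₚ.-1*i≡-i _)
... | false = trans (ℤₚ.*-identityˡ _) (∏ℤ-sgn q V)

∏ℤ-dbl : ∀ {A : Set} (q : A → Bool) V → ∏ℤ V (dbl ∘ q) ≡ + (2 ℕ.^ length (List.filterᵇ q V))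
∏ℤ-dbl q []      = refl
∏ℤ-dbl q (v ∷ V) with q v
... | true  = trans (cong (+ 2 ℤ.*_) (∏ℤ-dbl q V)) (sym (ℤₚ.pos-* 2 (2 ℕ.^ length (List.filterᵇ q V))))
... | false = trans (ℤₚ.*-identityˡ _) (∏ℤ-dbl q V)

minusOnePow-+ : ∀ a b → minusOnePow (a ℕ.+ b) ≡ minusOnePow a ℤ.* minusOnePow b
minusOnePow-+ zero    b = sym (ℤₚ.*-identityˡ _)
minusOnePow-+ (suc a) b = trans (cong ℤ.-_ (minusOnePow-+ a b)) (ℤₚ.neg-distribˡ-* (minusOnePow a) _)

minusOnePow-square : ∀ a → minusOnePow a ℤ.* minusOnePow a ≡ + 1
minusOnePow-square zero    = refl
minusOnePow-square (suc a) = trans (lem (minusOnePow a)) (minusOnePow-square a)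
  where
  lem : ∀ x → (ℤ.- x) ℤ.* (ℤ.- x) ≡ x ℤ.* x
  lem = solve-∀

-- For m vertices and t components the rank is m - t, and m + (m - t) has the parity of t. Thus the
-- part -k + r(G′) of the exponent amounts to one sign per component.
minusOnePow-∸ : ∀ {m t} → t ≤ m → minusOnePow (m ℕ.+ (m ℕ.∸ t)) ≡ minusOnePow t
minusOnePow-∸ {m} {t} t≤m = begin
  minusOnePow (m ℕ.+ d)                          ≡⟨ cong (λ z → minusOnePow (z ℕ.+ d)) (ℕₚ.m+[n∸m]≡n t≤m) ⟨
  minusOnePow (t ℕ.+ d ℕ.+ d)                    ≡⟨ cong minusOnePow (ℕₚ.+-assoc t d d) ⟩
  minusOnePow (t ℕ.+ (d ℕ.+ d))                  ≡⟨ minusOnePow-+ t (d ℕ.+ d) ⟩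
  minusOnePow t ℤ.* minusOnePow (d ℕ.+ d)        ≡⟨ cong (minusOnePow t ℤ.*_) (trans (minusOnePow-+ d d) (minusOnePow-square d)) ⟩
  minusOnePow t ℤ.* + 1                          ≡⟨ ℤₚ.*-identityʳ _ ⟩
  minusOnePow t                                  ∎
  where
  open ≡-Reasoning
  d : ℕ
  d = m ℕ.∸ t

-- The expansion of the characteristic polynomial of `G`.

module _ {n : ℕ} (G : MixedGraph n) where

  𝓜 : CharacteristicMatrix Poly-commutativeRing G
  𝓜 = record
    { x = X ; ν = constP ; ν-0 = constP-0 ; ν-1 = λ _ → refl
    ; ν-+ = λ _ _ _ → refl ; ν-* = constP-* ; ν-neg = λ _ _ → refl
    ; M = λ i j → (if ⌊ i Finₚ.≟ j ⌋ then X else []) +P (-P constP (N G i j))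
    ; M-diag = λ u i → diag u i ; M-off = λ {a} {b} ab i → off a b ab i }
    where
    diag : ∀ u → (if u == u then X else []) +P (-P constP (N G u u)) ≈P X
    diag u i = trans (cong₂ (λ b k → coeff ((if b then X else []) +P (-P constP (entry k))) i) (==-refl u) (loopless G u)) (at i)
      where
      at : ∀ i → coeff (X +P (-P constP 0ω)) i ≡ coeff X i
      at zero    = refl
      at (suc i) = refl
    off : ∀ a b → a ≢ b → (if a == b then X else []) +P (-P constP (N G a b)) ≈P -P constP (N G a b)
    off a b ab i = cong (λ t → coeff ((if t then X else []) +P (-P constP (N G a b))) i) (≢⇒== ab)

  open CharacteristicMatrix 𝓜 using (M)
  open Determinant Poly-commutativeRing
  open Walks M

  weight : Edges n → Fin n → ℤ
  weight S v = factor (isRep S v) (isCycleRep S v) (cycleWeight G S v)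

  elementaryAt : Edges n → Fin n → Bool
  elementaryAt S v = compIsEdge S v ∨ compIsCycle S v

  contribution : Edges n → Fin n → Poly
  contribution S v = if inV S v then (if elementaryAt S v then constP (fromℤ (weight S v)) else []) else X

  ∅ : Used n
  ∅ _ _ = false

  expand-S : ∀ S → S ∈ sublists (edges G) →
    Pf n (leaf Poly-commutativeRing (edges G) S) (allFin n) ∅ ≈P ∏ (allFin n) (contribution S)
  expand-S S S∈ = FixedSubgraph.Pf≈∏φ 𝓜 S S∈ n (record
    { sorted = AllPairsₚ.tabulate⁺-< id
    ; usym   = id
    ; closed = λ {_} {b} _ _ → ∈-allFin b
    ; out    = λ {a} a∉ _ → contradiction (∈-allFin a) a∉
    ; sub    = λ _ ()
    ; new    = λ _ → refl })
    (ℕₚ.≤-reflexive (Listₚ.length-tabulate {n = n} id))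

  charPoly-expansion : charPoly G ≈P ∑ (sublists (edges G)) (λ S → ∏ (allFin n) (contribution S))
  charPoly-expansion i = begin
    coeff (charPoly G) i
      ≡⟨ DetPoly.det≈detL M n id id i ⟩
    coeff (detL M (allFin n) (allFin n)) i
      ≡⟨ detL-Pf n (allFin n) ∅ (Uniqueₚ.allFin⁺ n) (ℕₚ.≤-reflexive (Listₚ.length-tabulate {n = n} id)) i ⟩
    coeff (Pf n (λ _ → constP 1ω) (allFin n) ∅) i
      ≡⟨ Pf-cong (λ U j → ∑-leaf Poly-commutativeRing (edges G) (proj₁ ∘ ∈-edges⁻ G) (edges-Unique G) U j) n (allFin n) ∅ i ⟨
    coeff (Pf n (λ U → ∑ Ss (λ S → leaf Poly-commutativeRing (edges G) S U)) (allFin n) ∅) i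
      ≡⟨ Pf-∑ Ss (leaf Poly-commutativeRing (edges G)) n (allFin n) ∅ i ⟩
    coeff (∑ Ss (λ S → Pf n (leaf Poly-commutativeRing (edges G) S) (allFin n) ∅)) i
      ≡⟨ ∑-cong∈ Ss {λ S → Pf n (leaf Poly-commutativeRing (edges G) S) (allFin n) ∅}
           {λ S → ∏ (allFin n) (contribution S)} (λ {S} → expand-S S) i ⟩
    coeff (∑ Ss (λ S → ∏ (allFin n) (contribution S))) i ∎
    where
    open ≡-Reasoning
    Ss : List (Edges n)
    Ss = sublists (edges G)

  term : ℕ → Edges n → ℤ
  term k S = minusOnePow (k ℕ.+ rk S ℕ.+ l-sn G S ℕ.+ l-n G S) ℤ.* (+ (2 ℕ.^ (l-p G S ℕ.+ l-n G S)))

  -- `factor` is a product of five values, each ±1 or a power of two switched by a condition on the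
  -- vertex. Multiplied over all vertices, each becomes a power whose exponent counts that
  -- condition: `tC`, `l-p`, `l-n` twice, and `l-sn`.
  ∏-weight : ∀ S → ∏ℤ (allFin n) (weight S) ≡ term (nV S) S
  ∏-weight S = begin
    ∏ℤ V (weight S)
      ≡⟨ trans (∏ℤ-* (sgn ∘ rep) _ V) (cong₂ ℤ._*_ (∏ℤ-sgn rep V)
          (trans (∏ℤ-* (dbl ∘ pos) _ V) (cong₂ ℤ._*_ (∏ℤ-dbl pos V)
            (trans (∏ℤ-* (sgn ∘ neg) _ V) (cong₂ ℤ._*_ (∏ℤ-sgn neg V)
              (trans (∏ℤ-* (dbl ∘ neg) _ V) (cong₂ ℤ._*_ (∏ℤ-dbl neg V) (∏ℤ-sgn semi V)))))))) ⟩
    minusOnePow (tC S) ℤ.* (+ (2 ℕ.^ l-p G S) ℤ.* (minusOnePow (l-n G S)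
      ℤ.* (+ (2 ℕ.^ l-n G S) ℤ.* minusOnePow (l-sn G S))))
      ≡⟨ rearrange (minusOnePow (tC S)) (+ (2 ℕ.^ l-p G S)) (minusOnePow (l-n G S)) (+ (2 ℕ.^ l-n G S)) (minusOnePow (l-sn G S)) ⟩
    minusOnePow (tC S) ℤ.* minusOnePow (l-sn G S) ℤ.* minusOnePow (l-n G S)
      ℤ.* (+ (2 ℕ.^ l-p G S) ℤ.* + (2 ℕ.^ l-n G S))
      ≡⟨ cong₂ ℤ._*_ signs powers ⟨
    term (nV S) S ∎
    where
    open ≡-Reasoning
    V : List (Fin n)
    V = allFin n
    rep pos neg semi : Fin n → Bool
    rep  = isRep S
    pos  v = isCycleRep S v ∧ (cycleWeight G S v ==ω 1ω)
    neg  v = isCycleRep S v ∧ (cycleWeight G S v ==ω (-ω 1ω))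
    semi v = isCycleRep S v ∧ ((cycleWeight G S v ==ω (-ω ω)) ∨ (cycleWeight G S v ==ω (-ω ω̄)))
    rearrange : ∀ t p s d m → t ℤ.* (p ℤ.* (s ℤ.* (d ℤ.* m))) ≡ t ℤ.* m ℤ.* s ℤ.* (p ℤ.* d)
    rearrange = solve-∀
    tC≤nV : tC S ≤ nV S
    tC≤nV = count-mono {p = isRep S} {inV S} (λ {v} e → proj₁ (∧-true {inV S v} e))
    signs : minusOnePow (nV S ℕ.+ rk S ℕ.+ l-sn G S ℕ.+ l-n G S)
            ≡ minusOnePow (tC S) ℤ.* minusOnePow (l-sn G S) ℤ.* minusOnePow (l-n G S)
    signs = trans (minusOnePow-+ (nV S ℕ.+ rk S ℕ.+ l-sn G S) (l-n G S))
      (cong (ℤ._* minusOnePow (l-n G S)) (trans (minusOnePow-+ (nV S ℕ.+ rk S) (l-sn G S))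
        (cong (ℤ._* minusOnePow (l-sn G S)) (minusOnePow-∸ tC≤nV))))
    powers : + (2 ℕ.^ (l-p G S ℕ.+ l-n G S)) ≡ + (2 ℕ.^ l-p G S) ℤ.* + (2 ℕ.^ l-n G S)
    powers = trans (cong +_ (ℕₚ.^-distribˡ-+-* 2 (l-p G S) (l-n G S))) (ℤₚ.pos-* (2 ℕ.^ l-p G S) _)

  non-elementary : ∀ S → isElementary S ≡ false → ∏ (allFin n) (contribution S) ≈P []
  non-elementary S e with allL-false⁻ (λ v → not (inV S v) ∨ elementaryAt S v) (allFin n) e
  ... | v , ev = ∏-zero∈ (allFin n) (contribution S) (∈-allFin v) λ i →
        cong (λ p → coeff p i) (vanish (inV S v) (elementaryAt S v) ev)
    where
    vanish : ∀ a b → not a ∨ b ≡ false → (if a then (if b then constP (fromℤ (weight S v)) else []) else X) ≡ []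
    vanish true false _ = refl

  elementary : ∀ S → isElementary S ≡ true →
    ∏ (allFin n) (contribution S) ≈P monomial (n ℕ.∸ nV S) (fromℤ (term (nV S) S))
  elementary S e i = trans
    (∏-monomial (inV S) (weight S) (contribution S) const isolated unit (allFin n) i)
    (cong₂ (λ m z → coeff (monomial m (fromℤ z)) i) isolated-count (∏-weight S))
    where
    isolated-count : length (List.filterᵇ (not ∘ inV S) (allFin n)) ≡ n ℕ.∸ nV S
    isolated-count = sym (trans
      (cong (ℕ._∸ nV S) (sym (trans (length-filter-split (inV S) (allFin n)) (Listₚ.length-tabulate {n = n} id))))
      (ℕₚ.m+n∸n≡m _ (nV S)))
    const : ∀ v → inV S v ≡ true → contribution S v ≡ constP (fromℤ (weight S v))
    const v iv = pick (inV S v) (elementaryAt S v) iv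
      (allL⁻ (λ v → not (inV S v) ∨ elementaryAt S v) e (∈-allFin v))
      where
      pick : ∀ a b → a ≡ true → not a ∨ b ≡ true →
        (if a then (if b then constP (fromℤ (weight S v)) else []) else X) ≡ constP (fromℤ (weight S v))
      pick true true _ _ = refl
    isolated : ∀ v → inV S v ≡ false → contribution S v ≡ X
    isolated v iv = cong (λ a → if a then (if elementaryAt S v then constP (fromℤ (weight S v)) else []) else X) iv
    unit : ∀ v → inV S v ≡ false → weight S v ≡ + 1
    unit v iv = cong (λ b → factor b (b ∧ compIsCycle S v) (cycleWeight G S v))
      (cong (_∧ allF (λ u → not (comp S v u) ∨ ⌊ v Fin.≤? u ⌋)) iv)

  coeff-contribution : ∀ {k} → k ≤ n → ∀ S → coeff (∏ (allFin n) (contribution S)) (n ℕ.∸ k)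
    ≡ (if isElementary S ∧ (nV S ℕ.≡ᵇ k) then fromℤ (term k S) else 0ω)
  coeff-contribution {k} k≤n S = byElementary (isElementary S) refl
    where
    byElementary : ∀ b → isElementary S ≡ b → coeff (∏ (allFin n) (contribution S)) (n ℕ.∸ k)
      ≡ (if b ∧ (nV S ℕ.≡ᵇ k) then fromℤ (term k S) else 0ω)
    byElementary false e = non-elementary S e (n ℕ.∸ k)
    byElementary true  e = trans (elementary S e (n ℕ.∸ k))
      (trans (coeff-monomial (n ℕ.∸ nV S) (fromℤ (term (nV S) S)) (n ℕ.∸ k)) (byOrder (nV S) (count≤n (inV S))))
      where
      byOrder : ∀ m → m ≤ n → (if (n ℕ.∸ m) ℕ.≡ᵇ (n ℕ.∸ k) then fromℤ (term m S) else 0ω)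
        ≡ (if m ℕ.≡ᵇ k then fromℤ (term k S) else 0ω)
      byOrder m m≤n with m ℕ.≟ k
      ... | yes refl rewrite ≡ᵇ-true {n ℕ.∸ k} refl | ≡ᵇ-true {k} refl = refl
      -- Truncated subtraction from n is injective only up to n, so both bounds are needed to tell
      -- the exponents n ∸ m and n ∸ k apart.
      ... | no m≢k rewrite ≡ᵇ-false {n ℕ.∸ m} (m≢k ∘ ℕₚ.∸-cancelˡ-≡ m≤n k≤n) | ≡ᵇ-false m≢k = refl

coeff-∑ : ∀ {A : Set} (p : A → Poly) (q : A → Bool) (t : A → ℤ) i →
  (∀ S → coeff (p S) i ≡ (if q S then fromℤ (t S) else 0ω)) →
  ∀ Ss → coeff (∑ Ss p) i ≡ fromℤ (sumℤ (map t (List.filterᵇ q Ss)))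
coeff-∑ p q t i h []       = refl
coeff-∑ p q t i h (S ∷ Ss) = trans (coeff-+P (p S) (∑ Ss p) i)
  (trans (cong₂ _+ω_ (h S) (coeff-∑ p q t i h Ss)) step)
  where
  step : (if q S then fromℤ (t S) else 0ω) +ω fromℤ (sumℤ (map t (List.filterᵇ q Ss)))
    ≡ fromℤ (sumℤ (map t (List.filterᵇ q (S ∷ Ss))))
  step with q S
  ... | true  = refl
  ... | false = +ω-identityˡ _

theorem2p6 : (n : ℕ) (G : MixedGraph n) (k : ℕ) → 1 ≤ k → k ≤ n →
    c G k ≡ fromℤ (rhs G k)
theorem2p6 n G k _ k≤n = trans (charPoly-expansion G (n ℕ.∸ k))
  (coeff-∑ (λ S → ∏ (allFin n) (contribution G S)) _ (term G k) (n ℕ.∸ k)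
    (coeff-contribution G k≤n) (sublists (edges G)))
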